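{- Let $L,M$ be nonnegative integers and $(a,b)$ a pair of coprime integers with $1\leq b<a$, with continued fraction order $n$, and $\bar a,\bar b$ and $H_{a,b}(L,M)$ as defined below. (i) If either $a<2b$ and $n$ is even, or $a>2b$ and $n$ is odd, then \[ \sum_{j\in\mathbb{Z}}(-1)^j q^{\frac{1}{2}j((2ab+1)j+4\bar{a}b+1)+\bar{a}\bar{b}} \mathcal{B}(L,M,aj+\bar{a},bj+\bar{b})=H_{a,b}(L,M). \] (ii) If either $a<2b$ and $n$ is odd, or $a\geq 2b$ and $n$ is even, then \[ \sum_{j\in\mathbb{Z}}(-1)^j q^{\frac{1}{2}j((2ab+1)j+4a\bar{b}+1)+\bar{a}\bar{b}} \mathcal{B}(L,M,aj+\bar{a},bj+\bar{b})=H_{a,b}(L,M). \]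
   Context: $(x)_n=(x;q)_n=\prod_{i=0}^{n-1}(1-xq^i)$; $\left[{n\atop m}\right]=\frac{(q)_n}{(q)_m(q)_{n-m}}$ if $m,n-m\in\mathbb{Z}_{\geq 0}$ and $0$ otherwise; $\mathcal{B}(L,M,a,b)=\left[{L+M+a-b\atop L+a}\right]\left[{L+M-a+b\atop L-a}\right]$. Continued fraction data: with $\mathrm{sign}(0)=0$, write $(a/b-1)^{\mathrm{sign}(a-2b)}=[a_0,\dots,a_n]=a_0+1/(a_1+1/(\cdots+1/a_n))$ with positive integers $a_i$, choosing the representation with $a_n\geq 2$ when $(a,b)\neq(2,1)$ (and $[1]$ for $(a,b)=(2,1)$); $n$ is the order. Put $t_0=0$, $t_j=a_0+\cdots+a_{j-1}$ ($1\le j\le n+1$), $d=t_{n+1}$. Let $\mathcal{I}$ be the $d\times d$ matrix with $\mathcal{I}_{j,k}=\delta_{j,k+1}+\delta_{j,k-1}$ if $j\notin\{t_1,\dots,t_{n+1}\}$ and $\mathcal{I}_{j,k}=\delta_{j,k+1}+\delta_{j,k}-\delta_{j,k-1}$ otherwise; $C=2I-\mathcal{I}$. For $m\in\mathbb{Z}_{\ge0}^d$: $mCm=\sum_{j,k}m_jC_{j,k}m_k$, $A_m=2m_d-2m_{d-1}+1$, $\tau_1=\dots=\tau_{d-1}=2$, $\tau_d=1$, $n_j=L\delta_{j,1}-\sum_kC_{j,k}m_k$. The pair $(\bar a,\bar b)$: $(\bar a,\bar b)=(1,0)$ if $b=1$; $(\bar a,\bar b)=(1,1)$ if $b=a-1$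 and $a>2$; otherwise $\bar a,\bar b$ are the positive coprime integers with $\bar a/\bar b=[1,a_0,\dots,a_{n-1}]$ if $a<2b$ and $\bar a/\bar b=[a_0+1,a_1,\dots,a_{n-1}]$ if $a>2b$. $H_{2,1}(L,M)=\sum_{k\ge0}q^{k^2}\left[{2L+M-k-1\atop 2L-1}\right]\left[{L-1\atop k}\right]$. For $(a,b)\neq(2,1)$: if $a<2b$, $H_{a,b}(L,M)=\sum_{m\in\mathbb{Z}_{\ge0}^d}q^{mCm+A_m}\left[{2L+M-m_1\atop 2L}\right]\prod_{j=1}^d\left[{\tau_jm_j+n_j-\delta_{j,d}\atop\tau_jm_j-\delta_{j,d-1}}\right]$; if $a>2b$, $H_{a,b}(L,M)=\sum_{m\in\mathbb{Z}_{\ge0}^d}q^{L(L-2m_1)+mCm+A_m}\left[{L+M+m_1\atop 2L}\right]\prod_{j=1}^d\left[{\tau_jm_j+n_j-\delta_{j,d}\atop\tau_jm_j-\delta_{j,d-1}}\right]$. -}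

module Defs where

open import Data.Nat as ℕ using (ℕ; zero; suc; _≡ᵇ_)
open import Data.Nat.DivMod using (_%_)
open import Data.Integer as ℤ using (ℤ; +_; -[1+_]; ∣_∣)
open import Data.Bool using (Bool; true; false; if_then_else_; _∨_)
open import Data.List as List using (List; []; _∷_; upTo; map; foldr; concatMap; _++_; drop)
open import Data.Vec as Vec using (Vec; toList; head; last; init)
open import Data.Product using (_×_; _,_; proj₁; proj₂; Σ)
open import Relation.Binary.PropositionalEquality using (_≡_)
open import Data.List.Membership.Propositional using (_∈_)
open import Data.Empty using (⊥)
open import Relation.Nullary using (¬_)
open import Data.Nat.Coprimality using (Coprime)

-- Formal power series in q with integer coefficients: coefficient maps.

PS : Set
PS = ℕ → ℤ

sumℤ : List ℤ → ℤ
sumℤ = foldr ℤ._+_ (+ 0)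

sumUpTo : ℕ → (ℕ → ℤ) → ℤ
sumUpTo k f = sumℤ (map f (upTo (suc k)))

zeroPS : PS
zeroPS _ = + 0

onePS : PS
onePS zero    = + 1
onePS (suc _) = + 0

_*PS_ : PS → PS → PS
(f *PS g) k = sumUpTo k (λ i → f i ℤ.* g (k ℕ.∸ i))

prodPS : List PS → PS
prodPS = foldr _*PS_ onePS

oneMinusQPow : ℕ → PS
oneMinusQPow i k = if k ≡ᵇ 0 then + 1 else (if k ≡ᵇ suc i then ℤ.- (+ 1) else + 0)

-- 1/(1 - q^(i+1)) = Σ_t q^{(i+1)t}
geomInv : ℕ → PS
geomInv i k = if (k % suc i) ≡ᵇ 0 then + 1 else + 0

qPoch : ℕ → PS
qPoch n = prodPS (map oneMinusQPow (upTo n))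

qPochInv : ℕ → PS
qPochInv n = prodPS (map geomInv (upTo n))

gaussNat : ℕ → ℕ → PS
gaussNat m r = qPoch (m ℕ.+ r) *PS (qPochInv m *PS qPochInv r)

gauss : ℤ → ℤ → PS
gauss n m with m | n ℤ.- m
... | + m' | + r' = gaussNat m' r'
... | _    | _    = zeroPS

calB : ℕ → ℕ → ℤ → ℤ → PS
calB L M a b =
  gauss (+ L ℤ.+ + M ℤ.+ a ℤ.- b) (+ L ℤ.+ a) *PS
  gauss (+ L ℤ.+ + M ℤ.- a ℤ.+ b) (+ L ℤ.- a)

shiftCoeff : ℤ → PS → ℤ → ℤ
shiftCoeff e P k with k ℤ.- e
... | + t      = P t
... | -[1+ _ ] = + 0

signPow : ℤ → ℤ
signPow j = (ℤ.- (+ 1)) ℤ.^ ∣ j ∣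

symRange : ℕ → List ℤ
symRange N = map +_ (upTo (suc N)) ++ map -[1+_] (upTo N)

Limit : (ℕ → ℤ) → ℤ → Set
Limit u c = Σ ℕ (λ N₀ → ∀ N → N₀ ℕ.≤ N → u N ≡ c)

-- Two formal (Laurent) series, each given by its sequence of partial sums
-- (partial-sum index N, then coefficient index k), converge coefficientwise
-- and have the same sum.
SameSum : (ℕ → ℤ → ℤ) → (ℕ → ℤ → ℤ) → Set
SameSum S T = ∀ (k : ℤ) → Σ ℤ (λ c → Limit (λ N → S N k) c × Limit (λ N → T N k) c)

-- value of [x₀, …, x_n] as a (numerator, denominator) pair; [] ↦ 1/0
cfEval : List ℕ → ℕ × ℕ
cfEval []       = 1 , 0
cfEval (x ∷ xs) with cfEval xs
... | P , Q = x ℕ.* P ℕ.+ Q , P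

-- (a/b - 1)^{sign(a - 2b)} as a pair (numerator, denominator)
cfTarget : ℕ → ℕ → ℕ × ℕ
cfTarget a b with a ℕ.<ᵇ 2 ℕ.* b | 2 ℕ.* b ℕ.<ᵇ a
... | true  | _     = b , a ℕ.∸ b
... | false | true  = a ℕ.∸ b , b
... | false | false = 1 , 1

-- as = (a₀,…,a_n) is the continued fraction expansion of (a,b) described in
-- the paper: positive entries, value (a/b-1)^{sign(a-2b)}, and a_n ≥ 2
-- unless (a,b) = (2,1) (where positivity and value force as = [1]).
IsCF : ℕ → ℕ → (n : ℕ) → Vec ℕ (suc n) → Set
IsCF a b n as =
  (∀ x → x ∈ toList as → 1 ℕ.≤ x) ×
  (proj₁ (cfEval (toList as)) ℕ.* proj₂ (cfTarget a b)
     ≡ proj₁ (cfTarget a b) ℕ.* proj₂ (cfEval (toList as))) ×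
  (¬ (a ≡ 2 × b ≡ 1) → 2 ℕ.≤ last as)

-- the continued fraction whose value is ā/b̄ in the generic case:
-- [1, a₀, …, a_{n-1}] if a < 2b,  [a₀+1, a₁, …, a_{n-1}] otherwise
barCF : ℕ → ℕ → (n : ℕ) → Vec ℕ (suc n) → List ℕ
barCF a b n as with a ℕ.<ᵇ 2 ℕ.* b
... | true  = 1 ∷ toList (init as)
... | false = (head as ℕ.+ 1) ∷ drop 1 (toList (init as))

IsBar : ℕ → ℕ → (n : ℕ) → Vec ℕ (suc n) → ℕ → ℕ → Set
IsBar a b n as ā b̄ =
  (b ≡ 1 → ā ≡ 1 × b̄ ≡ 0) ×
  (¬ (b ≡ 1) → b ≡ a ℕ.∸ 1 → 2 ℕ.< a → ā ≡ 1 × b̄ ≡ 1) ×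
  (¬ (b ≡ 1) → ¬ (b ≡ a ℕ.∸ 1 × 2 ℕ.< a) →
     1 ℕ.≤ ā × 1 ℕ.≤ b̄ × Coprime ā b̄ ×
     ā ℕ.* proj₂ (cfEval (barCF a b n as)) ≡ proj₁ (cfEval (barCF a b n as)) ℕ.* b̄)

tList : List ℕ → List ℕ
tList []       = []
tList (x ∷ xs) = x ∷ map (x ℕ.+_) (tList xs)

dOf : List ℕ → ℕ
dOf = foldr ℕ._+_ 0

δ : ℕ → ℕ → ℤ
δ j k = if j ≡ᵇ k then + 1 else + 0

-- 𝓘_{j,k} (indices 1..d); note δ_{j,k-1} = [j+1 = k]
calI : List ℕ → ℕ → ℕ → ℤ
calI as j k with foldr (λ t r → (t ≡ᵇ j) ∨ r) false (tList as)
... | false = δ j (suc k) ℤ.+ δ (suc j) k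
... | true  = δ j (suc k) ℤ.+ δ j k ℤ.- δ (suc j) k

Cmat : List ℕ → ℕ → ℕ → ℤ
Cmat as j k = (+ 2) ℤ.* δ j k ℤ.- calI as j k

sumOneTo : ℕ → (ℕ → ℤ) → ℤ
sumOneTo d f = sumℤ (map (λ i → f (suc i)) (upTo d))

-- m_j for 1 ≤ j ≤ d, with m given as the list (m₁,…,m_d)
mAt : List ℕ → ℕ → ℕ
mAt m zero          = 0
mAt []       (suc j) = 0
mAt (x ∷ xs) (suc zero) = x
mAt (x ∷ xs) (suc (suc j)) = mAt xs (suc j)

box : ℕ → ℕ → List (List ℕ)
box zero    N = [] ∷ []
box (suc d) N = concatMap (λ i → map (i ∷_) (box d N)) (upTo (suc N))

module _ (as : List ℕ) (L : ℕ) (m : List ℕ) where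
  private
    d = dOf as
    mm : ℕ → ℤ
    mm j = + mAt m j
    C = Cmat as

  mCm : ℤ
  mCm = sumOneTo d (λ j → sumOneTo d (λ k → mm j ℤ.* C j k ℤ.* mm k))

  Am : ℤ
  Am = (+ 2) ℤ.* mm d ℤ.- (+ 2) ℤ.* mm (d ℕ.∸ 1) ℤ.+ + 1

  τ : ℕ → ℤ
  τ j = if j ≡ᵇ d then + 1 else + 2

  nj : ℕ → ℤ
  nj j = + L ℤ.* δ j 1 ℤ.- sumOneTo d (λ k → C j k ℤ.* mm k)

  prodFactor : PS
  prodFactor = prodPS (map (λ i → let j = suc i in
                   gauss (τ j ℤ.* mm j ℤ.+ nj j ℤ.- δ j d)
                         (τ j ℤ.* mm j ℤ.- δ (suc j) d))
                 (upTo d))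

Hpartial : ℕ → ℕ → List ℕ → ℕ → ℕ → ℕ → ℤ → ℤ
Hpartial a b as L M N k with a ≡ᵇ 2 | b ≡ᵇ 1 | a ℕ.<ᵇ 2 ℕ.* b
... | true | true | _ =
  sumℤ (map (λ i → shiftCoeff (+ (i ℕ.* i))
                 (gauss (+ (2 ℕ.* L ℕ.+ M) ℤ.- + i ℤ.- + 1) (+ (2 ℕ.* L) ℤ.- + 1) *PS
                  gauss (+ L ℤ.- + 1) (+ i)) k)
            (upTo (suc N)))
... | _ | _ | true =
  sumℤ (map (λ m → shiftCoeff (mCm as L m ℤ.+ Am as L m)
                 (gauss (+ (2 ℕ.* L ℕ.+ M) ℤ.- + mAt m 1) (+ (2 ℕ.* L)) *PS
                  prodFactor as L m) k)
            (box (dOf as) N))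
... | _ | _ | false =
  sumℤ (map (λ m → shiftCoeff (+ L ℤ.* (+ L ℤ.- (+ 2) ℤ.* + mAt m 1)
                                ℤ.+ mCm as L m ℤ.+ Am as L m)
                 (gauss (+ (L ℕ.+ M ℕ.+ mAt m 1)) (+ (2 ℕ.* L)) *PS
                  prodFactor as L m) k)
            (box (dOf as) N))

-- Left-hand sides: partial sums over -N ≤ j ≤ N.
-- The q-exponent is ½ j((2ab+1)j + c + 1) + āb̄ with c = 4āb (part (i))
-- or c = 4ab̄ (part (ii)); the numerator is always even.

lhsPartial : ℕ → ℕ → ℕ → ℕ → ℕ → ℕ → ℕ → ℕ → ℤ → ℤ
lhsPartial a b ā b̄ c L M N k =
  sumℤ (map (λ j → signPow j ℤ.*
                   shiftCoeff ((j ℤ.* ((+ (2 ℕ.* a ℕ.* b ℕ.+ 1)) ℤ.* j ℤ.+ + c ℤ.+ + 1)) ℤ./ (+ 2)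
                               ℤ.+ + (ā ℕ.* b̄))
                     (calB L M (+ a ℤ.* j ℤ.+ + ā) (+ b ℤ.* j ℤ.+ + b̄)) k)
            (symRange N))

{-# OPTIONS --safe #-}
module Submission where

-- Both sides obey the same recursion along the continued fraction of a/b. On the left it is the
-- Burge transform: for α, β of equal sign,
--   Σ_i q^{i²} [2L+M-i; 2L] 𝓑(i, L-i, α, β) = q^{α²} 𝓑(L, M, α+β, α),
-- and the same with (q^{β²}, β) in place of (q^{α²}, α) on replacing i by L-i; it is a form of the
-- q-Pfaff–Saalschütz sum, which follows from two applications of q-Vandermonde. Applied termwise
-- with (α, β) = (aj+ā, bj+b̄) it turns the identity for (a, b) into the one for (a+b, a) or
-- (a+b, b). On the right, the first row and column of C split off, and the sum over m₁ is the
-- same transform of the function H of the shorter continued fraction.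
-- The recursion ends at (2, 1). There, expanding [L-1; k] by
--   Σ_j (-1)^j q^{j(3j+1)/2} [T+1; K+j] [T; K-1-j] = [T; K-1]
-- reduces H₂₁ to the q-Saalschütz sum once more, and one q-Pascal step, whose second half cancels
-- under j ↦ -1-j, produces the left-hand side.

open import Defs
open import Algebra.Bundles using (CommutativeRing)
import Algebra.Properties.Ring
import Algebra.Properties.Semiring.Exp
import Algebra.Solver.Ring.NaturalCoefficients.Default as SemiringSolver
open import Data.Bool.Base as Bool using (Bool; true; false; not; if_then_else_; _∨_)
open import Data.Empty using (⊥-elim)
open import Data.Integer.Base as ℤ using (ℤ; +_; -[1+_]; ∣_∣)
import Data.Integer.DivMod as ℤ-DivMod
import Data.Integer.Properties as ℤₚ
open import Data.Integer.Tactic.RingSolver using () renaming (solve-∀ to solveℤ)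
open import Data.List.Base as List using (List; []; _∷_; upTo; applyUpTo; _++_; concatMap)
import Data.List.Properties as Listₚ
open import Data.List.Membership.Propositional using (_∈_)
open import Data.List.Relation.Unary.Any using (here; there)
open import Data.Nat.Base as ℕ using (ℕ; suc; zero; _≤_; _<_; z≤n; s≤s; _∸_; _≡ᵇ_)
open import Data.Nat.Coprimality as Coprimality using (Coprime; coprime-+; coprime-divisor)
open import Data.Nat.Divisibility using (_∣_; divides; ∣-antisym; ∣m∣n⇒∣m+n; ∣-refl; ∣1⇒≡1)
import Data.Nat.DivMod as ℕ-DivMod
import Data.Nat.Properties as ℕₚ
open import Data.Nat.Tactic.RingSolver using () renaming (solve-∀ to solveℕ)
open import Data.Product.Base using (_,_; ∃; _×_; proj₁; proj₂)
open import Data.Sum.Base using (_⊎_; inj₁; inj₂)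
open import Data.Vec.Base using (Vec; []; _∷_; toList; init; last)
open import Function.Base using (_∘_)
open import Level using (_⊔_; 0ℓ)
open import Relation.Binary.PropositionalEquality as ≡ using (_≡_; _≢_; _≗_)
import Relation.Binary.Reasoning.Setoid as SetoidReasoning
open import Relation.Nullary using (¬_; yes; no; contradiction)

-- The pair (ā, b̄) is carried along by the same linear maps as (a, b), from (1, 0) beside (2, 1),
-- so ā/b̄ is the convergent preceding a/b. The determinant a b̄ - ā b starts at -1, keeps its sign
-- under (a, b) ↦ (a + b, b) and changes it under (a, b) ↦ (a + b, a). Beyond j(j + 1)/2 the linear
-- coefficient of the exponent is always twice the smaller of a b̄ and ā b; this is the origin of
-- the two cases and of the parity of n. The bounds ā ≤ a and b̄ ≤ b propagate too and put a j + ā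
-- and b j + b̄ on the same side of 0 for every j. For opposite signs the transform fails: its left
-- side can vanish while the right one does not. Unless (a, b) = (2, 1), the list (a_0, ..., a_n)
-- evaluates to the pair one transform before (a, b). The induction runs along the list, and a last
-- transform, chosen by the sign of a - 2b, is added outside it. No limit has to be taken: the
-- transform calls the shorter identity only at (i, L - i) with i ≤ L, so every truncation |j| ≤ N,
-- m_k ≤ N with N ≥ L is already exact. All sums are finite, over a ring in which the 1 - q^i are
-- invertible.

record QuantumParameter {c ℓ} (R : CommutativeRing c ℓ) : Set (c ⊔ ℓ) where
  open CommutativeRing R
  open Algebra.Properties.Semiring.Exp semiring using (_^_)
  field
    q       : Carrier
    inv     : ℕ → Carrier
    inverse : ∀ i → (1# - q ^ suc i) * inv i ≈ 1#

-- q-binomial coefficients and the q-Vandermonde sum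

module QBinomial {c ℓ} (R : CommutativeRing c ℓ) (Qp : QuantumParameter R) where
  open CommutativeRing R hiding (zero)
  open QuantumParameter Qp
  open Algebra.Properties.Semiring.Exp semiring using (_^_; ^-homo-*)
  open Algebra.Properties.Ring ring using (-‿distribʳ-*)
  open SemiringSolver commutativeSemiring using (solve; _:+_; _:*_; _:=_)
  open SetoidReasoning setoid

  +-interchange : ∀ a b c d → (a + b) + (c + d) ≈ (a + c) + (b + d)
  +-interchange = solve 4 (λ a b c d → (a :+ b) :+ (c :+ d) := (a :+ c) :+ (b :+ d)) refl

  abstract
    ∑ : ℕ → (ℕ → Carrier) → Carrier
    ∑ zero    f = 0#
    ∑ (suc n) f = f 0 + ∑ n (λ i → f (suc i))

    ∑-cong : ∀ n {f g : ℕ → Carrier} → (∀ i → i < n → f i ≈ g i) → ∑ n f ≈ ∑ n g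
    ∑-cong zero    f≈g = refl
    ∑-cong (suc n) f≈g = +-cong (f≈g 0 (s≤s z≤n)) (∑-cong n λ i i<n → f≈g (suc i) (s≤s i<n))

    ∑-0 : ∀ f → ∑ 0 f ≈ 0#
    ∑-0 f = refl

    ∑-suc : ∀ n f → ∑ (suc n) f ≈ f 0 + ∑ n (λ i → f (suc i))
    ∑-suc n f = refl

    ∑-zero : ∀ n {f : ℕ → Carrier} → (∀ i → i < n → f i ≈ 0#) → ∑ n f ≈ 0#
    ∑-zero zero    f≈0 = refl
    ∑-zero (suc n) f≈0 =
      trans (+-cong (f≈0 0 (s≤s z≤n)) (∑-zero n λ i i<n → f≈0 (suc i) (s≤s i<n))) (+-identityˡ 0#)

    ∑-distrib-+ : ∀ n (f g : ℕ → Carrier) → ∑ n (λ i → f i + g i) ≈ ∑ n f + ∑ n g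
    ∑-distrib-+ zero    f g = sym (+-identityˡ 0#)
    ∑-distrib-+ (suc n) f g =
      trans (+-congˡ (∑-distrib-+ n (λ i → f (suc i)) (λ i → g (suc i)))) (+-interchange _ _ _ _)

    *-distribˡ-∑ : ∀ n x (f : ℕ → Carrier) → x * ∑ n f ≈ ∑ n (λ i → x * f i)
    *-distribˡ-∑ zero    x f = zeroʳ x
    *-distribˡ-∑ (suc n) x f =
      trans (distribˡ x _ _) (+-congˡ (*-distribˡ-∑ n x (λ i → f (suc i))))

    ∑-comm : ∀ m n (f : ℕ → ℕ → Carrier) → ∑ m (λ i → ∑ n (f i)) ≈ ∑ n (λ j → ∑ m (λ i → f i j))
    ∑-comm zero    n f = sym (∑-zero n λ _ _ → refl)
    ∑-comm (suc m) n f =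
      trans (+-congˡ (∑-comm m n (λ i → f (suc i))))
            (sym (∑-distrib-+ n (f 0) (λ j → ∑ m (λ i → f (suc i) j))))

    ∑-last : ∀ n (f : ℕ → Carrier) → ∑ (suc n) f ≈ ∑ n f + f n
    ∑-last zero    f = +-comm (f 0) 0#
    ∑-last (suc n) f =
      trans (+-congˡ (∑-last n (λ i → f (suc i)))) (sym (+-assoc _ _ _))

    ∑-reverse : ∀ n (f : ℕ → Carrier) → ∑ (suc n) f ≈ ∑ (suc n) (λ i → f (n ∸ i))
    ∑-reverse zero    f = refl
    ∑-reverse (suc n) f = begin
      ∑ (suc (suc n)) f ≈⟨ ∑-last (suc n) f ⟩
      ∑ (suc n) f + f (suc n) ≈⟨ +-comm _ _ ⟩
      f (suc n) + ∑ (suc n) f ≈⟨ +-congˡ (∑-reverse n f) ⟩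
      f (suc n) + ∑ (suc n) (λ i → f (n ∸ i)) ∎

    ∑-pad : ∀ m k (f : ℕ → Carrier) → (∀ i → m ≤ i → f i ≈ 0#) → ∑ (m ℕ.+ k) f ≈ ∑ m f
    ∑-pad zero    k f f≈0 = ∑-zero k λ i _ → f≈0 i z≤n
    ∑-pad (suc m) k f f≈0 = +-congˡ (∑-pad m k (λ i → f (suc i)) λ i m≤i → f≈0 (suc i) (s≤s m≤i))

    ∑-shift : ∀ m k (f : ℕ → Carrier) → (∀ i → i < m → f i ≈ 0#) →
              ∑ (m ℕ.+ k) f ≈ ∑ k (λ i → f (m ℕ.+ i))
    ∑-shift zero    k f f≈0 = refl
    ∑-shift (suc m) k f f≈0 = begin
      f 0 + ∑ (m ℕ.+ k) (λ i → f (suc i)) ≈⟨ +-cong (f≈0 0 (s≤s z≤n))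
                                               (∑-shift m k (λ i → f (suc i)) λ i i<m → f≈0 (suc i) (s≤s i<m)) ⟩
      0# + ∑ k (λ i → f (suc (m ℕ.+ i))) ≈⟨ +-identityˡ _ ⟩
      ∑ k (λ i → f (suc (m ℕ.+ i))) ∎

  ∑-change-bound : ∀ m n (f : ℕ → Carrier) → (∀ i → m ≤ i → f i ≈ 0#) → (∀ i → n ≤ i → f i ≈ 0#) →
                   ∑ m f ≈ ∑ n f
  ∑-change-bound m n f zm zn = begin
    ∑ m f ≈⟨ ∑-pad m n f zm ⟨
    ∑ (m ℕ.+ n) f ≡⟨ ≡.cong (λ k → ∑ k f) (ℕₚ.+-comm m n) ⟩
    ∑ (n ℕ.+ m) f ≈⟨ ∑-pad n m f zn ⟩
    ∑ n f ∎

  infixr 8 q^_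

  abstract
    q^_ : ℕ → Carrier
    q^ n = q ^ n

    q^-def : ∀ n → q^ n ≈ q ^ n
    q^-def n = refl

    q^-0 : q^ 0 ≈ 1#
    q^-0 = refl

    q^-+ : ∀ m n → q^ (m ℕ.+ n) ≈ q^ m * q^ n
    q^-+ = ^-homo-* q

  qpow-cong : ∀ {m n} → m ≡ n → q^ m ≈ q^ n
  qpow-cong ≡.refl = refl

  qpow-* : ∀ {m n k} → m ℕ.+ n ≡ k → q^ m * q^ n ≈ q^ k
  qpow-* {m} {n} eq = trans (sym (q^-+ m n)) (qpow-cong eq)

  zero-*ʳ : ∀ {x y} → y ≈ 0# → x * y ≈ 0#
  zero-*ʳ y≈0 = trans (*-congˡ y≈0) (zeroʳ _)

  zero-*ˡ : ∀ {x y} → x ≈ 0# → x * y ≈ 0#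
  zero-*ˡ x≈0 = trans (*-congʳ x≈0) (zeroˡ _)

  abstract
    -- Given by q-Pascal rather than as a quotient, so that it vanishes for k > n without side
    -- conditions; `binom-multinom` identifies it with the quotient of q-factorials.
    binom : ℕ → ℕ → Carrier
    binom n       zero    = 1#
    binom zero    (suc k) = 0#
    binom (suc n) (suc k) = binom n k + q^ suc k * binom n (suc k)

    binom-n-0 : ∀ n → binom n 0 ≈ 1#
    binom-n-0 zero    = refl
    binom-n-0 (suc n) = refl

    binom-0-suc : ∀ k → binom 0 (suc k) ≈ 0#
    binom-0-suc k = refl

    binom-pascal : ∀ n k → binom (suc n) (suc k) ≈ binom n k + q^ suc k * binom n (suc k)
    binom-pascal n k = refl

  binom-cong : ∀ {m n k l} → m ≡ n → k ≡ l → binom m k ≈ binom n l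
  binom-cong ≡.refl ≡.refl = refl

  binom-zero : ∀ {n k} → n < k → binom n k ≈ 0#
  binom-zero {zero}  {suc k} _         = binom-0-suc k
  binom-zero {suc n} {suc k} (s≤s n<k) =
    trans (binom-pascal n k)
      (trans (+-cong (binom-zero n<k) (zero-*ʳ (binom-zero (ℕₚ.m<n⇒m<1+n n<k)))) (+-identityˡ 0#))

  binom-diag : ∀ n → binom n n ≈ 1#
  binom-diag zero    = binom-n-0 0
  binom-diag (suc n) =
    trans (binom-pascal n n)
      (trans (+-cong (binom-diag n) (zero-*ʳ (binom-zero (ℕₚ.n<1+n n)))) (+-identityʳ 1#))

  inverse′ : ∀ i → (1# - q^ suc i) * inv i ≈ 1#
  inverse′ i = trans (*-congʳ (+-congˡ (-‿cong (q^-def (suc i))))) (inverse i)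

  -- (q;q)_n and its inverse.
  poch pochInv : ℕ → Carrier
  poch zero    = 1#
  poch (suc n) = poch n * (1# - q^ suc n)
  pochInv zero    = 1#
  pochInv (suc n) = pochInv n * inv n

  poch-inverse : ∀ n → poch n * pochInv n ≈ 1#
  poch-inverse zero    = *-identityˡ 1#
  poch-inverse (suc n) = begin
    poch n * (1# - q^ suc n) * (pochInv n * inv n) ≈⟨ solve 4 (λ a b c d → a :* b :* (c :* d) := a :* c :* (b :* d)) refl _ _ _ _ ⟩
    poch n * pochInv n * ((1# - q^ suc n) * inv n) ≈⟨ *-cong (poch-inverse n) (inverse′ n) ⟩
    1# * 1# ≈⟨ *-identityˡ 1# ⟩
    1# ∎

  pochInv-pred : ∀ n → (1# - q^ suc n) * pochInv (suc n) ≈ pochInv n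
  pochInv-pred n = begin
    (1# - q^ suc n) * (pochInv n * inv n) ≈⟨ solve 3 (λ a b c → a :* (b :* c) := b :* (a :* c)) refl _ _ _ ⟩
    pochInv n * ((1# - q^ suc n) * inv n) ≈⟨ *-congˡ (inverse′ n) ⟩
    pochInv n * 1# ≈⟨ *-identityʳ _ ⟩
    pochInv n ∎

  1-xy : ∀ x y → 1# - x * y ≈ (1# - x) + x * (1# - y)
  1-xy x y = sym (begin
    (1# - x) + x * (1# - y) ≈⟨ +-congˡ (distribˡ x 1# (- y)) ⟩
    (1# - x) + (x * 1# + x * - y) ≈⟨ +-congˡ (+-cong (*-identityʳ x) (sym (-‿distribʳ-* x y))) ⟩
    (1# - x) + (x - x * y) ≈⟨ solve 4 (λ a b c d → (a :+ b) :+ (c :+ d) := a :+ ((b :+ c) :+ d)) refl 1# (- x) x (- (x * y)) ⟩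
    1# + ((- x + x) - x * y) ≈⟨ +-congˡ (+-congʳ (-‿inverseˡ x)) ⟩
    1# + (0# - x * y) ≈⟨ +-congˡ (+-identityˡ _) ⟩
    1# - x * y ∎)

  multinom : ℕ → ℕ → Carrier
  multinom m r = poch (m ℕ.+ r) * (pochInv m * pochInv r)

  -- 1 - q^{m+1} q^{r+1} splits as (1 - q^{m+1}) + q^{m+1} (1 - q^{r+1}), and each part cancels the
  -- last factor of one of the two inverses.
  multinom-pascal : ∀ m r → multinom (suc m) (suc r) ≈ multinom m (suc r) + q^ suc m * multinom (suc m) r
  multinom-pascal m r = begin
    P * (1# - q^ suc (m ℕ.+ suc r)) * (iM * iR)
      ≈⟨ *-congʳ (*-congˡ (+-congˡ (-‿cong (sym (qpow-* ≡.refl))))) ⟩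
    P * (1# - q^ suc m * q^ suc r) * (iM * iR)
      ≈⟨ *-congʳ (*-congˡ (1-xy _ _)) ⟩
    P * ((1# - q^ suc m) + q^ suc m * (1# - q^ suc r)) * (iM * iR)
      ≈⟨ solve 6 (λ P a x b m r → P :* (a :+ x :* b) :* (m :* r) := P :* ((a :* m) :* r) :+ x :* (P :* (m :* (b :* r)))) refl _ _ _ _ _ _ ⟩
    P * ((1# - q^ suc m) * iM * iR) + q^ suc m * (P * (iM * ((1# - q^ suc r) * iR)))
      ≈⟨ +-cong (*-congˡ (*-congʳ (pochInv-pred m)))
                (*-congˡ (*-cong (reflexive (≡.cong poch (ℕₚ.+-suc m r))) (*-congˡ (pochInv-pred r)))) ⟩
    multinom m (suc r) + q^ suc m * multinom (suc m) r ∎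
    where
    P  = poch (m ℕ.+ suc r)
    iM = pochInv (suc m)
    iR = pochInv (suc r)

  binom-multinom : ∀ m r → binom (m ℕ.+ r) m ≈ multinom m r
  binom-multinom zero    r = trans (binom-n-0 r) (sym (trans (*-congˡ (*-identityˡ _)) (poch-inverse r)))
  binom-multinom (suc m) zero = begin
    binom (suc m ℕ.+ 0) (suc m) ≡⟨ ≡.cong (λ k → binom k (suc m)) (ℕₚ.+-identityʳ (suc m)) ⟩
    binom (suc m) (suc m) ≈⟨ binom-diag (suc m) ⟩
    1# ≈⟨ poch-inverse (suc m) ⟨
    poch (suc m) * pochInv (suc m) ≈⟨ *-cong (reflexive (≡.cong poch (≡.sym (ℕₚ.+-identityʳ (suc m))))) (sym (*-identityʳ _)) ⟩
    multinom (suc m) zero ∎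
  binom-multinom (suc m) (suc r) = begin
    binom (suc m ℕ.+ suc r) (suc m)
      ≈⟨ binom-pascal (m ℕ.+ suc r) m ⟩
    binom (m ℕ.+ suc r) m + q^ suc m * binom (m ℕ.+ suc r) (suc m)
      ≈⟨ +-cong (binom-multinom m (suc r)) (*-congˡ (trans (binom-cong (ℕₚ.+-suc m r) ≡.refl) (binom-multinom (suc m) r))) ⟩
    multinom m (suc r) + q^ suc m * multinom (suc m) r
      ≈⟨ multinom-pascal m r ⟨
    multinom (suc m) (suc r) ∎

  binom-sym : ∀ {n} k l → k ℕ.+ l ≡ n → binom n k ≈ binom n l
  binom-sym k l ≡.refl = begin
    binom (k ℕ.+ l) k ≈⟨ binom-multinom k l ⟩
    multinom k l ≈⟨ *-cong (reflexive (≡.cong poch (ℕₚ.+-comm k l))) (*-comm _ _) ⟩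
    multinom l k ≈⟨ binom-multinom l k ⟨
    binom (l ℕ.+ k) l ≈⟨ binom-cong (ℕₚ.+-comm l k) ≡.refl ⟩
    binom (k ℕ.+ l) l ∎

  -- For a + b ≤ n both sides are (q)_n / ((q)_a (q)_b (q)_{n-a-b}), otherwise both vanish. The
  -- truncation in n ∸ a is harmless, since `binom n a` is zero when a > n.
  binom-revise : ∀ n a b → binom n (a ℕ.+ b) * binom (a ℕ.+ b) a ≈ binom n a * binom (n ∸ a) b
  binom-revise n a b with a ℕ.+ b ℕₚ.≤? n
  ... | yes a+b≤n with ℕₚ.m≤n⇒∃[o]m+o≡n a+b≤n
  ...   | c , ≡.refl = begin
    binom (a ℕ.+ b ℕ.+ c) (a ℕ.+ b) * binom (a ℕ.+ b) a
      ≈⟨ *-cong (binom-multinom (a ℕ.+ b) c) (binom-multinom a b) ⟩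
    poch (a ℕ.+ b ℕ.+ c) * (pochInv (a ℕ.+ b) * pochInv c) * (poch (a ℕ.+ b) * (pochInv a * pochInv b))
      ≈⟨ regroup _ _ _ _ _ _ ⟩
    poch (a ℕ.+ b) * pochInv (a ℕ.+ b) * T
      ≈⟨ *-congʳ (trans (poch-inverse (a ℕ.+ b)) (sym (poch-inverse (b ℕ.+ c)))) ⟩
    poch (b ℕ.+ c) * pochInv (b ℕ.+ c) * T
      ≈⟨ regroup′ _ _ _ _ _ _ ⟩
    poch (a ℕ.+ b ℕ.+ c) * (pochInv a * pochInv (b ℕ.+ c)) * (poch (b ℕ.+ c) * (pochInv b * pochInv c))
      ≈⟨ *-congʳ (*-congʳ (reflexive (≡.cong poch (ℕₚ.+-assoc a b c)))) ⟩
    multinom a (b ℕ.+ c) * multinom b c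
      ≈⟨ *-cong (binom-multinom a (b ℕ.+ c)) (binom-multinom b c) ⟨
    binom (a ℕ.+ (b ℕ.+ c)) a * binom (b ℕ.+ c) b
      ≈⟨ *-cong (binom-cong (≡.sym (ℕₚ.+-assoc a b c)) ≡.refl)
                (binom-cong (≡.sym (≡.trans (≡.cong (_∸ a) (ℕₚ.+-assoc a b c)) (ℕₚ.m+n∸m≡n a (b ℕ.+ c)))) ≡.refl) ⟩
    binom (a ℕ.+ b ℕ.+ c) a * binom (a ℕ.+ b ℕ.+ c ∸ a) b ∎
    where
    T = poch (a ℕ.+ b ℕ.+ c) * (pochInv a * (pochInv b * pochInv c))
    regroup : ∀ p i k P x y → p * (i * k) * (P * (x * y)) ≈ P * i * (p * (x * (y * k)))
    regroup = solve 6 (λ p i k P x y → p :* (i :* k) :* (P :* (x :* y)) := P :* i :* (p :* (x :* (y :* k)))) refl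
    regroup′ : ∀ P i p x y k → P * i * (p * (x * (y * k))) ≈ p * (x * i) * (P * (y * k))
    regroup′ = solve 6 (λ P i p x y k → P :* i :* (p :* (x :* (y :* k))) := p :* (x :* i) :* (P :* (y :* k))) refl
  binom-revise n a b | no a+b≰n with a ℕₚ.≤? n
  ... | no a≰n = trans (zero-*ˡ (binom-zero (ℕₚ.≰⇒> a+b≰n))) (sym (zero-*ˡ (binom-zero (ℕₚ.≰⇒> a≰n))))
  ... | yes a≤n with ℕₚ.m≤n⇒∃[o]m+o≡n a≤n
  ...   | c , ≡.refl = trans (zero-*ˡ (binom-zero (ℕₚ.≰⇒> a+b≰n))) (sym (zero-*ʳ
          (trans (binom-cong (ℕₚ.m+n∸m≡n a c) ≡.refl) (binom-zero (ℕₚ.+-cancelˡ-< a c b (ℕₚ.≰⇒> a+b≰n))))))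

  -- Induction on u: q-Pascal on the left gives the sums for k and k + 1, whose terms at s and s + 1
  -- recombine by q-Pascal in u. Wherever ∸ truncates the exponent, `binom u s` is zero.
  vandermonde : ∀ u y k → binom (u ℕ.+ y) k
              ≈ ∑ (suc k) (λ s → q^ ((u ∸ s) ℕ.* (k ∸ s)) * (binom u s * binom y (k ∸ s)))
  vandermonde zero y k = sym (begin
    ∑ (suc k) F
      ≈⟨ ∑-suc k F ⟩
    q^ 0 * (binom 0 0 * binom y k) + ∑ k (λ s → q^ ((0 ∸ suc s) ℕ.* (k ∸ suc s)) * (binom 0 (suc s) * binom y (k ∸ suc s)))
      ≈⟨ +-cong (*-cong q^-0 (*-congʳ (binom-n-0 0))) (∑-zero k λ s _ → zero-*ʳ (zero-*ˡ (binom-0-suc s))) ⟩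
    1# * (1# * binom y k) + 0#
      ≈⟨ trans (+-identityʳ _) (trans (*-identityˡ _) (*-identityˡ _)) ⟩
    binom y k ∎)
    where
    F : ℕ → Carrier
    F s = q^ ((0 ∸ s) ℕ.* (k ∸ s)) * (binom 0 s * binom y (k ∸ s))
  vandermonde (suc u) y zero = sym (begin
    ∑ 1 F
      ≈⟨ trans (∑-suc 0 F) (trans (+-congˡ (∑-0 (λ i → F (suc i)))) (+-identityʳ _)) ⟩
    q^ (suc u ℕ.* 0) * (binom (suc u) 0 * binom y 0)
      ≈⟨ *-cong (trans (qpow-cong (ℕₚ.*-zeroʳ (suc u))) q^-0) (*-cong (binom-n-0 _) (binom-n-0 _)) ⟩
    1# * (1# * 1#)
      ≈⟨ trans (*-identityˡ _) (*-identityˡ _) ⟩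
    1#
      ≈⟨ binom-n-0 _ ⟨
    binom (suc u ℕ.+ y) 0 ∎)
    where
    F : ℕ → Carrier
    F s = q^ ((suc u ∸ s) ℕ.* (0 ∸ s)) * (binom (suc u) s * binom y (0 ∸ s))
  vandermonde (suc u) y (suc k) = begin
    binom (suc u ℕ.+ y) (suc k)
      ≈⟨ binom-pascal (u ℕ.+ y) k ⟩
    binom (u ℕ.+ y) k + Q * binom (u ℕ.+ y) (suc k)
      ≈⟨ +-cong (vandermonde u y k) (*-congˡ (trans (vandermonde u y (suc k)) (∑-suc (suc k) G))) ⟩
    ∑ (suc k) F + Q * (G 0 + ∑ (suc k) (λ s → G (suc s)))
      ≈⟨ +-congˡ (distribˡ Q _ _) ⟩
    ∑ (suc k) F + (Q * G 0 + Q * ∑ (suc k) (λ s → G (suc s)))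
      ≈⟨ +-congˡ (+-cong head (*-distribˡ-∑ (suc k) Q (λ s → G (suc s)))) ⟩
    ∑ (suc k) F + (H 0 + ∑ (suc k) (λ s → Q * G (suc s)))
      ≈⟨ solve 3 (λ a b c → a :+ (b :+ c) := b :+ (a :+ c)) refl _ _ _ ⟩
    H 0 + (∑ (suc k) F + ∑ (suc k) (λ s → Q * G (suc s)))
      ≈⟨ +-congˡ (∑-distrib-+ (suc k) F (λ s → Q * G (suc s))) ⟨
    H 0 + ∑ (suc k) (λ s → F s + Q * G (suc s))
      ≈⟨ +-congˡ (∑-cong (suc k) {λ s → F s + Q * G (suc s)} {λ s → H (suc s)} step) ⟩
    H 0 + ∑ (suc k) (λ s → H (suc s))
      ≈⟨ ∑-suc (suc k) H ⟨
    ∑ (suc (suc k)) H ∎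
    where
    Q = q^ suc k
    F G H : ℕ → Carrier
    F s = q^ ((u ∸ s) ℕ.* (k ∸ s)) * (binom u s * binom y (k ∸ s))
    G s = q^ ((u ∸ s) ℕ.* (suc k ∸ s)) * (binom u s * binom y (suc k ∸ s))
    H s = q^ ((suc u ∸ s) ℕ.* (suc k ∸ s)) * (binom (suc u) s * binom y (suc k ∸ s))
    head : Q * G 0 ≈ H 0
    head = trans (sym (*-assoc _ _ _)) (*-cong (qpow-* ≡.refl) (*-congʳ (trans (binom-n-0 u) (sym (binom-n-0 (suc u))))))
    exponent : ∀ s u′ k′ → (s ℕ.+ k′ ℕ.+ 1) ℕ.+ u′ ℕ.* k′ ≡ (1 ℕ.+ u′) ℕ.* k′ ℕ.+ suc s
    exponent = solveℕ
    step : ∀ s → s < suc k → F s + Q * G (suc s) ≈ H (suc s)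
    step s (s≤s s≤k) = begin
      x * (b * d) + Q * (x′ * (b′ * d)) ≈⟨ +-congˡ (sym (*-assoc _ _ _)) ⟩
      x * (b * d) + Q * x′ * (b′ * d) ≈⟨ +-congˡ tail ⟩
      x * (b * d) + x * q^ suc s * (b′ * d) ≈⟨ solve 5 (λ x b d t b′ → x :* (b :* d) :+ x :* t :* (b′ :* d) := x :* ((b :+ t :* b′) :* d)) refl _ _ _ _ _ ⟩
      x * ((b + q^ suc s * b′) * d) ≈⟨ *-congˡ (*-congʳ (binom-pascal u s)) ⟨
      x * (binom (suc u) (suc s) * d) ∎
      where
      x  = q^ ((u ∸ s) ℕ.* (k ∸ s))
      x′ = q^ ((u ∸ suc s) ℕ.* (k ∸ s))
      b  = binom u s
      b′ = binom u (suc s)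
      d  = binom y (k ∸ s)
      -- For s < u both exponents equal (u - s)(k - s) + s + 1; for s ≥ u the factor `b′` vanishes.
      tail : Q * x′ * (b′ * d) ≈ x * q^ suc s * (b′ * d)
      tail with suc s ℕₚ.≤? u
      ... | no s≮u = trans (zero-*ʳ (zero-*ˡ z)) (sym (zero-*ʳ (zero-*ˡ z)))
        where z = binom-zero (ℕₚ.≰⇒> s≮u)
      ... | yes s<u with ℕₚ.m≤n⇒∃[o]m+o≡n s<u | ℕₚ.m≤n⇒∃[o]m+o≡n s≤k
      ...   | u′ , ≡.refl | k′ , ≡.refl
        rewrite ℕₚ.m+n∸m≡n s k′ | ℕₚ.m+n∸m≡n s u′ | ≡.sym (ℕₚ.+-suc s u′) | ℕₚ.m+n∸m≡n s (suc u′) =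
        *-congʳ (trans (qpow-* (≡.trans (≡.cong (ℕ._+ u′ ℕ.* k′) (ℕₚ.+-comm 1 (s ℕ.+ k′))) (exponent s u′ k′))) (sym (qpow-* ≡.refl)))

  -- The same sum with u and y exchanged and read backwards, which moves the power of q onto s.
  vandermonde′ : ∀ u y k → binom (u ℕ.+ y) k
               ≈ ∑ (suc k) (λ s → q^ (s ℕ.* (y ∸ (k ∸ s))) * (binom u s * binom y (k ∸ s)))
  vandermonde′ u y k = begin
    binom (u ℕ.+ y) k ≈⟨ binom-cong (ℕₚ.+-comm u y) ≡.refl ⟩
    binom (y ℕ.+ u) k ≈⟨ vandermonde y u k ⟩
    ∑ (suc k) F ≈⟨ ∑-reverse k F ⟩
    ∑ (suc k) (λ s → F (k ∸ s)) ≈⟨ ∑-cong (suc k) step ⟩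
    ∑ (suc k) (λ s → q^ (s ℕ.* (y ∸ (k ∸ s))) * (binom u s * binom y (k ∸ s))) ∎
    where
    F : ℕ → Carrier
    F s = q^ ((y ∸ s) ℕ.* (k ∸ s)) * (binom y s * binom u (k ∸ s))
    step : ∀ s → s < suc k → F (k ∸ s) ≈ q^ (s ℕ.* (y ∸ (k ∸ s))) * (binom u s * binom y (k ∸ s))
    step s (s≤s s≤k) = *-cong
      (qpow-cong (≡.trans (≡.cong ((y ∸ (k ∸ s)) ℕ.*_) (ℕₚ.m∸[m∸n]≡n s≤k)) (ℕₚ.*-comm (y ∸ (k ∸ s)) s)))
      (trans (*-congˡ (binom-cong ≡.refl (ℕₚ.m∸[m∸n]≡n s≤k))) (*-comm _ _))

-- The q-Saalschütz sum

module QSaalschütz {c ℓ} (R : CommutativeRing c ℓ) (Qp : QuantumParameter R) where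
  open CommutativeRing R hiding (zero)
  open SemiringSolver commutativeSemiring using (solve; _:+_; _:*_; _:=_)
  open SetoidReasoning setoid
  open QBinomial R Qp

  -- The vanishing of binom u s for u < s replaces the condition s ≤ u.
  binom-split : ∀ x y N s → s ≤ N →
    binom x s * binom ((x ∸ s) ℕ.+ (y ℕ.+ N)) (N ∸ s)
      ≈ ∑ (suc N) (λ u → q^ ((u ∸ s) ℕ.* (y ℕ.+ u)) * (binom x u * binom u s * binom (y ℕ.+ N) (N ∸ u)))
  binom-split x y N s s≤N with s ℕₚ.≤? x
  ... | no s≰x = trans (zero-*ˡ (binom-zero (ℕₚ.≰⇒> s≰x))) (sym (∑-zero (suc N) λ u _ → zero-*ʳ (zero-*ˡ (vanish u))))
    where
    vanish : ∀ u → binom x u * binom u s ≈ 0#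
    vanish u with s ℕₚ.≤? u
    ... | yes s≤u = zero-*ˡ (binom-zero (ℕₚ.<-≤-trans (ℕₚ.≰⇒> s≰x) s≤u))
    ... | no s≰u  = zero-*ʳ (binom-zero (ℕₚ.≰⇒> s≰u))
  ... | yes s≤x with ℕₚ.m≤n⇒∃[o]m+o≡n s≤x | ℕₚ.m≤n⇒∃[o]m+o≡n s≤N
  ...   | x′ , ≡.refl | N′ , ≡.refl = begin
    binom x s * binom ((x ∸ s) ℕ.+ Y) (N ∸ s)
      ≈⟨ *-congˡ (binom-cong (≡.cong (ℕ._+ Y) (ℕₚ.m+n∸m≡n s x′)) (ℕₚ.m+n∸m≡n s N′)) ⟩
    binom x s * binom (x′ ℕ.+ Y) N′
      ≈⟨ *-congˡ (vandermonde′ x′ Y N′) ⟩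
    binom x s * ∑ (suc N′) F
      ≈⟨ *-distribˡ-∑ (suc N′) (binom x s) F ⟩
    ∑ (suc N′) (λ r → binom x s * F r)
      ≈⟨ ∑-cong (suc N′) {λ r → binom x s * F r} {λ r → G (s ℕ.+ r)} step ⟩
    ∑ (suc N′) (λ r → G (s ℕ.+ r))
      ≈⟨ ∑-shift s (suc N′) G (λ u u<s → zero-*ʳ (zero-*ˡ (zero-*ʳ (binom-zero u<s)))) ⟨
    ∑ (s ℕ.+ suc N′) G
      ≡⟨ ≡.cong (λ k → ∑ k G) (ℕₚ.+-suc s N′) ⟩
    ∑ (suc N) G ∎
    where
    Y = y ℕ.+ N
    F G : ℕ → Carrier
    F r = q^ (r ℕ.* (Y ∸ (N′ ∸ r))) * (binom x′ r * binom Y (N′ ∸ r))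
    G u = q^ ((u ∸ s) ℕ.* (y ℕ.+ u)) * (binom x u * binom u s * binom Y (N ∸ u))
    exponent : ∀ r → r ≤ N′ → Y ∸ (N′ ∸ r) ≡ y ℕ.+ (s ℕ.+ r)
    exponent r r≤N′ = ≡.trans (ℕₚ.+-∸-assoc y (ℕₚ.≤-trans (ℕₚ.m∸n≤m N′ r) (ℕₚ.m≤n+m N′ s)))
      (≡.cong (y ℕ.+_) (≡.trans (ℕₚ.+-∸-assoc s (ℕₚ.m∸n≤m N′ r)) (≡.cong (s ℕ.+_) (ℕₚ.m∸[m∸n]≡n r≤N′))))
    revise : ∀ r → binom x s * binom x′ r ≈ binom x (s ℕ.+ r) * binom (s ℕ.+ r) s
    revise r = sym (trans (binom-revise x s r) (*-congˡ (binom-cong (ℕₚ.m+n∸m≡n s x′) ≡.refl)))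
    step : ∀ r → r < suc N′ → binom x s * F r ≈ G (s ℕ.+ r)
    step r (s≤s r≤N′) = begin
      binom x s * F r
        ≈⟨ solve 4 (λ a p b c → a :* (p :* (b :* c)) := p :* (a :* b :* c)) refl _ _ _ _ ⟩
      q^ (r ℕ.* (Y ∸ (N′ ∸ r))) * (binom x s * binom x′ r * binom Y (N′ ∸ r))
        ≈⟨ *-cong (qpow-cong (≡.cong₂ ℕ._*_ (≡.sym (ℕₚ.m+n∸m≡n s r)) (exponent r r≤N′)))
                  (*-cong (revise r) (binom-cong ≡.refl (≡.sym (ℕₚ.[m+n]∸[m+o]≡n∸o s N′ r)))) ⟩
      G (s ℕ.+ r) ∎

  -- With k = y - C this is q-Vandermonde: [y; s + C] = [y; k - s], and u(u + C) + (u - s)(k - s) =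
  -- s(s + C) + (u - s)(y + u). The bound N ≥ u is left free so that the range does not depend on u
  -- when sums are exchanged.
  vandermonde″ : ∀ u y N C → u ≤ N →
    ∑ (suc N) (λ s → q^ (s ℕ.* (s ℕ.+ C) ℕ.+ (u ∸ s) ℕ.* (y ℕ.+ u)) * (binom u s * binom y (s ℕ.+ C)))
      ≈ q^ (u ℕ.* (u ℕ.+ C)) * binom (u ℕ.+ y) (u ℕ.+ C)
  vandermonde″ u y N C u≤N with C ℕₚ.≤? y
  ... | no C≰y = trans
        (∑-zero (suc N) λ s _ → zero-*ʳ (zero-*ʳ (binom-zero (ℕₚ.<-≤-trans (ℕₚ.≰⇒> C≰y) (ℕₚ.m≤n+m C s)))))
        (sym (zero-*ʳ (binom-zero (ℕₚ.+-monoʳ-< u (ℕₚ.≰⇒> C≰y)))))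
  ... | yes C≤y with ℕₚ.m≤n⇒∃[o]m+o≡n C≤y
  ...   | k , ≡.refl = sym (begin
    q^ e * binom (u ℕ.+ y) (u ℕ.+ C)
      ≈⟨ *-congˡ (binom-sym (u ℕ.+ C) k (ℕₚ.+-assoc u C k)) ⟩
    q^ e * binom (u ℕ.+ y) k
      ≈⟨ *-congˡ (vandermonde u y k) ⟩
    q^ e * ∑ (suc k) F
      ≈⟨ *-distribˡ-∑ (suc k) (q^ e) F ⟩
    ∑ (suc k) (λ s → q^ e * F s)
      ≈⟨ ∑-cong (suc k) {λ s → q^ e * F s} {G} step ⟩
    ∑ (suc k) G
      ≈⟨ ∑-change-bound (suc k) (suc N) G
           (λ s k<s → zero-*ʳ (zero-*ʳ (binom-zero (≡.subst (_< s ℕ.+ C) (ℕₚ.+-comm k C) (ℕₚ.+-monoˡ-< C k<s)))))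
           (λ s N<s → zero-*ʳ (zero-*ˡ (binom-zero (ℕₚ.≤-<-trans u≤N N<s)))) ⟩
    ∑ (suc N) G ∎)
    where
    e = u ℕ.* (u ℕ.+ C)
    F G : ℕ → Carrier
    F s = q^ ((u ∸ s) ℕ.* (k ∸ s)) * (binom u s * binom y (k ∸ s))
    G s = q^ (s ℕ.* (s ℕ.+ C) ℕ.+ (u ∸ s) ℕ.* (y ℕ.+ u)) * (binom u s * binom y (s ℕ.+ C))
    exponent : ∀ s u′ k′ C → (s ℕ.+ u′) ℕ.* (s ℕ.+ u′ ℕ.+ C) ℕ.+ u′ ℕ.* k′
                 ≡ s ℕ.* (s ℕ.+ C) ℕ.+ u′ ℕ.* (C ℕ.+ (s ℕ.+ k′) ℕ.+ (s ℕ.+ u′))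
    exponent = solveℕ
    complement : ∀ s C k′ → k′ ℕ.+ (s ℕ.+ C) ≡ C ℕ.+ (s ℕ.+ k′)
    complement = solveℕ
    step : ∀ s → s < suc k → q^ e * F s ≈ G s
    step s (s≤s s≤k) with s ℕₚ.≤? u
    ... | no s≰u = trans (zero-*ʳ (zero-*ʳ (zero-*ˡ z))) (sym (zero-*ʳ (zero-*ˡ z)))
      where z = binom-zero (ℕₚ.≰⇒> s≰u)
    ... | yes s≤u with ℕₚ.m≤n⇒∃[o]m+o≡n s≤u | ℕₚ.m≤n⇒∃[o]m+o≡n s≤k
    ...   | u′ , ≡.refl | k′ , ≡.refl rewrite ℕₚ.m+n∸m≡n s u′ | ℕₚ.m+n∸m≡n s k′ =
      trans (sym (*-assoc _ _ _))
        (*-cong (qpow-* (exponent s u′ k′ C)) (*-congˡ (binom-sym k′ (s ℕ.+ C) (complement s C k′))))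

  -- For C ≤ y both sides are the q-multinomial coefficient with parts N - u, u + C and y - C; for C
  -- > y both vanish.
  revise-complement : ∀ y N C u → u ≤ N →
    binom (y ℕ.+ N) (N ∸ u) * binom (u ℕ.+ y) (u ℕ.+ C)
      ≈ binom (y ℕ.+ N) (N ℕ.+ C) * binom (N ℕ.+ C) (N ∸ u)
  revise-complement y N C u u≤N with C ℕₚ.≤? y
  ... | no C≰y = trans (zero-*ʳ (binom-zero (ℕₚ.+-monoʳ-< u (ℕₚ.≰⇒> C≰y))))
                       (sym (zero-*ˡ (binom-zero (≡.subst (_< N ℕ.+ C) (ℕₚ.+-comm N y) (ℕₚ.+-monoʳ-< N (ℕₚ.≰⇒> C≰y))))))
  ... | yes C≤y with ℕₚ.m≤n⇒∃[o]m+o≡n C≤y | ℕₚ.m≤n⇒∃[o]m+o≡n u≤N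
  ...   | k , ≡.refl | N′ , ≡.refl rewrite ℕₚ.m+n∸m≡n u N′ = begin
    binom n N′ * binom (u ℕ.+ (C ℕ.+ k)) (u ℕ.+ C)
      ≈⟨ *-cong (binom-sym N′ (u ℕ.+ C ℕ.+ k) (ar₁ C k u N′)) (binom-cong (≡.sym (ℕₚ.+-assoc u C k)) ≡.refl) ⟩
    binom n (u ℕ.+ C ℕ.+ k) * binom (u ℕ.+ C ℕ.+ k) (u ℕ.+ C)
      ≈⟨ binom-revise n (u ℕ.+ C) k ⟩
    binom n (u ℕ.+ C) * binom (n ∸ (u ℕ.+ C)) k
      ≈⟨ *-congˡ (binom-sym k N′ (≡.sym (≡.trans (≡.cong (_∸ (u ℕ.+ C)) (ar₂ C k u N′)) (ℕₚ.m+n∸m≡n (u ℕ.+ C) _)))) ⟩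
    binom n (u ℕ.+ C) * binom (n ∸ (u ℕ.+ C)) N′
      ≈⟨ binom-revise n (u ℕ.+ C) N′ ⟨
    binom n (u ℕ.+ C ℕ.+ N′) * binom (u ℕ.+ C ℕ.+ N′) (u ℕ.+ C)
      ≈⟨ *-cong (binom-cong ≡.refl (ar₃ u C N′))
           (trans (binom-sym (u ℕ.+ C) N′ ≡.refl) (binom-cong (ar₃ u C N′) ≡.refl)) ⟩
    binom n (u ℕ.+ N′ ℕ.+ C) * binom (u ℕ.+ N′ ℕ.+ C) N′ ∎
    where
    n = C ℕ.+ k ℕ.+ (u ℕ.+ N′)
    ar₁ : ∀ C k u N′ → N′ ℕ.+ (u ℕ.+ C ℕ.+ k) ≡ C ℕ.+ k ℕ.+ (u ℕ.+ N′)
    ar₁ = solveℕ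
    ar₂ : ∀ C k u N′ → C ℕ.+ k ℕ.+ (u ℕ.+ N′) ≡ u ℕ.+ C ℕ.+ (k ℕ.+ N′)
    ar₂ = solveℕ
    ar₃ : ∀ u C N′ → u ℕ.+ C ℕ.+ N′ ≡ u ℕ.+ N′ ℕ.+ C
    ar₃ = solveℕ

  -- `binom-split` expands the two factors containing x as a sum over u. The sum over s is then
  -- `vandermonde″`, and `revise-complement` extracts a factor free of u, so that what remains is a
  -- q-Vandermonde sum over u.
  q-saalschütz : ∀ x y N C →
    ∑ (suc N) (λ s → q^ (s ℕ.* (s ℕ.+ C)) * (binom ((x ∸ s) ℕ.+ (y ℕ.+ N)) (N ∸ s) * (binom x s * binom y (s ℕ.+ C))))
      ≈ binom (x ℕ.+ (N ℕ.+ C)) N * binom (y ℕ.+ N) (N ℕ.+ C)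
  q-saalschütz x y N C = begin
    ∑ (suc N) (λ s → p s * (binom ((x ∸ s) ℕ.+ (y ℕ.+ N)) (N ∸ s) * (binom x s * binom y (s ℕ.+ C))))
      ≈⟨ ∑-cong (suc N) expand ⟩
    ∑ (suc N) (λ s → ∑ (suc N) (λ u → D u * H u s))
      ≈⟨ ∑-comm (suc N) (suc N) (λ s u → D u * H u s) ⟩
    ∑ (suc N) (λ u → ∑ (suc N) (λ s → D u * H u s))
      ≈⟨ ∑-cong (suc N) inner ⟩
    ∑ (suc N) (λ u → Y * V u)
      ≈⟨ *-distribˡ-∑ (suc N) Y V ⟨
    Y * ∑ (suc N) V
      ≈⟨ *-congˡ (trans (∑-cong (suc N) final) (sym (vandermonde′ x (N ℕ.+ C) N))) ⟩
    Y * binom (x ℕ.+ (N ℕ.+ C)) N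
      ≈⟨ *-comm _ _ ⟩
    binom (x ℕ.+ (N ℕ.+ C)) N * Y ∎
    where
    Y = binom (y ℕ.+ N) (N ℕ.+ C)
    p D V : ℕ → Carrier
    p s = q^ (s ℕ.* (s ℕ.+ C))
    D u = binom x u * binom (y ℕ.+ N) (N ∸ u)
    V u = p u * (binom x u * binom (N ℕ.+ C) (N ∸ u))
    H : ℕ → ℕ → Carrier
    H u s = q^ (s ℕ.* (s ℕ.+ C) ℕ.+ (u ∸ s) ℕ.* (y ℕ.+ u)) * (binom u s * binom y (s ℕ.+ C))
    expand : ∀ s → s < suc N → p s * (binom ((x ∸ s) ℕ.+ (y ℕ.+ N)) (N ∸ s) * (binom x s * binom y (s ℕ.+ C)))
                 ≈ ∑ (suc N) (λ u → D u * H u s)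
    expand s (s≤s s≤N) = begin
      p s * (t * (binom x s * b)) ≈⟨ solve 4 (λ p t x b → p :* (t :* (x :* b)) := p :* b :* (x :* t)) refl _ _ _ _ ⟩
      p s * b * (binom x s * t) ≈⟨ *-congˡ (binom-split x y N s s≤N) ⟩
      p s * b * ∑ (suc N) K ≈⟨ *-distribˡ-∑ (suc N) (p s * b) K ⟩
      ∑ (suc N) (λ u → p s * b * K u) ≈⟨ ∑-cong (suc N) (λ u _ →
        trans (solve 6 (λ p b e x u d → p :* b :* (e :* (x :* u :* d)) := x :* d :* (p :* e :* (u :* b))) refl _ _ _ _ _ _)
              (*-congˡ (*-congʳ (sym (q^-+ _ _))))) ⟩
      ∑ (suc N) (λ u → D u * H u s) ∎
      where
      t = binom ((x ∸ s) ℕ.+ (y ℕ.+ N)) (N ∸ s)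
      b = binom y (s ℕ.+ C)
      K : ℕ → Carrier
      K u = q^ ((u ∸ s) ℕ.* (y ℕ.+ u)) * (binom x u * binom u s * binom (y ℕ.+ N) (N ∸ u))
    inner : ∀ u → u < suc N → ∑ (suc N) (λ s → D u * H u s) ≈ Y * V u
    inner u (s≤s u≤N) = begin
      ∑ (suc N) (λ s → D u * H u s) ≈⟨ *-distribˡ-∑ (suc N) (D u) (H u) ⟨
      D u * ∑ (suc N) (H u) ≈⟨ *-congˡ (vandermonde″ u y N C u≤N) ⟩
      D u * (p u * binom (u ℕ.+ y) (u ℕ.+ C)) ≈⟨ solve 4 (λ x d p b → x :* d :* (p :* b) := x :* p :* (d :* b)) refl _ _ _ _ ⟩
      binom x u * p u * (binom (y ℕ.+ N) (N ∸ u) * binom (u ℕ.+ y) (u ℕ.+ C)) ≈⟨ *-congˡ (revise-complement y N C u u≤N) ⟩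
      binom x u * p u * (Y * binom (N ℕ.+ C) (N ∸ u)) ≈⟨ solve 4 (λ x p Y b → x :* p :* (Y :* b) := Y :* (p :* (x :* b))) refl _ _ _ _ ⟩
      Y * V u ∎
    final : ∀ u → u < suc N → V u ≈ q^ (u ℕ.* (N ℕ.+ C ∸ (N ∸ u))) * (binom x u * binom (N ℕ.+ C) (N ∸ u))
    final u (s≤s u≤N) = *-congʳ (qpow-cong (≡.cong (u ℕ.*_) (≡.sym eq)))
      where
      eq : N ℕ.+ C ∸ (N ∸ u) ≡ u ℕ.+ C
      eq = ≡.trans (≡.cong (_∸ (N ∸ u)) (ℕₚ.+-comm N C))
          (≡.trans (ℕₚ.+-∸-assoc C (ℕₚ.m∸n≤m N u))
          (≡.trans (≡.cong (C ℕ.+_) (ℕₚ.m∸[m∸n]≡n u≤N)) (ℕₚ.+-comm C u)))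

-- The q-Saalschütz sum with integer entries

sq : ℤ → ℕ
sq i = ∣ i ∣ ℕ.* ∣ i ∣

module IntegerBinomial {c ℓ} (R : CommutativeRing c ℓ) (Qp : QuantumParameter R) where
  open CommutativeRing R hiding (zero)
  open SemiringSolver commutativeSemiring using (solve; _:+_; _:*_; _:=_)
  open SetoidReasoning setoid
  open QBinomial R Qp
  open QSaalschütz R Qp

  abstract
    binomℤ : ℤ → ℤ → Carrier
    binomℤ (+ n) (+ k) = binom n k
    binomℤ _     _     = 0#

    binomℤ-+ : ∀ n k → binomℤ (+ n) (+ k) ≈ binom n k
    binomℤ-+ n k = refl

    binomℤ-negˡ : ∀ n k → binomℤ -[1+ n ] k ≈ 0#
    binomℤ-negˡ n k = refl

    binomℤ-negʳ : ∀ n k → binomℤ n -[1+ k ] ≈ 0#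
    binomℤ-negʳ (+ n)    k = refl
    binomℤ-negʳ -[1+ n ] k = refl

  binomℤ-cong : ∀ {m n k l} → m ≡ n → k ≡ l → binomℤ m k ≈ binomℤ n l
  binomℤ-cong ≡.refl ≡.refl = refl

  binomℤ-n<0 : ∀ {n} k → n ℤ.< + 0 → binomℤ n k ≈ 0#
  binomℤ-n<0 { -[1+ n ]} k _ = binomℤ-negˡ n k
  binomℤ-n<0 {+ n} k (ℤ.+<+ ())

  binomℤ-k<0 : ∀ n {k} → k ℤ.< + 0 → binomℤ n k ≈ 0#
  binomℤ-k<0 n { -[1+ k ]} _ = binomℤ-negʳ n k
  binomℤ-k<0 n {+ k} (ℤ.+<+ ())

  binomℤ-n<k : ∀ {n k} → n ℤ.< k → binomℤ n k ≈ 0#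
  binomℤ-n<k {+ n}      {+ k}      (ℤ.+<+ n<k) = trans (binomℤ-+ n k) (binom-zero n<k)
  binomℤ-n<k { -[1+ n ]} {k}       _           = binomℤ-negˡ n k
  binomℤ-n<k {n}        { -[1+ k ]} _          = binomℤ-negʳ n k

  binomℤ-complement : ∀ n s → binomℤ (+ n) (+ n ℤ.- + s) ≈ binom n s
  binomℤ-complement n s with s ℕₚ.≤? n
  ... | yes s≤n with ℕₚ.m≤n⇒∃[o]m+o≡n s≤n
  ...   | k , ≡.refl = begin
    binomℤ (+ (s ℕ.+ k)) (+ (s ℕ.+ k) ℤ.- + s) ≈⟨ binomℤ-cong ≡.refl (cancel (+ s) (+ k)) ⟩
    binomℤ (+ (s ℕ.+ k)) (+ k) ≈⟨ binomℤ-+ _ k ⟩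
    binom (s ℕ.+ k) k ≈⟨ binom-sym s k ≡.refl ⟨
    binom (s ℕ.+ k) s ∎
    where
    cancel : ∀ s k → s ℤ.+ k ℤ.- s ≡ k
    cancel = solveℤ
  binomℤ-complement n s | no s≰n with ℕₚ.m≤n⇒∃[o]m+o≡n (ℕₚ.≰⇒> s≰n)
  ...   | k , ≡.refl =
    trans (trans (binomℤ-cong {n = + n} ≡.refl (negative (+ n) (+ k))) (binomℤ-negʳ (+ n) k)) (sym (binom-zero (ℕₚ.≰⇒> s≰n)))
    where
    negative : ∀ n k → n ℤ.- (+ 1 ℤ.+ n ℤ.+ k) ≡ ℤ.- (+ 1 ℤ.+ k)
    negative = solveℤ

  binomℤ-sym : ∀ n k → binomℤ n k ≈ binomℤ n (n ℤ.- k)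
  binomℤ-sym -[1+ n ] k        = trans (binomℤ-negˡ n k) (sym (binomℤ-negˡ n _))
  binomℤ-sym (+ n)    (+ k)    = trans (binomℤ-+ n k) (sym (binomℤ-complement n k))
  binomℤ-sym (+ n)    -[1+ k ] = trans (binomℤ-negʳ (+ n) k)
    (sym (trans (binomℤ-+ n (n ℕ.+ suc k)) (binom-zero (ℕₚ.m<m+n n (s≤s z≤n)))))

  -- q-Pascal carries the factor q^k, which for k < 0 need not exist in the ring. Multiplying
  -- through by q^e with e + k = e′ ≥ 0 states it for every integer k. The upper entry must be
  -- positive: [0; 0] = 1, while the two terms of the recurrence would be zero.
  binomℤ-pascal : ∀ n k e e′ → + e ℤ.+ k ≡ + e′ →
    q^ e * binomℤ (+ suc n) k ≈ q^ e * binomℤ (+ n) (k ℤ.- + 1) + q^ e′ * binomℤ (+ n) k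
  binomℤ-pascal n -[1+ k ] e e′ eq = trans (zero-*ʳ (binomℤ-negʳ _ k))
    (sym (trans (+-cong (zero-*ʳ (binomℤ-negʳ _ (suc (k ℕ.+ 0)))) (zero-*ʳ (binomℤ-negʳ _ k))) (+-identityʳ 0#)))
  binomℤ-pascal n (+ zero) e e′ eq with ≡.trans (≡.sym (ℕₚ.+-identityʳ e)) (ℤₚ.+-injective eq)
  ... | ≡.refl = trans (*-congˡ (trans (binomℤ-+ (suc n) 0) (trans (binom-n-0 (suc n)) (sym (trans (binomℤ-+ n 0) (binom-n-0 n))))))
        (sym (trans (+-congʳ (zero-*ʳ (binomℤ-negʳ (+ n) 0))) (+-identityˡ _)))
  binomℤ-pascal n (+ suc k) e e′ eq = begin
    q^ e * binomℤ (+ suc n) (+ suc k)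
      ≈⟨ *-congˡ (trans (binomℤ-+ (suc n) (suc k)) (binom-pascal n k)) ⟩
    q^ e * (binom n k + q^ suc k * binom n (suc k))
      ≈⟨ solve 4 (λ e b x c → e :* (b :+ x :* c) := e :* b :+ e :* x :* c) refl _ _ _ _ ⟩
    q^ e * binom n k + q^ e * q^ suc k * binom n (suc k)
      ≈⟨ +-cong (*-congˡ (sym (binomℤ-+ n k))) (*-cong (qpow-* (ℤₚ.+-injective eq)) (sym (binomℤ-+ n (suc k)))) ⟩
    q^ e * binomℤ (+ n) (+ k) + q^ e′ * binomℤ (+ n) (+ suc k) ∎

  private
    nonpos : ∀ B → B ℤ.≤ + 0 → ∃ λ b → ℤ.- B ≡ + b
    nonpos (+ zero)  _ = 0 , ≡.refl
    nonpos -[1+ n ] _ = suc n , ≡.refl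
    nonpos (+ suc n) (ℤ.+≤+ ())

    neg-by : ∀ {x} k → x ≡ -[1+ k ] → x ℤ.< + 0
    neg-by k ≡.refl = ℤ.-<+

  -- The substitution i = b + s, M = b + N, X = x + b, Y = y - b turns the integer summand into the
  -- natural one with C = 2b, since (b + s)² = b² + s(s + 2b).
  saalschütz-natural : ∀ x y b N s → s ≤ N →
    q^ ((b ℕ.+ s) ℕ.* (b ℕ.+ s)) *
      (binomℤ (+ (x ℕ.+ y) ℤ.+ + (b ℕ.+ N) ℤ.- + (b ℕ.+ s)) (+ (x ℕ.+ y)) *
        (binomℤ (+ x) (+ x ℤ.- + s) * binomℤ (+ y) (+ y ℤ.- + (s ℕ.+ (b ℕ.+ b)))))
    ≈ q^ (b ℕ.* b) * (q^ (s ℕ.* (s ℕ.+ (b ℕ.+ b))) *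
        (binom ((x ∸ s) ℕ.+ (y ℕ.+ N)) (N ∸ s) * (binom x s * binom y (s ℕ.+ (b ℕ.+ b)))))
  saalschütz-natural x y b N s s≤N = begin
    q^ ((b ℕ.+ s) ℕ.* (b ℕ.+ s)) * (T * (binomℤ (+ x) (+ x ℤ.- + s) * binomℤ (+ y) (+ y ℤ.- + (s ℕ.+ (b ℕ.+ b)))))
      ≈⟨ *-cong (sym (qpow-* (square b s))) (*-congˡ (*-cong (binomℤ-complement x s) (binomℤ-complement y _))) ⟩
    q^ (b ℕ.* b) * q^ (s ℕ.* (s ℕ.+ (b ℕ.+ b))) * (T * (binom x s * Y))
      ≈⟨ *-assoc _ _ _ ⟩
    q^ (b ℕ.* b) * (q^ (s ℕ.* (s ℕ.+ (b ℕ.+ b))) * (T * (binom x s * Y)))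
      ≈⟨ *-congˡ (*-congˡ top) ⟩
    q^ (b ℕ.* b) * (q^ (s ℕ.* (s ℕ.+ (b ℕ.+ b))) * (binom ((x ∸ s) ℕ.+ (y ℕ.+ N)) (N ∸ s) * (binom x s * Y))) ∎
    where
    T = binomℤ (+ (x ℕ.+ y) ℤ.+ + (b ℕ.+ N) ℤ.- + (b ℕ.+ s)) (+ (x ℕ.+ y))
    Y = binom y (s ℕ.+ (b ℕ.+ b))
    square : ∀ b s → b ℕ.* b ℕ.+ s ℕ.* (s ℕ.+ (b ℕ.+ b)) ≡ (b ℕ.+ s) ℕ.* (b ℕ.+ s)
    square = solveℕ
    ar₁ : ∀ s x′ y b N′ → s ℤ.+ x′ ℤ.+ y ℤ.+ (b ℤ.+ (s ℤ.+ N′)) ℤ.- (b ℤ.+ s) ≡ s ℤ.+ x′ ℤ.+ y ℤ.+ N′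
    ar₁ = solveℤ
    ar₂ : ∀ s x′ y N′ → s ℕ.+ x′ ℕ.+ y ℕ.+ N′ ≡ x′ ℕ.+ (y ℕ.+ (s ℕ.+ N′))
    ar₂ = solveℕ
    top : T * (binom x s * Y) ≈ binom ((x ∸ s) ℕ.+ (y ℕ.+ N)) (N ∸ s) * (binom x s * Y)
    top with s ℕₚ.≤? x
    ... | no s≰x = trans (zero-*ʳ (zero-*ˡ z)) (sym (zero-*ʳ (zero-*ˡ z)))
      where z = binom-zero (ℕₚ.≰⇒> s≰x)
    ... | yes s≤x with ℕₚ.m≤n⇒∃[o]m+o≡n s≤x | ℕₚ.m≤n⇒∃[o]m+o≡n s≤N
    ...   | x′ , ≡.refl | N′ , ≡.refl rewrite ℕₚ.m+n∸m≡n s x′ | ℕₚ.m+n∸m≡n s N′ = *-congʳ (begin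
      binomℤ (+ (s ℕ.+ x′ ℕ.+ y) ℤ.+ + (b ℕ.+ (s ℕ.+ N′)) ℤ.- + (b ℕ.+ s)) (+ (s ℕ.+ x′ ℕ.+ y))
        ≈⟨ binomℤ-cong (ar₁ (+ s) (+ x′) (+ y) (+ b) (+ N′)) ≡.refl ⟩
      binomℤ (+ (s ℕ.+ x′ ℕ.+ y ℕ.+ N′)) (+ (s ℕ.+ x′ ℕ.+ y))
        ≈⟨ binomℤ-+ _ _ ⟩
      binom (s ℕ.+ x′ ℕ.+ y ℕ.+ N′) (s ℕ.+ x′ ℕ.+ y)
        ≈⟨ binom-sym (s ℕ.+ x′ ℕ.+ y) N′ ≡.refl ⟩
      binom (s ℕ.+ x′ ℕ.+ y ℕ.+ N′) N′
        ≈⟨ binom-cong (ar₂ s x′ y N′) ≡.refl ⟩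
      binom (x′ ℕ.+ (y ℕ.+ (s ℕ.+ N′))) N′ ∎)

  -- By symmetry of the binomials the last two factors are [X - B; i - B] and [Y + B; i + B]. The
  -- term is invariant under (X, Y, B) ↦ (Y, X, -B).
  saalschütz-term : ℕ → ℕ → ℤ → ℤ → ℤ → ℕ → Carrier
  saalschütz-term P M X Y B i =
    q^ (i ℕ.* i) * (binomℤ (+ P ℤ.+ + M ℤ.- + i) (+ P) * (binomℤ (X ℤ.- B) (X ℤ.- + i) * binomℤ (Y ℤ.+ B) (Y ℤ.- + i)))

  private
    sum-negative : ∀ X Y P i → X ℤ.+ Y ≡ + P → P < i ℕ.+ i → X ℤ.- + i ℤ.< + 0 ⊎ Y ℤ.- + i ℤ.< + 0
    sum-negative X Y P i X+Y≡P P<2i with X ℤ.- + i in eq₁ | Y ℤ.- + i in eq₂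
    ... | -[1+ _ ] | _        = inj₁ ℤ.-<+
    ... | + _      | -[1+ _ ] = inj₂ ℤ.-<+
    ... | + u      | + v      = contradiction P<2i (ℕₚ.≤⇒≯ (≡.subst (i ℕ.+ i ≤_) (ℤₚ.+-injective P≡) (ℕₚ.m≤m+n (i ℕ.+ i) (u ℕ.+ v))))
      where
      ar : ∀ X Y i → i ℤ.+ i ℤ.+ ((X ℤ.- i) ℤ.+ (Y ℤ.- i)) ≡ X ℤ.+ Y
      ar = solveℤ
      P≡ : + (i ℕ.+ i ℕ.+ (u ℕ.+ v)) ≡ + P
      P≡ = ≡.trans (≡.cong₂ (λ x y → + i ℤ.+ + i ℤ.+ (x ℤ.+ y)) (≡.sym eq₁) (≡.sym eq₂)) (≡.trans (ar X Y (+ i)) X+Y≡P)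

  -- X - i and Y - i add up to P - 2i < 0, so one lower entry is negative. Any range i ≤ r with 2(r
  -- + 1) > P therefore gives the full sum.
  saalschütz-term-large : ∀ X Y B P M i → X ℤ.+ Y ≡ + P → P < i ℕ.+ i → saalschütz-term P M X Y B i ≈ 0#
  saalschütz-term-large X Y B P M i X+Y≡P P<2i with sum-negative X Y P i X+Y≡P P<2i
  ... | inj₁ X<i = zero-*ʳ (zero-*ʳ (zero-*ˡ (binomℤ-k<0 _ X<i)))
  ... | inj₂ Y<i = zero-*ʳ (zero-*ʳ (zero-*ʳ (binomℤ-k<0 _ Y<i)))

  saalschütz-term-M<i : ∀ X Y B P M i → M < i → saalschütz-term P M X Y B i ≈ 0#
  saalschütz-term-M<i X Y B P M i M<i = zero-*ʳ (zero-*ˡ (binomℤ-n<k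
    (≡.subst₂ ℤ._<_ (≡.sym (ℤₚ.+-assoc (+ P) (+ M) (ℤ.- + i))) (ℤₚ.+-identityʳ (+ P))
      (ℤₚ.+-monoʳ-< (+ P) (≡.subst (+ M ℤ.- + i ℤ.<_) (ℤₚ.+-inverseʳ (+ i)) (ℤₚ.+-monoˡ-< (ℤ.- + i) (ℤ.+<+ M<i)))))))

  saalschütz-term-i<B : ∀ X Y b P M i → i < b → saalschütz-term P M X Y (+ b) i ≈ 0#
  saalschütz-term-i<B X Y b P M i i<b = zero-*ʳ (zero-*ʳ (zero-*ˡ (binomℤ-n<k
    (ℤₚ.+-monoʳ-< X (ℤₚ.neg-mono-< (ℤ.+<+ i<b))))))

  -- The terms with i < b, with i > M and with 2i > P all vanish, so the range i ≤ r can be replaced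
  -- by b ≤ i ≤ M, where `saalschütz-natural` applies.
  saalschütz-shifted : ∀ x y b M r → x ℕ.+ y < suc r ℕ.+ suc r →
    ∑ (suc r) (saalschütz-term (x ℕ.+ y) M (+ x ℤ.+ + b) (+ y ℤ.- + b) (+ b))
      ≈ q^ (b ℕ.* b) * (binomℤ (+ x ℤ.+ + b ℤ.+ + M) (+ x ℤ.+ + b ℤ.+ + b)
                        * binomℤ (+ y ℤ.- + b ℤ.+ + M) (+ y ℤ.- + b ℤ.- + b))
  saalschütz-shifted x y b M r P<2r with b ℕₚ.≤? M
  ... | no b≰M = trans (∑-zero (suc r) λ i _ → vanish i)
                       (sym (zero-*ʳ (zero-*ˡ (binomℤ-n<k (ℤₚ.+-monoʳ-< (+ x ℤ.+ + b) (ℤ.+<+ (ℕₚ.≰⇒> b≰M)))))))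
    where
    vanish : ∀ i → saalschütz-term (x ℕ.+ y) M (+ x ℤ.+ + b) (+ y ℤ.- + b) (+ b) i ≈ 0#
    vanish i with i ℕₚ.<? b
    ... | yes i<b = saalschütz-term-i<B (+ x ℤ.+ + b) (+ y ℤ.- + b) b (x ℕ.+ y) M i i<b
    ... | no i≮b  = saalschütz-term-M<i (+ x ℤ.+ + b) (+ y ℤ.- + b) (+ b) (x ℕ.+ y) M i
                      (ℕₚ.<-≤-trans (ℕₚ.≰⇒> b≰M) (ℕₚ.≮⇒≥ i≮b))
  ... | yes b≤M with ℕₚ.m≤n⇒∃[o]m+o≡n b≤M
  ...   | N , ≡.refl = begin
    ∑ (suc r) F
      ≈⟨ ∑-change-bound (suc r) (b ℕ.+ suc N) F
           (λ i r<i → saalschütz-term-large X Y (+ b) (x ℕ.+ y) (b ℕ.+ N) i (X+Y (+ x) (+ y) (+ b)) (ℕₚ.<-≤-trans P<2r (ℕₚ.+-mono-≤ r<i r<i)))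
           (λ i M<i → saalschütz-term-M<i X Y (+ b) (x ℕ.+ y) (b ℕ.+ N) i (≡.subst (_≤ i) (ℕₚ.+-suc b N) M<i)) ⟩
    ∑ (b ℕ.+ suc N) F
      ≈⟨ ∑-shift b (suc N) F (λ i → saalschütz-term-i<B X Y b (x ℕ.+ y) (b ℕ.+ N) i) ⟩
    ∑ (suc N) (λ s → F (b ℕ.+ s))
      ≈⟨ ∑-cong (suc N) {λ s → F (b ℕ.+ s)} {λ s → q^ (b ℕ.* b) * G s} (λ { s (s≤s s≤N) → trans
           (*-congˡ (*-congˡ (*-cong (binomℤ-cong (ar₁ (+ x) (+ b)) (ar₂ (+ x) (+ b) (+ s))) (binomℤ-cong (ar₃ (+ y) (+ b)) (ar₄ (+ y) (+ b) (+ s))))))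
           (saalschütz-natural x y b N s s≤N) }) ⟩
    ∑ (suc N) (λ s → q^ (b ℕ.* b) * G s)
      ≈⟨ *-distribˡ-∑ (suc N) (q^ (b ℕ.* b)) G ⟨
    q^ (b ℕ.* b) * ∑ (suc N) G
      ≈⟨ *-congˡ (q-saalschütz x y N (b ℕ.+ b)) ⟩
    q^ (b ℕ.* b) * (binom (x ℕ.+ (N ℕ.+ (b ℕ.+ b))) N * binom (y ℕ.+ N) (N ℕ.+ (b ℕ.+ b)))
      ≈⟨ *-congˡ (*-cong
           (trans (binom-sym N (x ℕ.+ b ℕ.+ b) (ar₅ x N b))
             (trans (binom-cong (ar₆ x N b) ≡.refl) (sym (binomℤ-+ _ _))))
           (trans (sym (binomℤ-complement _ _)) (binomℤ-cong (ar₇ (+ y) (+ N) (+ b)) (ar₈ (+ y) (+ N) (+ b))))) ⟩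
    q^ (b ℕ.* b) * (binomℤ (X ℤ.+ + (b ℕ.+ N)) (X ℤ.+ + b) * binomℤ (Y ℤ.+ + (b ℕ.+ N)) (Y ℤ.- + b)) ∎
    where
    X = + x ℤ.+ + b
    Y = + y ℤ.- + b
    F G : ℕ → Carrier
    F = saalschütz-term (x ℕ.+ y) (b ℕ.+ N) X Y (+ b)
    G s = q^ (s ℕ.* (s ℕ.+ (b ℕ.+ b))) * (binom ((x ∸ s) ℕ.+ (y ℕ.+ N)) (N ∸ s) * (binom x s * binom y (s ℕ.+ (b ℕ.+ b))))
    X+Y : ∀ x y b → x ℤ.+ b ℤ.+ (y ℤ.- b) ≡ x ℤ.+ y
    X+Y = solveℤ
    ar₁ : ∀ x b → x ℤ.+ b ℤ.- b ≡ x
    ar₁ = solveℤ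
    ar₂ : ∀ x b s → x ℤ.+ b ℤ.- (b ℤ.+ s) ≡ x ℤ.- s
    ar₂ = solveℤ
    ar₃ : ∀ y b → y ℤ.- b ℤ.+ b ≡ y
    ar₃ = solveℤ
    ar₄ : ∀ y b s → y ℤ.- b ℤ.- (b ℤ.+ s) ≡ y ℤ.- (s ℤ.+ (b ℤ.+ b))
    ar₄ = solveℤ
    ar₅ : ∀ x N b → N ℕ.+ (x ℕ.+ b ℕ.+ b) ≡ x ℕ.+ (N ℕ.+ (b ℕ.+ b))
    ar₅ = solveℕ
    ar₆ : ∀ x N b → x ℕ.+ (N ℕ.+ (b ℕ.+ b)) ≡ x ℕ.+ b ℕ.+ (b ℕ.+ N)
    ar₆ = solveℕ
    ar₇ : ∀ y N b → y ℤ.+ N ≡ y ℤ.- b ℤ.+ (b ℤ.+ N)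
    ar₇ = solveℤ
    ar₈ : ∀ y N b → y ℤ.+ N ℤ.- (N ℤ.+ (b ℤ.+ b)) ≡ y ℤ.- b ℤ.- b
    ar₈ = solveℤ

  -- If X - b or Y + b is negative, the left side vanishes term by term, and on the right the lower
  -- entry Y - b is negative; for X - b < 0 this is where Y ≤ X enters.
  saalschütz-nonneg : ∀ X Y b P M r → X ℤ.+ Y ≡ + P → P < suc r ℕ.+ suc r → Y ℤ.≤ X →
    ∑ (suc r) (saalschütz-term P M X Y (+ b))
      ≈ q^ (b ℕ.* b) * (binomℤ (X ℤ.+ + M) (X ℤ.+ + b) * binomℤ (Y ℤ.+ + M) (Y ℤ.- + b))
  saalschütz-nonneg X Y b P M r X+Y≡P P<2r Y≤X = split (X ℤ.- + b) (Y ℤ.+ + b) ≡.refl ≡.refl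
    where
    ar₁ : ∀ X b → X ≡ X ℤ.- b ℤ.+ b
    ar₁ = solveℤ
    ar₂ : ∀ Y b → Y ≡ Y ℤ.+ b ℤ.- b
    ar₂ = solveℤ
    ar₃ : ∀ x y b → x ℤ.+ b ℤ.+ (y ℤ.- b) ≡ x ℤ.+ y
    ar₃ = solveℤ
    Goal = ∑ (suc r) (saalschütz-term P M X Y (+ b))
             ≈ q^ (b ℕ.* b) * (binomℤ (X ℤ.+ + M) (X ℤ.+ + b) * binomℤ (Y ℤ.+ + M) (Y ℤ.- + b))
    main : ∀ x y X Y P → X ≡ + x ℤ.+ + b → Y ≡ + y ℤ.- + b → P ≡ x ℕ.+ y → P < suc r ℕ.+ suc r →
      ∑ (suc r) (saalschütz-term P M X Y (+ b))
        ≈ q^ (b ℕ.* b) * (binomℤ (X ℤ.+ + M) (X ℤ.+ + b) * binomℤ (Y ℤ.+ + M) (Y ℤ.- + b))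
    main x y _ _ _ ≡.refl ≡.refl ≡.refl = saalschütz-shifted x y b M r
    split : ∀ u v → X ℤ.- + b ≡ u → Y ℤ.+ + b ≡ v → Goal
    split -[1+ x ] v eqx eqy = trans (∑-zero (suc r) λ i _ → zero-*ʳ (zero-*ʳ (zero-*ˡ (binomℤ-n<0 _ (neg-by x eqx)))))
      (sym (zero-*ʳ (zero-*ʳ (binomℤ-k<0 _ (ℤₚ.≤-<-trans (ℤₚ.+-monoˡ-≤ (ℤ.- + b) Y≤X) (neg-by x eqx))))))
    split (+ x) -[1+ y ] eqx eqy = trans (∑-zero (suc r) λ i _ → zero-*ʳ (zero-*ʳ (zero-*ʳ (binomℤ-n<0 _ (neg-by y eqy)))))
      (sym (zero-*ʳ (zero-*ʳ (binomℤ-k<0 _ (ℤₚ.≤-<-trans (ℤₚ.≤-trans (ℤₚ.i-j≤i Y (+ b)) (ℤₚ.i≤i+j Y (+ b))) (neg-by y eqy))))))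
    split (+ x) (+ y) eqx eqy = main x y X Y P X≡ Y≡ (ℤₚ.+-injective (≡.trans (≡.sym X+Y≡P)
        (≡.trans (≡.cong₂ ℤ._+_ X≡ Y≡) (ar₃ (+ x) (+ y) (+ b))))) P<2r
      where
      X≡ = ≡.trans (ar₁ X (+ b)) (≡.cong (ℤ._+ + b) eqx)
      Y≡ = ≡.trans (ar₂ Y (+ b)) (≡.cong (ℤ._- + b) eqy)

  -- Negative B reduces to the other case by exchanging X with Y and B with -B, which also reverses
  -- the order of X and Y.
  saalschütz-integer : ∀ X Y B P M r → X ℤ.+ Y ≡ + P → P < suc r ℕ.+ suc r →
    (+ 0 ℤ.≤ B × Y ℤ.≤ X) ⊎ (B ℤ.≤ + 0 × X ℤ.≤ Y) →
    ∑ (suc r) (saalschütz-term P M X Y B)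
      ≈ q^ (sq B) * (binomℤ (X ℤ.+ + M) (X ℤ.+ B) * binomℤ (Y ℤ.+ + M) (Y ℤ.- B))
  saalschütz-integer X Y (+ b) P M r eq P<2r (inj₁ (_ , Y≤X)) = saalschütz-nonneg X Y b P M r eq P<2r Y≤X
  saalschütz-integer X Y B P M r eq P<2r (inj₂ (B≤0 , X≤Y)) with nonpos B B≤0
  ... | b , -B≡ = begin
    ∑ (suc r) (saalschütz-term P M X Y B)
      ≈⟨ ∑-cong (suc r) (λ i _ → *-congˡ (*-congˡ (trans (*-comm _ _) (*-cong
           (binomℤ-cong (≡.trans (ar₁ Y B) (≡.cong (λ t → Y ℤ.- t) -B≡)) ≡.refl)
           (binomℤ-cong (≡.cong (λ t → X ℤ.+ t) -B≡) ≡.refl))))) ⟩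
    ∑ (suc r) (saalschütz-term P M Y X (+ b))
      ≈⟨ saalschütz-nonneg Y X b P M r (≡.trans (ℤₚ.+-comm Y X) eq) P<2r X≤Y ⟩
    q^ (b ℕ.* b) * (binomℤ (Y ℤ.+ + M) (Y ℤ.+ + b) * binomℤ (X ℤ.+ + M) (X ℤ.- + b))
      ≈⟨ *-cong (qpow-cong (≡.cong (λ k → k ℕ.* k) ∣B∣≡b)) (trans (*-comm _ _) (*-cong
           (binomℤ-cong ≡.refl (≡.trans (≡.cong (λ t → X ℤ.- t) (≡.sym -B≡)) (≡.sym (ar₁ X B))))
           (binomℤ-cong ≡.refl (≡.cong (λ t → Y ℤ.+ t) (≡.sym -B≡))))) ⟩
    q^ (sq B) * (binomℤ (X ℤ.+ + M) (X ℤ.+ B) * binomℤ (Y ℤ.+ + M) (Y ℤ.- B)) ∎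
    where
    ar₁ : ∀ Y B → Y ℤ.+ B ≡ Y ℤ.- ℤ.- B
    ar₁ = solveℤ
    ∣B∣≡b : b ≡ ∣ B ∣
    ∣B∣≡b = ≡.trans (≡.sym (≡.cong ∣_∣ -B≡)) (ℤₚ.∣-i∣≡∣i∣ B)

-- Truncated sums over the integers, signs and triangular numbers

module IntegerSums {c ℓ} (R : CommutativeRing c ℓ) (Qp : QuantumParameter R) where
  open CommutativeRing R hiding (zero)
  open SemiringSolver commutativeSemiring using (solve; _:+_; _:*_; _:=_)
  open SetoidReasoning setoid
  open QBinomial R Qp

  -- Pairs j with -j, so that the reflection j ↦ -j acts inside each summand.
  ∑ℤ : ℕ → (ℤ → Carrier) → Carrier
  ∑ℤ N f = f (+ 0) + ∑ N (λ m → f (+ suc m) + f -[1+ m ])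

  ∑ℤ-cong : ∀ N {f g : ℤ → Carrier} → (∀ j → f j ≈ g j) → ∑ℤ N f ≈ ∑ℤ N g
  ∑ℤ-cong N f≈g = +-cong (f≈g (+ 0)) (∑-cong N λ m _ → +-cong (f≈g (+ suc m)) (f≈g -[1+ m ]))

  ∑ℤ-distrib-+ : ∀ N (f g : ℤ → Carrier) → ∑ℤ N (λ j → f j + g j) ≈ ∑ℤ N f + ∑ℤ N g
  ∑ℤ-distrib-+ N f g = trans
    (+-congˡ (trans (∑-cong N λ _ _ → +-interchange _ _ _ _)
                    (∑-distrib-+ N (λ m → f (+ suc m) + f -[1+ m ]) (λ m → g (+ suc m) + g -[1+ m ]))))
    (+-interchange _ _ _ _)

  *-distribˡ-∑ℤ : ∀ N x (f : ℤ → Carrier) → x * ∑ℤ N f ≈ ∑ℤ N (λ j → x * f j)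
  *-distribˡ-∑ℤ N x f = trans (distribˡ x _ _) (+-congˡ (trans (*-distribˡ-∑ N x _) (∑-cong N λ _ _ → distribˡ x _ _)))

  ∑-∑ℤ-comm : ∀ n N (f : ℕ → ℤ → Carrier) → ∑ n (λ i → ∑ℤ N (f i)) ≈ ∑ℤ N (λ j → ∑ n (λ i → f i j))
  ∑-∑ℤ-comm n N f = begin
    ∑ n (λ i → ∑ℤ N (f i))
      ≈⟨ ∑-distrib-+ n (λ i → f i (+ 0)) (λ i → ∑ N (λ m → f i (+ suc m) + f i -[1+ m ])) ⟩
    ∑ n (λ i → f i (+ 0)) + ∑ n (λ i → ∑ N (λ m → f i (+ suc m) + f i -[1+ m ]))
      ≈⟨ +-congˡ (∑-comm n N (λ i m → f i (+ suc m) + f i -[1+ m ])) ⟩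
    ∑ n (λ i → f i (+ 0)) + ∑ N (λ m → ∑ n (λ i → f i (+ suc m) + f i -[1+ m ]))
      ≈⟨ +-congˡ (∑-cong N λ m _ → ∑-distrib-+ n (λ i → f i (+ suc m)) (λ i → f i -[1+ m ])) ⟩
    ∑ℤ N (λ j → ∑ n (λ i → f i j)) ∎

  ∑ℤ-neg : ∀ N (f : ℤ → Carrier) → ∑ℤ N f ≈ ∑ℤ N (λ j → f (ℤ.- j))
  ∑ℤ-neg N f = +-congˡ (∑-cong N λ _ _ → +-comm _ _)

  ∑ℤ-single : ∀ N (f : ℤ → Carrier) → (∀ m → f (+ suc m) ≈ 0#) → (∀ m → f -[1+ m ] ≈ 0#) → ∑ℤ N f ≈ f (+ 0)
  ∑ℤ-single N f f+≈0 f-≈0 =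
    trans (+-congˡ (∑-zero N λ m _ → trans (+-cong (f+≈0 m) (f-≈0 m)) (+-identityˡ 0#))) (+-identityʳ _)

  ∑ℤ-zero : ∀ N (f : ℤ → Carrier) → (∀ j → f j ≈ 0#) → ∑ℤ N f ≈ 0#
  ∑ℤ-zero N f f≈0 = trans (∑ℤ-single N f (λ m → f≈0 (+ suc m)) (λ m → f≈0 -[1+ m ])) (f≈0 (+ 0))

  -- The reflection j ↦ -1-j swaps + m and -[1+ m ], so the sum telescopes.
  ∑ℤ-antisym : ∀ N (f : ℤ → Carrier) → (∀ m → f -[1+ m ] ≈ - f (+ m)) → f (+ N) ≈ 0# → ∑ℤ N f ≈ 0#
  ∑ℤ-antisym N f anti f≈0 = trans (telescope N) f≈0
    where
    telescope : ∀ N → ∑ℤ N f ≈ f (+ N)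
    telescope zero    = trans (+-congˡ (∑-0 _)) (+-identityʳ _)
    telescope (suc N) = begin
      f (+ 0) + ∑ (suc N) (λ m → f (+ suc m) + f -[1+ m ]) ≈⟨ +-congˡ (∑-last N _) ⟩
      f (+ 0) + (∑ N (λ m → f (+ suc m) + f -[1+ m ]) + (f (+ suc N) + f -[1+ N ])) ≈⟨ +-assoc _ _ _ ⟨
      ∑ℤ N f + (f (+ suc N) + f -[1+ N ]) ≈⟨ +-cong (telescope N) (+-congˡ (anti N)) ⟩
      f (+ N) + (f (+ suc N) - f (+ N)) ≈⟨ solve 3 (λ a b c → a :+ (b :+ c) := b :+ (a :+ c)) refl _ _ _ ⟩
      f (+ suc N) + (f (+ N) - f (+ N)) ≈⟨ +-congˡ (-‿inverseʳ _) ⟩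
      f (+ suc N) + 0# ≈⟨ +-identityʳ _ ⟩
      f (+ suc N) ∎

  signℕ : ℕ → Carrier
  signℕ zero    = 1#
  signℕ (suc n) = - signℕ n

  abstract
    sign : ℤ → Carrier
    sign j = signℕ ∣ j ∣

    sign-def : ∀ j → sign j ≈ signℕ ∣ j ∣
    sign-def j = refl

    sign-neg : ∀ j → sign (ℤ.- j) ≈ sign j
    sign-neg j = reflexive (≡.cong signℕ (ℤₚ.∣-i∣≡∣i∣ j))

    sign-reflect : ∀ m → sign -[1+ m ] ≈ - sign (+ m)
    sign-reflect m = refl

    sign-0 : sign (+ 0) ≈ 1#
    sign-0 = refl

tri : ℕ → ℕ
tri zero    = 0
tri (suc n) = suc n ℕ.+ tri n

-- j (j + 1) / 2
triℤ : ℤ → ℕ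
triℤ (+ n)    = tri n
triℤ -[1+ n ] = tri n

tri-double : ∀ n → tri n ℕ.+ tri n ≡ n ℕ.* n ℕ.+ n
tri-double zero    = ≡.refl
tri-double (suc n) = ≡.trans (ar₁ n (tri n)) (≡.trans (≡.cong (ℕ._+ (2 ℕ.+ n ℕ.+ n)) (tri-double n)) (ar₂ n))
  where
  ar₁ : ∀ n t → suc n ℕ.+ t ℕ.+ (suc n ℕ.+ t) ≡ t ℕ.+ t ℕ.+ (2 ℕ.+ n ℕ.+ n)
  ar₁ = solveℕ
  ar₂ : ∀ n → n ℕ.* n ℕ.+ n ℕ.+ (2 ℕ.+ n ℕ.+ n) ≡ suc n ℕ.* suc n ℕ.+ suc n
  ar₂ = solveℕ

+[tri+tri] : ∀ n → + tri n ℤ.+ + tri n ≡ + n ℤ.* + n ℤ.+ + n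
+[tri+tri] n = ≡.trans (≡.cong +_ (tri-double n)) (≡.cong (ℤ._+ + n) (ℤₚ.pos-* n n))

triℤ-double : ∀ j → + triℤ j ℤ.+ + triℤ j ≡ j ℤ.* j ℤ.+ j
triℤ-double (+ n)    = +[tri+tri] n
triℤ-double -[1+ n ] = ≡.trans (+[tri+tri] n) (ar (+ n))
  where
  ar : ∀ n → n ℤ.* n ℤ.+ n ≡ (ℤ.- (+ 1 ℤ.+ n)) ℤ.* (ℤ.- (+ 1 ℤ.+ n)) ℤ.+ (ℤ.- (+ 1 ℤ.+ n))
  ar = solveℤ

triℤ-neg : ∀ j → + triℤ (ℤ.- j) ℤ.+ j ≡ + triℤ j
triℤ-neg (+ zero)  = ≡.refl
triℤ-neg (+ suc n) = ℤₚ.+-comm (+ tri n) (+ suc n)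
triℤ-neg -[1+ n ]  = ar (+ suc n) (+ tri n)
  where
  ar : ∀ s t → s ℤ.+ t ℤ.+ ℤ.- s ≡ t
  ar = solveℤ

+sq : ∀ j → + sq j ≡ j ℤ.* j
+sq (+ n)    = ℤₚ.pos-* n n
+sq -[1+ n ] = ≡.refl

sq-neg : ∀ j → sq (ℤ.- j) ≡ sq j
sq-neg j = ≡.cong (λ k → k ℕ.* k) (ℤₚ.∣-i∣≡∣i∣ j)

-- j (3 j + 1) / 2
pentℤ : ℤ → ℕ
pentℤ j = sq j ℕ.+ triℤ j

-- A finite form of the pentagonal number theorem

module SeedIdentity {c ℓ} (R : CommutativeRing c ℓ) (Qp : QuantumParameter R) where
  open CommutativeRing R hiding (zero)
  open SemiringSolver commutativeSemiring using (solve; _:+_; _:*_; _:=_)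
  open Algebra.Properties.Ring ring using (-‿distribˡ-*)
  open SetoidReasoning setoid
  open QBinomial R Qp
  open IntegerBinomial R Qp
  open IntegerSums R Qp

  pair-neg : ∀ m n {k l} → k ℤ.+ l ℤ.< + 0 → binomℤ m k * binomℤ n l ≈ 0#
  pair-neg m n { -[1+ k ]} k+l<0 = zero-*ˡ (binomℤ-negʳ m k)
  pair-neg m n {+ k} { -[1+ l ]} k+l<0 = zero-*ʳ (binomℤ-negʳ n l)
  pair-neg m n {+ k} {+ l} (ℤ.+<+ ())

  -- A nonnegative l forces k > m, so one of the two factors always vanishes.
  pair-far : ∀ {m} n {k l} → m ℤ.< k ℤ.- l → binomℤ m k * binomℤ n l ≈ 0#
  pair-far n {l = -[1+ l ]} _ = zero-*ʳ (binomℤ-negʳ n l)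
  pair-far n {k} {+ l} m<k-l = zero-*ˡ (binomℤ-n<k (ℤₚ.<-≤-trans m<k-l (ℤₚ.i-j≤i k (+ l))))

  binom² : ∀ k → binomℤ (+ 0) k * binomℤ (+ 0) k ≈ binomℤ (+ 0) k
  binom² (+ zero)  = trans (*-congʳ (trans (binomℤ-+ 0 0) (binom-n-0 0))) (*-identityˡ _)
  binom² (+ suc k) = trans (zero-*ˡ z) (sym z)
    where z = trans (binomℤ-+ 0 (suc k)) (binom-0-suc k)
  binom² -[1+ k ]  = trans (zero-*ˡ (binomℤ-negʳ _ k)) (sym (binomℤ-negʳ _ k))

  term : (ℤ → ℕ) → (ℤ → Carrier) → ℤ → Carrier
  term e f j = sign j * (q^ e j * f j)

  term-cong : ∀ e {f g} j → f j ≈ g j → term e f j ≈ term e g j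
  term-cong e j f≈g = *-congˡ (*-congˡ f≈g)

  term-zero : ∀ e f j → f j ≈ 0# → term e f j ≈ 0#
  term-zero e f j f≈0 = zero-*ʳ (zero-*ʳ f≈0)

  term-antisym : ∀ e f → (∀ m → e -[1+ m ] ≡ e (+ m)) → (∀ m → f -[1+ m ] ≈ f (+ m)) →
                 ∀ m → term e f -[1+ m ] ≈ - term e f (+ m)
  term-antisym e f e≡ f≈ m =
    trans (*-cong (sign-reflect m) (*-cong (qpow-cong (e≡ m)) (f≈ m))) (sym (-‿distribˡ-* _ _))

  evenPair oddPair : ℕ → ℤ → ℤ → Carrier
  evenPair T L j = binomℤ (+ T) (L ℤ.+ j) * binomℤ (+ T) (L ℤ.- j)
  oddPair  T L j = binomℤ (+ suc T) (L ℤ.+ j) * binomℤ (+ T) (L ℤ.- + 1 ℤ.- j)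

  -- The two families determine each other by recursion on T and are evaluated as [T; L] and
  -- [T; L - 1]. Letting T and then L grow, the evaluation of V becomes Euler's pentagonal number
  -- theorem.
  V W : ℕ → ℕ → ℤ → Carrier
  V N T L = ∑ℤ N (term pentℤ (evenPair T L))
  W N T L = ∑ℤ N (term pentℤ (oddPair T L))

  private
    even-sum : ∀ L j → (L ℤ.+ j) ℤ.+ (L ℤ.- j) ≡ L ℤ.+ L
    even-sum = solveℤ
    odd-sum : ∀ L j → (L ℤ.+ j) ℤ.+ (L ℤ.- + 1 ℤ.- j) ≡ L ℤ.+ L ℤ.- + 1
    odd-sum = solveℤ

  V-neg : ∀ N T l → V N T -[1+ l ] ≈ 0#
  V-neg N T l = ∑ℤ-zero N (term pentℤ (evenPair T -[1+ l ])) λ j → term-zero pentℤ (evenPair T -[1+ l ]) j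
    (pair-neg _ _ (≡.subst (ℤ._< + 0) (≡.sym (even-sum -[1+ l ] j)) ℤ.-<+))

  W-neg : ∀ N T l → W N T -[1+ l ] ≈ 0#
  W-neg N T l = ∑ℤ-zero N (term pentℤ (oddPair T -[1+ l ])) λ j → term-zero pentℤ (oddPair T -[1+ l ]) j
    (pair-neg _ _ (≡.subst (ℤ._< + 0) (≡.sym (odd-sum -[1+ l ] j)) ℤ.-<+))

  -- q-Pascal for the first factor; the second summand is antisymmetric under j ↦ -1-j.
  W-V : ∀ N T L → T ≤ N → W N T L ≈ V N T (L ℤ.- + 1)
  W-V N T -[1+ l ] T≤N = trans (W-neg N T l) (sym (V-neg N T (suc (l ℕ.+ 0))))
  W-V N T (+ l)    T≤N = begin
    ∑ℤ N (term pentℤ (oddPair T L))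
      ≈⟨ ∑ℤ-cong N {term pentℤ (oddPair T L)} {λ j → term pentℤ (evenPair T (L ℤ.- + 1)) j + term e′ f j} step ⟩
    ∑ℤ N (λ j → term pentℤ (evenPair T (L ℤ.- + 1)) j + term e′ f j)
      ≈⟨ ∑ℤ-distrib-+ N (term pentℤ (evenPair T (L ℤ.- + 1))) (term e′ f) ⟩
    V N T (L ℤ.- + 1) + ∑ℤ N (term e′ f)
      ≈⟨ +-congˡ (∑ℤ-antisym N (term e′ f) (term-antisym e′ f (λ _ → ≡.refl) reflect) far) ⟩
    V N T (L ℤ.- + 1) + 0#
      ≈⟨ +-identityʳ _ ⟩
    V N T (L ℤ.- + 1) ∎
    where
    L = + l
    -- Three triangular numbers plus L: in this form the invariance under j ↦ -1-j is definitional,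
    -- since `triℤ` takes the same value at `+ m` and `-[1+ m ]`.
    e′ : ℤ → ℕ
    e′ j = triℤ j ℕ.+ (triℤ j ℕ.+ triℤ j) ℕ.+ l
    f : ℤ → Carrier
    f j = binomℤ (+ T) (L ℤ.+ j) * binomℤ (+ T) (L ℤ.- + 1 ℤ.- j)
    ar₁ : ∀ j t L → j ℤ.* j ℤ.+ t ℤ.+ (L ℤ.+ j) ≡ t ℤ.+ (j ℤ.* j ℤ.+ j) ℤ.+ L
    ar₁ = solveℤ
    exponent : ∀ j → + pentℤ j ℤ.+ (L ℤ.+ j) ≡ + e′ j
    exponent j = ≡.trans (≡.cong (λ s → s ℤ.+ + triℤ j ℤ.+ (L ℤ.+ j)) (+sq j))
      (≡.trans (ar₁ j (+ triℤ j) L) (≡.cong (λ s → + triℤ j ℤ.+ s ℤ.+ L) (≡.sym (triℤ-double j))))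
    ar₂ : ∀ L j → L ℤ.+ j ℤ.- + 1 ≡ L ℤ.- + 1 ℤ.+ j
    ar₂ = solveℤ
    step : ∀ j → term pentℤ (oddPair T L) j ≈ term pentℤ (evenPair T (L ℤ.- + 1)) j + term e′ f j
    step j = begin
      sign j * (q^ pentℤ j * (binomℤ (+ suc T) (L ℤ.+ j) * b))
        ≈⟨ *-congˡ (*-assoc _ _ _) ⟨
      sign j * (q^ pentℤ j * binomℤ (+ suc T) (L ℤ.+ j) * b)
        ≈⟨ *-congˡ (*-congʳ (binomℤ-pascal T (L ℤ.+ j) (pentℤ j) (e′ j) (exponent j))) ⟩
      sign j * ((q^ pentℤ j * binomℤ (+ T) (L ℤ.+ j ℤ.- + 1) + q^ e′ j * binomℤ (+ T) (L ℤ.+ j)) * b)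
        ≈⟨ solve 6 (λ s p x e y b → s :* ((p :* x :+ e :* y) :* b) := s :* (p :* (x :* b)) :+ s :* (e :* (y :* b))) refl _ _ _ _ _ _ ⟩
      sign j * (q^ pentℤ j * (binomℤ (+ T) (L ℤ.+ j ℤ.- + 1) * b)) + term e′ f j
        ≈⟨ +-congʳ (term-cong pentℤ {λ j → binomℤ (+ T) (L ℤ.+ j ℤ.- + 1) * b} {evenPair T (L ℤ.- + 1)} j
             (*-congʳ (binomℤ-cong ≡.refl (ar₂ L j)))) ⟩
      term pentℤ (evenPair T (L ℤ.- + 1)) j + term e′ f j ∎
      where b = binomℤ (+ T) (L ℤ.- + 1 ℤ.- j)
    ar₃ : ∀ L m → L ℤ.+ ℤ.- (+ 1 ℤ.+ m) ≡ L ℤ.- + 1 ℤ.- m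
    ar₃ = solveℤ
    ar₄ : ∀ L m → L ℤ.- + 1 ℤ.- ℤ.- (+ 1 ℤ.+ m) ≡ L ℤ.+ m
    ar₄ = solveℤ
    reflect : ∀ m → f -[1+ m ] ≈ f (+ m)
    reflect m = trans (*-cong (binomℤ-cong ≡.refl (ar₃ L (+ m))) (binomℤ-cong ≡.refl (ar₄ L (+ m)))) (*-comm _ _)
    ar₅ : ∀ L n → L ℤ.+ n ℤ.- (L ℤ.- + 1 ℤ.- n) ≡ + 1 ℤ.+ n ℤ.+ n
    ar₅ = solveℤ
    -- At j = N the lower entries differ by 2N + 1 > T, which is what T ≤ N is for.
    far : term e′ f (+ N) ≈ 0#
    far = term-zero e′ f (+ N) (pair-far _ (≡.subst (+ T ℤ.<_) (≡.sym (ar₅ L (+ N)))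
      (ℤ.+<+ (s≤s (ℕₚ.≤-trans T≤N (ℕₚ.m≤m+n N N))))))

  -- q-Pascal on the second factor. In the part carrying q^{L-j}, reflecting j ↦ -j and
  -- complementing both binomials restores the exponent j(3j + 1)/2 and gives W at T + 1 - L.
  V-W : ∀ N T l → V N (suc T) (+ l) ≈ W N T (+ l) + q^ l * W N T (+ suc T ℤ.- + l)
  V-W N T l = begin
    ∑ℤ N (term pentℤ (evenPair (suc T) L))
      ≈⟨ ∑ℤ-cong N {term pentℤ (evenPair (suc T) L)} {λ j → term pentℤ (oddPair T L) j + q^ l * g j} step ⟩
    ∑ℤ N (λ j → term pentℤ (oddPair T L) j + q^ l * g j)
      ≈⟨ ∑ℤ-distrib-+ N (term pentℤ (oddPair T L)) (λ j → q^ l * g j) ⟩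
    W N T L + ∑ℤ N (λ j → q^ l * g j)
      ≈⟨ +-congˡ (*-distribˡ-∑ℤ N (q^ l) g) ⟨
    W N T L + q^ l * ∑ℤ N g
      ≈⟨ +-congˡ (*-congˡ (trans (∑ℤ-neg N g) (∑ℤ-cong N {λ j → g (ℤ.- j)} {term pentℤ (oddPair T (+ suc T ℤ.- L))} flip))) ⟩
    W N T L + q^ l * W N T (+ suc T ℤ.- L) ∎
    where
    L = + l
    e : ℤ → ℕ
    e j = sq j ℕ.+ triℤ (ℤ.- j)
    h g : ℤ → Carrier
    h j = binomℤ (+ suc T) (L ℤ.+ j) * binomℤ (+ T) (L ℤ.- j)
    g = term e h
    ar₁ : ∀ s t j L → s ℤ.+ (t ℤ.+ j) ℤ.+ (L ℤ.- j) ≡ L ℤ.+ (s ℤ.+ t)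
    ar₁ = solveℤ
    exponent : ∀ j → + pentℤ j ℤ.+ (L ℤ.- j) ≡ + (l ℕ.+ e j)
    exponent j = ≡.trans (≡.cong (λ t → + sq j ℤ.+ t ℤ.+ (L ℤ.- j)) (≡.sym (triℤ-neg j)))
      (ar₁ (+ sq j) (+ triℤ (ℤ.- j)) j L)
    ar₂ : ∀ L j → L ℤ.- j ℤ.- + 1 ≡ L ℤ.- + 1 ℤ.- j
    ar₂ = solveℤ
    step : ∀ j → term pentℤ (evenPair (suc T) L) j ≈ term pentℤ (oddPair T L) j + q^ l * g j
    step j = begin
      sign j * (q^ pentℤ j * (b * binomℤ (+ suc T) (L ℤ.- j)))
        ≈⟨ solve 4 (λ s p b x → s :* (p :* (b :* x)) := s :* (b :* (p :* x))) refl _ _ _ _ ⟩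
      sign j * (b * (q^ pentℤ j * binomℤ (+ suc T) (L ℤ.- j)))
        ≈⟨ *-congˡ (*-congˡ (binomℤ-pascal T (L ℤ.- j) (pentℤ j) (l ℕ.+ e j) (exponent j))) ⟩
      sign j * (b * (q^ pentℤ j * binomℤ (+ T) (L ℤ.- j ℤ.- + 1) + q^ (l ℕ.+ e j) * binomℤ (+ T) (L ℤ.- j)))
        ≈⟨ *-congˡ (*-congˡ (+-cong (*-congˡ (binomℤ-cong ≡.refl (ar₂ L j))) (*-congʳ (q^-+ l (e j))))) ⟩
      sign j * (b * (q^ pentℤ j * binomℤ (+ T) (L ℤ.- + 1 ℤ.- j) + q^ l * q^ e j * binomℤ (+ T) (L ℤ.- j)))
        ≈⟨ solve 7 (λ s b p x l e y → s :* (b :* (p :* x :+ l :* e :* y)) := s :* (p :* (b :* x)) :+ l :* (s :* (e :* (b :* y)))) refl _ _ _ _ _ _ _ ⟩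
      term pentℤ (oddPair T L) j + q^ l * g j ∎
      where b = binomℤ (+ suc T) (L ℤ.+ j)
    ar₃ : ∀ T L j → + 1 ℤ.+ T ℤ.- (L ℤ.+ ℤ.- j) ≡ + 1 ℤ.+ T ℤ.- L ℤ.+ j
    ar₃ = solveℤ
    ar₄ : ∀ T L j → T ℤ.- (L ℤ.- ℤ.- j) ≡ + 1 ℤ.+ T ℤ.- L ℤ.- + 1 ℤ.- j
    ar₄ = solveℤ
    flip : ∀ j → g (ℤ.- j) ≈ term pentℤ (oddPair T (+ suc T ℤ.- L)) j
    flip j = *-cong (sign-neg j) (*-cong
      (qpow-cong (≡.cong₂ ℕ._+_ (sq-neg j) (≡.cong triℤ (ℤₚ.neg-involutive j))))
      (*-cong (trans (binomℤ-sym _ _) (binomℤ-cong ≡.refl (ar₃ (+ T) L j)))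
              (trans (binomℤ-sym _ _) (binomℤ-cong ≡.refl (ar₄ (+ T) L j)))))

  -- Induction on T: `V-W` and `W-V` reduce T + 1 to [T; L - 1] + q^L [T; T - L], which is q-Pascal.
  -- For T = 0 only the term j = 0 survives.
  V-binom : ∀ N T L → T ≤ N → V N T L ≈ binomℤ (+ T) L
  V-binom N T       -[1+ l ] T≤N = trans (V-neg N T l) (sym (binomℤ-negʳ _ l))
  V-binom N zero    (+ l)    T≤N = begin
    V N 0 L ≈⟨ ∑ℤ-single N (term pentℤ (evenPair 0 L)) positive negative ⟩
    term pentℤ (evenPair 0 L) (+ 0) ≈⟨ *-cong sign-0 (*-cong q^-0 (*-cong
                                                  (binomℤ-cong ≡.refl (ℤₚ.+-identityʳ L)) (binomℤ-cong ≡.refl (ℤₚ.+-identityʳ L)))) ⟩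
    1# * (1# * (binomℤ (+ 0) L * binomℤ (+ 0) L)) ≈⟨ trans (*-identityˡ _) (*-identityˡ _) ⟩
    binomℤ (+ 0) L * binomℤ (+ 0) L ≈⟨ binom² L ⟩
    binomℤ (+ 0) L ∎
    where
    L = + l
    ar₁ : ∀ L j → L ℤ.+ j ℤ.- (L ℤ.- j) ≡ j ℤ.+ j
    ar₁ = solveℤ
    ar₂ : ∀ L j → L ℤ.- ℤ.- j ℤ.- (L ℤ.+ ℤ.- j) ≡ j ℤ.+ j
    ar₂ = solveℤ
    positive : ∀ m → term pentℤ (evenPair 0 L) (+ suc m) ≈ 0#
    positive m = term-zero pentℤ (evenPair 0 L) (+ suc m)
      (pair-far _ (≡.subst (+ 0 ℤ.<_) (≡.sym (ar₁ L (+ suc m))) (ℤ.+<+ (s≤s z≤n))))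
    negative : ∀ m → term pentℤ (evenPair 0 L) -[1+ m ] ≈ 0#
    negative m = term-zero pentℤ (evenPair 0 L) -[1+ m ]
      (trans (*-comm _ _) (pair-far _ (≡.subst (+ 0 ℤ.<_) (≡.sym (ar₂ L (+ suc m))) (ℤ.+<+ (s≤s z≤n)))))
  V-binom N (suc T) (+ l)    T<N = begin
    V N (suc T) L
      ≈⟨ V-W N T l ⟩
    W N T L + q^ l * W N T (+ suc T ℤ.- L)
      ≈⟨ +-cong (step L) (*-congˡ (step (+ suc T ℤ.- L))) ⟩
    binomℤ (+ T) (L ℤ.- + 1) + q^ l * binomℤ (+ T) (+ suc T ℤ.- L ℤ.- + 1)
      ≈⟨ +-cong (sym (trans (*-congʳ q^-0) (*-identityˡ _)))
                (*-congˡ (trans (binomℤ-cong ≡.refl (ar (+ T) L)) (sym (binomℤ-sym _ L)))) ⟩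
    q^ 0 * binomℤ (+ T) (L ℤ.- + 1) + q^ l * binomℤ (+ T) L
      ≈⟨ binomℤ-pascal T L 0 l ≡.refl ⟨
    q^ 0 * binomℤ (+ suc T) L
      ≈⟨ trans (*-congʳ q^-0) (*-identityˡ _) ⟩
    binomℤ (+ suc T) L ∎
    where
    L = + l
    T≤N = ℕₚ.≤-trans (ℕₚ.n≤1+n T) T<N
    step : ∀ L → W N T L ≈ binomℤ (+ T) (L ℤ.- + 1)
    step L = trans (W-V N T L T≤N) (V-binom N T (L ℤ.- + 1) T≤N)
    ar : ∀ T L → + 1 ℤ.+ T ℤ.- L ℤ.- + 1 ≡ T ℤ.- L
    ar = solveℤ

  W-binom : ∀ N T L → T ≤ N → W N T L ≈ binomℤ (+ T) (L ℤ.- + 1)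
  W-binom N T L T≤N = trans (W-V N T L T≤N) (V-binom N T (L ℤ.- + 1) T≤N)

-- j (5 j + 1) / 2
seedExponent : ℤ → ℕ
seedExponent j = pentℤ j ℕ.+ sq j

+∸ : ∀ {i L} → i ≤ L → + (L ∸ i) ≡ + L ℤ.- + i
+∸ {i} {L} i≤L = ≡.trans (≡.sym (ℤₚ.⊖-≥ i≤L)) (≡.sym (ℤₚ.m-n≡m⊖n L i))

-- The Burge transform, and the identity for (2, 1)

module BurgeTransform {c ℓ} (R : CommutativeRing c ℓ) (Qp : QuantumParameter R) where
  open CommutativeRing R hiding (zero)
  open SemiringSolver commutativeSemiring using (solve; _:+_; _:*_; _:=_)
  open SetoidReasoning setoid
  open QBinomial R Qp
  open IntegerBinomial R Qp
  open IntegerSums R Qp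
  open SeedIdentity R Qp

  𝓑 : ℕ → ℕ → ℤ → ℤ → Carrier
  𝓑 L M a b = binomℤ (+ L ℤ.+ + M ℤ.+ a ℤ.- b) (+ L ℤ.+ a) * binomℤ (+ L ℤ.+ + M ℤ.- a ℤ.+ b) (+ L ℤ.- a)

  SameSign : ℤ → ℤ → Set
  SameSign a b = (+ 0 ℤ.≤ a × + 0 ℤ.≤ b) ⊎ (a ℤ.≤ + 0 × b ℤ.≤ + 0)

  private
    2L<2[L+1] : ∀ L → 2 ℕ.* L < suc L ℕ.+ suc L
    2L<2[L+1] L = ≡.subst (_< suc L ℕ.+ suc L) (≡.cong (L ℕ.+_) (≡.sym (ℕₚ.+-identityʳ L))) (ℕₚ.+-mono-< (ℕₚ.n<1+n L) (ℕₚ.n<1+n L))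

    L-a≤L+a : ∀ L {a} → + 0 ℤ.≤ a → L ℤ.- a ℤ.≤ L ℤ.+ a
    L-a≤L+a L 0≤a = ℤₚ.+-monoʳ-≤ L (ℤₚ.≤-trans (ℤₚ.neg-mono-≤ 0≤a) 0≤a)

    L+a≤L-a : ∀ L {a} → a ℤ.≤ + 0 → L ℤ.+ a ℤ.≤ L ℤ.- a
    L+a≤L-a L a≤0 = ℤₚ.+-monoʳ-≤ L (ℤₚ.≤-trans a≤0 (ℤₚ.neg-mono-≤ a≤0))

    double : ∀ L a → (+ L ℤ.+ a) ℤ.+ (+ L ℤ.- a) ≡ + (2 ℕ.* L)
    double L a = ≡.trans (ar (+ L) a) (≡.cong (λ k → + (L ℕ.+ k)) (≡.sym (ℕₚ.+-identityʳ L)))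
      where
      ar : ∀ L a → (L ℤ.+ a) ℤ.+ (L ℤ.- a) ≡ L ℤ.+ L
      ar = solveℤ

  -- After both binomials of 𝓑(i, L - i, a, b) are complemented, the sum over i is the q-Saalschütz
  -- sum with X = L + b, Y = L - b, B = a and P = 2L. As Y ≤ X means b ≥ 0, equal signs of a and b
  -- give the ordering condition of `saalschütz-integer`.
  burge₁ : ∀ L M a b → SameSign a b →
    ∑ (suc L) (λ i → q^ (i ℕ.* i) * (binomℤ (+ (2 ℕ.* L ℕ.+ M) ℤ.- + i) (+ (2 ℕ.* L)) * 𝓑 i (L ∸ i) a b))
      ≈ q^ (sq a) * 𝓑 L M (a ℤ.+ b) a
  burge₁ L M a b same = begin
    ∑ (suc L) (λ i → q^ (i ℕ.* i) * (binomℤ (+ (2 ℕ.* L ℕ.+ M) ℤ.- + i) (+ (2 ℕ.* L)) * 𝓑 i (L ∸ i) a b))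
      ≈⟨ ∑-cong (suc L) (λ { i (s≤s i≤L) → *-congˡ (*-congˡ (step i i≤L)) }) ⟩
    ∑ (suc L) (saalschütz-term (2 ℕ.* L) M (+ L ℤ.+ b) (+ L ℤ.- b) a)
      ≈⟨ saalschütz-integer (+ L ℤ.+ b) (+ L ℤ.- b) a (2 ℕ.* L) M L (double L b) (2L<2[L+1] L) (order same) ⟩
    q^ (sq a) * (binomℤ (+ L ℤ.+ b ℤ.+ + M) (+ L ℤ.+ b ℤ.+ a) * binomℤ (+ L ℤ.- b ℤ.+ + M) (+ L ℤ.- b ℤ.- a))
      ≈⟨ *-congˡ (*-cong (binomℤ-cong (ar₁ (+ L) (+ M) a b) (ar₂ (+ L) a b)) (binomℤ-cong (ar₃ (+ L) (+ M) a b) (ar₄ (+ L) a b))) ⟩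
    q^ (sq a) * 𝓑 L M (a ℤ.+ b) a ∎
    where
    order : SameSign a b → (+ 0 ℤ.≤ a × + L ℤ.- b ℤ.≤ + L ℤ.+ b) ⊎ (a ℤ.≤ + 0 × + L ℤ.+ b ℤ.≤ + L ℤ.- b)
    order (inj₁ (0≤a , 0≤b)) = inj₁ (0≤a , L-a≤L+a (+ L) 0≤b)
    order (inj₂ (a≤0 , b≤0)) = inj₂ (a≤0 , L+a≤L-a (+ L) b≤0)
    ar₁ : ∀ L M a b → L ℤ.+ b ℤ.+ M ≡ L ℤ.+ M ℤ.+ (a ℤ.+ b) ℤ.- a
    ar₁ = solveℤ
    ar₂ : ∀ L a b → L ℤ.+ b ℤ.+ a ≡ L ℤ.+ (a ℤ.+ b)
    ar₂ = solveℤ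
    ar₃ : ∀ L M a b → L ℤ.- b ℤ.+ M ≡ L ℤ.+ M ℤ.- (a ℤ.+ b) ℤ.+ a
    ar₃ = solveℤ
    ar₄ : ∀ L a b → L ℤ.- b ℤ.- a ≡ L ℤ.- (a ℤ.+ b)
    ar₄ = solveℤ
    ar₅ : ∀ L i a b → i ℤ.+ (L ℤ.- i) ℤ.+ a ℤ.- b ≡ L ℤ.- b ℤ.+ a
    ar₅ = solveℤ
    ar₆ : ∀ L i a b → i ℤ.+ (L ℤ.- i) ℤ.+ a ℤ.- b ℤ.- (i ℤ.+ a) ≡ L ℤ.- b ℤ.- i
    ar₆ = solveℤ
    ar₇ : ∀ L i a b → i ℤ.+ (L ℤ.- i) ℤ.- a ℤ.+ b ≡ L ℤ.+ b ℤ.- a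
    ar₇ = solveℤ
    ar₈ : ∀ L i a b → i ℤ.+ (L ℤ.- i) ℤ.- a ℤ.+ b ℤ.- (i ℤ.- a) ≡ L ℤ.+ b ℤ.- i
    ar₈ = solveℤ
    step : ∀ i → i ≤ L → 𝓑 i (L ∸ i) a b ≈
      binomℤ (+ L ℤ.+ b ℤ.- a) (+ L ℤ.+ b ℤ.- + i) * binomℤ (+ L ℤ.- b ℤ.+ a) (+ L ℤ.- b ℤ.- + i)
    step i i≤L = trans (*-comm _ _) (*-cong
      (trans (binomℤ-sym _ _) (binomℤ-cong
        (≡.trans (≡.cong (λ t → + i ℤ.+ t ℤ.- a ℤ.+ b) (+∸ i≤L)) (ar₇ (+ L) (+ i) a b))
        (≡.trans (≡.cong (λ t → + i ℤ.+ t ℤ.- a ℤ.+ b ℤ.- (+ i ℤ.- a)) (+∸ i≤L)) (ar₈ (+ L) (+ i) a b))))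
      (trans (binomℤ-sym _ _) (binomℤ-cong
        (≡.trans (≡.cong (λ t → + i ℤ.+ t ℤ.+ a ℤ.- b) (+∸ i≤L)) (ar₅ (+ L) (+ i) a b))
        (≡.trans (≡.cong (λ t → + i ℤ.+ t ℤ.+ a ℤ.- b ℤ.- (+ i ℤ.+ a)) (+∸ i≤L)) (ar₆ (+ L) (+ i) a b)))))

  -- Follows from `burge₁` by the symmetry 𝓑(L - i, i, a, b) = 𝓑(i, L - i, b, a), which is again the
  -- complementing of both binomials.
  burge₂ : ∀ L M a b → SameSign a b →
    ∑ (suc L) (λ i → q^ ((L ∸ i) ℕ.* (L ∸ i)) * (binomℤ (+ (L ℕ.+ M ℕ.+ i)) (+ (2 ℕ.* L)) * 𝓑 i (L ∸ i) a b))
      ≈ q^ (sq b) * 𝓑 L M (a ℤ.+ b) b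
  burge₂ L M a b same = begin
    ∑ (suc L) F
      ≈⟨ ∑-reverse L F ⟩
    ∑ (suc L) (λ i → F (L ∸ i))
      ≈⟨ ∑-cong (suc L) {λ i → F (L ∸ i)} (λ { i (s≤s i≤L) → step i i≤L }) ⟩
    ∑ (suc L) (λ i → q^ (i ℕ.* i) * (binomℤ (+ (2 ℕ.* L ℕ.+ M) ℤ.- + i) (+ (2 ℕ.* L)) * 𝓑 i (L ∸ i) b a))
      ≈⟨ burge₁ L M b a (swap same) ⟩
    q^ (sq b) * 𝓑 L M (b ℤ.+ a) b
      ≡⟨ ≡.cong (λ t → q^ (sq b) * 𝓑 L M t b) (ℤₚ.+-comm b a) ⟩
    q^ (sq b) * 𝓑 L M (a ℤ.+ b) b ∎
    where
    F : ℕ → Carrier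
    F i = q^ ((L ∸ i) ℕ.* (L ∸ i)) * (binomℤ (+ (L ℕ.+ M ℕ.+ i)) (+ (2 ℕ.* L)) * 𝓑 i (L ∸ i) a b)
    swap : SameSign a b → SameSign b a
    swap (inj₁ (x , y)) = inj₁ (y , x)
    swap (inj₂ (x , y)) = inj₂ (y , x)
    ar₁ : ∀ L i a b → L ℤ.- i ℤ.+ i ℤ.+ a ℤ.- b ≡ i ℤ.+ (L ℤ.- i) ℤ.- b ℤ.+ a
    ar₁ = solveℤ
    ar₂ : ∀ L i a b → L ℤ.- i ℤ.+ i ℤ.+ a ℤ.- b ℤ.- (L ℤ.- i ℤ.+ a) ≡ i ℤ.- b
    ar₂ = solveℤ
    ar₃ : ∀ L i a b → L ℤ.- i ℤ.+ i ℤ.- a ℤ.+ b ≡ i ℤ.+ (L ℤ.- i) ℤ.+ b ℤ.- a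
    ar₃ = solveℤ
    ar₄ : ∀ L i a b → L ℤ.- i ℤ.+ i ℤ.- a ℤ.+ b ℤ.- (L ℤ.- i ℤ.- a) ≡ i ℤ.+ b
    ar₄ = solveℤ
    ar₅ : ∀ L M i → L ℤ.+ M ℤ.+ (L ℤ.- i) ≡ L ℤ.+ L ℤ.+ M ℤ.- i
    ar₅ = solveℤ
    step : ∀ i → i ≤ L → F (L ∸ i) ≈
      q^ (i ℕ.* i) * (binomℤ (+ (2 ℕ.* L ℕ.+ M) ℤ.- + i) (+ (2 ℕ.* L)) * 𝓑 i (L ∸ i) b a)
    step i i≤L = *-cong (qpow-cong (≡.cong (λ k → k ℕ.* k) (ℕₚ.m∸[m∸n]≡n i≤L))) (*-cong
      (binomℤ-cong (≡.trans (≡.cong (λ t → + L ℤ.+ + M ℤ.+ t) (+∸ i≤L)) (≡.trans (ar₅ (+ L) (+ M) (+ i))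
        (≡.cong (λ k → + (L ℕ.+ k ℕ.+ M) ℤ.- + i) (≡.sym (ℕₚ.+-identityʳ L))))) ≡.refl)
      (trans (reflexive (≡.cong (λ k → 𝓑 (L ∸ i) k a b) (ℕₚ.m∸[m∸n]≡n i≤L))) (trans (*-comm _ _) (*-cong
        (trans (binomℤ-sym _ _) (binomℤ-cong
          (≡.trans (≡.cong (λ t → t ℤ.+ + i ℤ.- a ℤ.+ b) (+∸ i≤L)) (≡.trans (ar₃ (+ L) (+ i) a b) (≡.cong (λ t → + i ℤ.+ t ℤ.+ b ℤ.- a) (≡.sym (+∸ i≤L)))))
          (≡.trans (≡.cong (λ t → t ℤ.+ + i ℤ.- a ℤ.+ b ℤ.- (t ℤ.- a)) (+∸ i≤L)) (ar₄ (+ L) (+ i) a b))))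
        (trans (binomℤ-sym _ _) (binomℤ-cong
          (≡.trans (≡.cong (λ t → t ℤ.+ + i ℤ.+ a ℤ.- b) (+∸ i≤L)) (≡.trans (ar₁ (+ L) (+ i) a b) (≡.cong (λ t → + i ℤ.+ t ℤ.- b ℤ.+ a) (≡.sym (+∸ i≤L)))))
          (≡.trans (≡.cong (λ t → t ℤ.+ + i ℤ.+ a ℤ.- b ℤ.- (t ℤ.+ a)) (+∸ i≤L)) (ar₂ (+ L) (+ i) a b))))))))

  -- The sum stops below L because [L - 1; i] vanishes for i ≥ L; for L = 0 it is empty.
  H₂₁ : ℕ → ℕ → Carrier
  H₂₁ L M = ∑ L (λ i → q^ (i ℕ.* i) *
    (binomℤ (+ (2 ℕ.* L ℕ.+ M) ℤ.- + i ℤ.- + 1) (+ (2 ℕ.* L) ℤ.- + 1) * binomℤ (+ L ℤ.- + 1) (+ i)))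

  -- One half of the q-Pascal expansion of `seedPair`, and at the same time the product that the
  -- q-Saalschütz sum makes out of `H₂₁`.
  halfPair : ℕ → ℕ → ℤ → Carrier
  halfPair L M j =
    binomℤ (+ L ℤ.+ + M ℤ.+ j) (+ L ℤ.+ (j ℤ.+ j)) * binomℤ (+ L ℤ.+ + M ℤ.- + 1 ℤ.- j) (+ L ℤ.- + 1 ℤ.- (j ℤ.+ j))

  -- Inserting W-binom for the last factor of H₂₁ leaves an instance of the q-Saalschütz sum
  -- whose two upper parameters X = L + j and Y = L - 1 - j have odd sum.
  H₂₁-halfPair : ∀ N L M → L ≤ N → H₂₁ L M ≈ ∑ℤ N (term seedExponent (halfPair L M))
  -- For L = 0 the left side is an empty sum, and on the right the lower entries 2j and -1 - 2j add
  -- up to -1.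
  H₂₁-halfPair N zero M L≤N = trans (∑-0 _) (sym (∑ℤ-zero N (term seedExponent (halfPair 0 M))
    λ j → term-zero seedExponent (halfPair 0 M) j (pair-neg _ _ (≡.subst (ℤ._< + 0) (≡.sym (ar j)) ℤ.-<+))))
    where
    ar : ∀ j → + 0 ℤ.+ (j ℤ.+ j) ℤ.+ (+ 0 ℤ.- + 1 ℤ.- (j ℤ.+ j)) ≡ ℤ.- (+ 1)
    ar = solveℤ
  H₂₁-halfPair N L@(suc l) M L≤N = begin
    ∑ L (λ i → q^ (i ℕ.* i) * (binomℤ (+ (2 ℕ.* L ℕ.+ M) ℤ.- + i ℤ.- + 1) (+ (2 ℕ.* L) ℤ.- + 1) * binomℤ (+ L ℤ.- + 1) (+ i)))
      ≈⟨ ∑-cong L (λ i _ → insert i) ⟩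
    ∑ L (λ i → ∑ℤ N (λ j → F i j))
      ≈⟨ ∑-∑ℤ-comm L N F ⟩
    ∑ℤ N (λ j → ∑ L (λ i → F i j))
      ≈⟨ ∑ℤ-cong N {λ j → ∑ L (λ i → F i j)} {term seedExponent (halfPair L M)} sum-i ⟩
    ∑ℤ N (term seedExponent (halfPair L M)) ∎
    where
    P = L ℕ.+ l
    top : ℕ → Carrier
    top i = binomℤ (+ P ℤ.+ + M ℤ.- + i) (+ P)
    F : ℕ → ℤ → Carrier
    F i j = q^ (i ℕ.* i) * (top i * term pentℤ (oddPair l (+ L ℤ.- + i)) j)
    br₁ : ∀ l i → l ℤ.- i ≡ + 1 ℤ.+ l ℤ.- i ℤ.- + 1
    br₁ = solveℤ
    br₂ : ∀ l M i → + 1 ℤ.+ l ℤ.+ (+ 1 ℤ.+ l) ℤ.+ M ℤ.- i ℤ.- + 1 ≡ + 1 ℤ.+ l ℤ.+ l ℤ.+ M ℤ.- i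
    br₂ = solveℤ
    br₃ : ∀ l → + 1 ℤ.+ l ℤ.+ (+ 1 ℤ.+ l) ℤ.- + 1 ≡ + 1 ℤ.+ l ℤ.+ l
    br₃ = solveℤ
    twice : 2 ℕ.* L ≡ L ℕ.+ L
    twice = ≡.cong (L ℕ.+_) (ℕₚ.+-identityʳ L)
    insert : ∀ i → q^ (i ℕ.* i) * (binomℤ (+ (2 ℕ.* L ℕ.+ M) ℤ.- + i ℤ.- + 1) (+ (2 ℕ.* L) ℤ.- + 1) * binomℤ (+ L ℤ.- + 1) (+ i))
                   ≈ ∑ℤ N (λ j → F i j)
    insert i = begin
      q^ (i ℕ.* i) * (binomℤ (+ (2 ℕ.* L ℕ.+ M) ℤ.- + i ℤ.- + 1) (+ (2 ℕ.* L) ℤ.- + 1) * binomℤ (+ l) (+ i))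
        ≈⟨ *-congˡ (*-cong
             (binomℤ-cong (≡.trans (≡.cong (λ k → + (k ℕ.+ M) ℤ.- + i ℤ.- + 1) twice) (br₂ (+ l) (+ M) (+ i)))
                          (≡.trans (≡.cong (λ k → + k ℤ.- + 1) twice) (br₃ (+ l))))
             (trans (binomℤ-sym (+ l) (+ i)) (binomℤ-cong {+ l} ≡.refl (br₁ (+ l) (+ i))))) ⟩
      q^ (i ℕ.* i) * (top i * binomℤ (+ l) (+ L ℤ.- + i ℤ.- + 1))
        ≈⟨ *-congˡ (*-congˡ (W-binom N l (+ L ℤ.- + i) (ℕₚ.≤-trans (ℕₚ.n≤1+n l) L≤N))) ⟨
      q^ (i ℕ.* i) * (top i * W N l (+ L ℤ.- + i))
        ≈⟨ *-congˡ (*-distribˡ-∑ℤ N (top i) (term pentℤ (oddPair l (+ L ℤ.- + i)))) ⟩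
      q^ (i ℕ.* i) * ∑ℤ N (λ j → top i * term pentℤ (oddPair l (+ L ℤ.- + i)) j)
        ≈⟨ *-distribˡ-∑ℤ N (q^ (i ℕ.* i)) (λ j → top i * term pentℤ (oddPair l (+ L ℤ.- + i)) j) ⟩
      ∑ℤ N (λ j → F i j) ∎
    X Y : ℤ → ℤ
    X j = + L ℤ.+ j
    Y j = + l ℤ.- j
    ar₁ : ∀ l j → + 1 ℤ.+ l ≡ + 1 ℤ.+ l ℤ.+ j ℤ.- j
    ar₁ = solveℤ
    ar₂ : ∀ L j i → L ℤ.- i ℤ.+ j ≡ L ℤ.+ j ℤ.- i
    ar₂ = solveℤ
    ar₃ : ∀ l j → l ≡ l ℤ.- j ℤ.+ j
    ar₃ = solveℤ
    ar₄ : ∀ l j i → + 1 ℤ.+ l ℤ.- i ℤ.- + 1 ℤ.- j ≡ l ℤ.- j ℤ.- i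
    ar₄ = solveℤ
    ar₅ : ∀ L l j → L ℤ.+ j ℤ.+ (l ℤ.- j) ≡ L ℤ.+ l
    ar₅ = solveℤ
    ar₆ : ∀ L M j → L ℤ.+ j ℤ.+ M ≡ L ℤ.+ M ℤ.+ j
    ar₆ = solveℤ
    ar₇ : ∀ L j → L ℤ.+ j ℤ.+ j ≡ L ℤ.+ (j ℤ.+ j)
    ar₇ = solveℤ
    ar₈ : ∀ l M j → l ℤ.- j ℤ.+ M ≡ + 1 ℤ.+ l ℤ.+ M ℤ.- + 1 ℤ.- j
    ar₈ = solveℤ
    ar₉ : ∀ l j → l ℤ.- j ℤ.- j ≡ + 1 ℤ.+ l ℤ.- + 1 ℤ.- (j ℤ.+ j)
    ar₉ = solveℤ
    ar₁₀ : ∀ l m → l ℤ.- ℤ.- (+ 1 ℤ.+ m) ≡ + 1 ℤ.+ l ℤ.+ m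
    ar₁₀ = solveℤ
    ar₁₁ : ∀ l m → + 1 ℤ.+ l ℤ.+ ℤ.- (+ 1 ℤ.+ m) ≡ l ℤ.- m
    ar₁₁ = solveℤ
    -- Y j ≤ X j means 2j + 1 ≥ 0, that is j ≥ 0, so the ordering condition holds with B = j for
    -- either sign.
    order : ∀ j → (+ 0 ℤ.≤ j × Y j ℤ.≤ X j) ⊎ (j ℤ.≤ + 0 × X j ℤ.≤ Y j)
    order (+ m)    = inj₁ (ℤ.+≤+ z≤n , ℤₚ.≤-trans (ℤₚ.i-j≤i (+ l) (+ m)) (ℤ.+≤+ (ℕₚ.≤-trans (ℕₚ.n≤1+n l) (ℕₚ.m≤m+n L m))))
    order -[1+ m ] = inj₂ (ℤ.-≤+ , ≡.subst₂ ℤ._≤_ (≡.sym (ar₁₁ (+ l) (+ m))) (≡.sym (ar₁₀ (+ l) (+ m)))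
      (ℤₚ.≤-trans (ℤₚ.i-j≤i (+ l) (+ m)) (ℤ.+≤+ (ℕₚ.≤-trans (ℕₚ.n≤1+n l) (ℕₚ.m≤m+n L m)))))
    sum-i : ∀ j → ∑ L (λ i → F i j) ≈ term seedExponent (halfPair L M) j
    sum-i j = begin
      ∑ L (λ i → F i j)
        ≈⟨ ∑-cong L (λ i _ → trans
             (solve 6 (λ e t s p x y → e :* (t :* (s :* (p :* (x :* y)))) := s :* p :* (e :* (t :* (x :* y)))) refl _ _ _ _ _ _)
             (*-congˡ (*-congˡ (*-congˡ (*-cong (binomℤ-cong (ar₁ (+ l) j) (ar₂ (+ L) j (+ i)))
                                                (binomℤ-cong (ar₃ (+ l) j) (ar₄ (+ l) j (+ i)))))))) ⟩
      ∑ L (λ i → sign j * q^ pentℤ j * saalschütz-term P M (X j) (Y j) j i)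
        ≈⟨ *-distribˡ-∑ L (sign j * q^ pentℤ j) (saalschütz-term P M (X j) (Y j) j) ⟨
      sign j * q^ pentℤ j * ∑ L (saalschütz-term P M (X j) (Y j) j)
        ≈⟨ *-congˡ (saalschütz-integer (X j) (Y j) j P M l (ar₅ (+ L) (+ l) j) (ℕₚ.+-monoʳ-< L (ℕₚ.n<1+n l)) (order j)) ⟩
      sign j * q^ pentℤ j * (q^ (sq j) * (binomℤ (X j ℤ.+ + M) (X j ℤ.+ j) * binomℤ (Y j ℤ.+ + M) (Y j ℤ.- j)))
        ≈⟨ solve 4 (λ s p e b → s :* p :* (e :* b) := s :* (p :* e :* b)) refl _ _ _ _ ⟩
      sign j * (q^ pentℤ j * q^ (sq j) * (binomℤ (X j ℤ.+ + M) (X j ℤ.+ j) * binomℤ (Y j ℤ.+ + M) (Y j ℤ.- j)))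
        ≈⟨ *-congˡ (*-cong (qpow-* ≡.refl) (*-cong
             (binomℤ-cong (ar₆ (+ L) (+ M) j) (ar₇ (+ L) j)) (binomℤ-cong (ar₈ (+ l) (+ M) j) (ar₉ (+ l) j)))) ⟩
      term seedExponent (halfPair L M) j ∎

  seedPair : ℕ → ℕ → ℤ → Carrier
  seedPair L M j = 𝓑 L M (+ 2 ℤ.* j ℤ.+ + 1) (+ 1 ℤ.* j ℤ.+ + 0)

  -- q-Pascal on the first factor of seedPair; the second summand is antisymmetric under j ↦ -1-j.
  seed-halfPair : ∀ N L M → L ≤ N →
    ∑ℤ N (term seedExponent (seedPair L M)) ≈ ∑ℤ N (term seedExponent (halfPair L M))
  seed-halfPair N L M L≤N = begin
    ∑ℤ N (term seedExponent (seedPair L M))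
      ≈⟨ ∑ℤ-cong N {term seedExponent (seedPair L M)} {λ j → term seedExponent (halfPair L M) j + term e′ f j} step ⟩
    ∑ℤ N (λ j → term seedExponent (halfPair L M) j + term e′ f j)
      ≈⟨ ∑ℤ-distrib-+ N (term seedExponent (halfPair L M)) (term e′ f) ⟩
    ∑ℤ N (term seedExponent (halfPair L M)) + ∑ℤ N (term e′ f)
      ≈⟨ +-congˡ (∑ℤ-antisym N (term e′ f) (term-antisym e′ f (λ _ → ≡.refl) reflect) far) ⟩
    ∑ℤ N (term seedExponent (halfPair L M)) + 0#
      ≈⟨ +-identityʳ _ ⟩
    ∑ℤ N (term seedExponent (halfPair L M)) ∎
    where
    -- Five triangular numbers plus L + 1, again invariant under j ↦ -1-j by definition.
    e′ : ℤ → ℕ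
    e′ j = triℤ j ℕ.+ (triℤ j ℕ.+ triℤ j) ℕ.+ (triℤ j ℕ.+ triℤ j) ℕ.+ suc L
    k₁ k₂ : ℤ → ℤ
    k₁ j = + L ℤ.+ (j ℤ.+ j) ℤ.+ + 1
    k₂ j = + L ℤ.- + 1 ℤ.- (j ℤ.+ j)
    n₁ n₂ : ℤ → ℤ
    n₁ j = + L ℤ.+ + M ℤ.+ j
    n₂ j = + L ℤ.+ + M ℤ.- + 1 ℤ.- j
    f : ℤ → Carrier
    f j = binomℤ (n₁ j) (k₁ j) * binomℤ (n₂ j) (k₂ j)
    cr₁ : ∀ L M m → L ℤ.+ M ℤ.+ ℤ.- (+ 1 ℤ.+ m) ≡ L ℤ.+ M ℤ.- + 1 ℤ.- m
    cr₁ = solveℤ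
    cr₂ : ∀ L m → L ℤ.+ (ℤ.- (+ 1 ℤ.+ m) ℤ.+ ℤ.- (+ 1 ℤ.+ m)) ℤ.+ + 1 ≡ L ℤ.- + 1 ℤ.- (m ℤ.+ m)
    cr₂ = solveℤ
    cr₃ : ∀ L M m → L ℤ.+ M ℤ.- + 1 ℤ.- ℤ.- (+ 1 ℤ.+ m) ≡ L ℤ.+ M ℤ.+ m
    cr₃ = solveℤ
    cr₄ : ∀ L m → L ℤ.- + 1 ℤ.- (ℤ.- (+ 1 ℤ.+ m) ℤ.+ ℤ.- (+ 1 ℤ.+ m)) ≡ L ℤ.+ (m ℤ.+ m) ℤ.+ + 1
    cr₄ = solveℤ
    reflect : ∀ m → f -[1+ m ] ≈ f (+ m)
    reflect m = trans (*-cong (binomℤ-cong (cr₁ (+ L) (+ M) (+ m)) (cr₂ (+ L) (+ m)))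
                              (binomℤ-cong (cr₃ (+ L) (+ M) (+ m)) (cr₄ (+ L) (+ m)))) (*-comm _ _)
    cr₅ : ∀ L N′ → L ℤ.- + 1 ℤ.- ((L ℤ.+ N′) ℤ.+ (L ℤ.+ N′)) ≡ ℤ.- (+ 1 ℤ.+ (L ℤ.+ N′ ℤ.+ N′))
    cr₅ = solveℤ
    -- At j = N ≥ L the lower entry L - 1 - 2N is negative, so the unpaired end of the telescoping
    -- sum vanishes.
    far-k₂ : k₂ (+ N) ℤ.< + 0
    far-k₂ with ℕₚ.m≤n⇒∃[o]m+o≡n L≤N
    ... | N′ , ≡.refl = ≡.subst (ℤ._< + 0) (≡.sym (cr₅ (+ L) (+ N′))) ℤ.-<+
    far : term e′ f (+ N) ≈ 0#
    far = term-zero e′ f (+ N) (zero-*ʳ (binomℤ-k<0 _ far-k₂))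
    dr₁ : ∀ j t L → j ℤ.* j ℤ.+ t ℤ.+ j ℤ.* j ℤ.+ (L ℤ.+ (j ℤ.+ j) ℤ.+ + 1)
                    ≡ t ℤ.+ (j ℤ.* j ℤ.+ j) ℤ.+ (j ℤ.* j ℤ.+ j) ℤ.+ (+ 1 ℤ.+ L)
    dr₁ = solveℤ
    exponent : ∀ j → + seedExponent j ℤ.+ k₁ j ≡ + e′ j
    exponent j = ≡.trans (≡.cong (λ s → s ℤ.+ + triℤ j ℤ.+ s ℤ.+ k₁ j) (+sq j))
      (≡.trans (dr₁ j (+ triℤ j) (+ L)) (≡.cong (λ s → + triℤ j ℤ.+ s ℤ.+ s ℤ.+ + suc L) (≡.sym (triℤ-double j))))
    er₁ : ∀ L M j → L ℤ.+ M ℤ.+ (+ 2 ℤ.* j ℤ.+ + 1) ℤ.- (+ 1 ℤ.* j ℤ.+ + 0) ≡ + 1 ℤ.+ (L ℤ.+ M ℤ.+ j)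
    er₁ = solveℤ
    er₂ : ∀ L j → L ℤ.+ (+ 2 ℤ.* j ℤ.+ + 1) ≡ L ℤ.+ (j ℤ.+ j) ℤ.+ + 1
    er₂ = solveℤ
    er₃ : ∀ L M j → L ℤ.+ M ℤ.- (+ 2 ℤ.* j ℤ.+ + 1) ℤ.+ (+ 1 ℤ.* j ℤ.+ + 0) ≡ L ℤ.+ M ℤ.- + 1 ℤ.- j
    er₃ = solveℤ
    er₄ : ∀ L j → L ℤ.- (+ 2 ℤ.* j ℤ.+ + 1) ≡ L ℤ.- + 1 ℤ.- (j ℤ.+ j)
    er₄ = solveℤ
    er₅ : ∀ k → k ℤ.+ + 1 ℤ.- + 1 ≡ k
    er₅ = solveℤ
    -- q-Pascal fails for the upper entry 0, but then the lower entries k₁ j are negative.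
    k₁-neg : ∀ j u → n₁ j ≡ -[1+ u ] → k₁ j ℤ.< + 0
    k₁-neg (+ m)    u ()
    k₁-neg -[1+ m ] u n≡ = ≡.subst (ℤ._< + 0) (≡.sym (kr (+ L) (+ m)))
      (ℤₚ.≤-<-trans (ℤₚ.≤-trans (ℤₚ.i-j≤i (+ L ℤ.+ -[1+ m ]) (+ m))
        (ℤₚ.+-monoˡ-≤ -[1+ m ] (ℤₚ.i≤i+j (+ L) (+ M)))) (≡.subst (ℤ._< + 0) (≡.sym n≡) ℤ.-<+))
      where
      kr : ∀ L m → L ℤ.+ (ℤ.- (+ 1 ℤ.+ m) ℤ.+ ℤ.- (+ 1 ℤ.+ m)) ℤ.+ + 1 ≡ L ℤ.+ ℤ.- (+ 1 ℤ.+ m) ℤ.- m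
      kr = solveℤ
    pascal : ∀ j n → n₁ j ≡ n → q^ seedExponent j * binomℤ (+ 1 ℤ.+ n) (k₁ j)
      ≈ q^ seedExponent j * binomℤ n (+ L ℤ.+ (j ℤ.+ j)) + q^ e′ j * binomℤ n (k₁ j)
    pascal j (+ n) _ = trans (binomℤ-pascal n (k₁ j) (seedExponent j) (e′ j) (exponent j))
      (+-congʳ (*-congˡ (binomℤ-cong ≡.refl (er₅ (+ L ℤ.+ (j ℤ.+ j))))))
    pascal j -[1+ u ] n≡ = trans (zero-*ʳ (binomℤ-k<0 _ (k₁-neg j u n≡)))
      (sym (trans (+-cong (zero-*ʳ (binomℤ-negˡ u _)) (zero-*ʳ (binomℤ-negˡ u _))) (+-identityˡ 0#)))
    step : ∀ j → term seedExponent (seedPair L M) j ≈ term seedExponent (halfPair L M) j + term e′ f j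
    step j = begin
      term seedExponent (seedPair L M) j
        ≈⟨ term-cong seedExponent {seedPair L M} {λ j → binomℤ (+ 1 ℤ.+ n₁ j) (k₁ j) * binomℤ (n₂ j) (k₂ j)} j
             (*-cong (binomℤ-cong (er₁ (+ L) (+ M) j) (er₂ (+ L) j)) (binomℤ-cong (er₃ (+ L) (+ M) j) (er₄ (+ L) j))) ⟩
      sign j * (q^ seedExponent j * (binomℤ (+ 1 ℤ.+ n₁ j) (k₁ j) * b))
        ≈⟨ *-congˡ (*-assoc _ _ _) ⟨
      sign j * (q^ seedExponent j * binomℤ (+ 1 ℤ.+ n₁ j) (k₁ j) * b)
        ≈⟨ *-congˡ (*-congʳ (pascal j (n₁ j) ≡.refl)) ⟩
      sign j * ((q^ seedExponent j * binomℤ (n₁ j) (+ L ℤ.+ (j ℤ.+ j)) + q^ e′ j * binomℤ (n₁ j) (k₁ j)) * b)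
        ≈⟨ solve 6 (λ s p x e y b → s :* ((p :* x :+ e :* y) :* b) := s :* (p :* (x :* b)) :+ s :* (e :* (y :* b))) refl _ _ _ _ _ _ ⟩
      term seedExponent (halfPair L M) j + term e′ f j ∎
      where b = binomℤ (n₂ j) (k₂ j)

  seed-identity : ∀ N L M → L ≤ N → ∑ℤ N (term seedExponent (seedPair L M)) ≈ H₂₁ L M
  seed-identity N L M L≤N = trans (seed-halfPair N L M L≤N) (sym (H₂₁-halfPair N L M L≤N))

-- The lists obtained from [2] by increasing the first entry or by prefixing 1: these are
-- the continued fractions with positive entries whose last entry is at least 2.
data CF : List ℕ → Set where
  two  : CF (2 ∷ [])
  stay : ∀ {a as} → CF (suc a ∷ as) → CF (suc (suc a) ∷ as)
  drop : ∀ {a as} → CF (suc a ∷ as) → CF (1 ∷ suc a ∷ as)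

-- The parameters along the continued fraction

record Params : Set where
  constructor params
  field
    a b ā b̄ : ℕ
    E       : ℤ → ℕ

  line₁ line₂ : ℤ → ℤ
  line₁ j = + a ℤ.* j ℤ.+ + ā
  line₂ j = + b ℤ.* j ℤ.+ + b̄

seed : Params
seed = params 2 1 1 0 seedExponent

-- Prefixing 1 to the continued fraction of a/b and increasing its first entry. The added square is
-- the power of q contributed by the Burge transform.
step₁ step₂ : Params → Params
step₁ P = params (a ℕ.+ b) a (ā ℕ.+ b̄) ā (λ j → E j ℕ.+ sq (line₁ j))
  where open Params P
step₂ P = params (a ℕ.+ b) b (ā ℕ.+ b̄) b̄ (λ j → E j ℕ.+ sq (line₂ j))
  where open Params P

-- Here a/b is the value of the list itself. The pair of the theorem, for which the list expands a/b
-- - 1 or its inverse, lies one further step away.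
paramsOf : ∀ {as} → CF as → Params
paramsOf two      = seed
paramsOf (stay c) = step₂ (paramsOf c)
paramsOf (drop c) = step₁ (paramsOf c)

Bounded : Params → Set
Bounded P = ā ≤ a × b̄ ≤ b
  where open Params P

bounded : ∀ {as} (c : CF as) → Bounded (paramsOf c)
bounded two      = s≤s z≤n , z≤n
bounded (stay c) = let x , y = bounded c in ℕₚ.+-mono-≤ x y , y
bounded (drop c) = let x , y = bounded c in ℕₚ.+-mono-≤ x y , x

-- m C m + A_m without m_1², as a sum of squares: one square for each row that splits off, and
-- (m_{d-1} - m_d - 1)² at the end.
tailExponent : ∀ {as} → CF as → List ℕ → ℕ
tailExponent two      m = sq (+ mAt m 1 ℤ.- + mAt m 2 ℤ.- + 1)
tailExponent (stay c) m = sq (+ mAt m 1 ℤ.- + mAt m 2) ℕ.+ tailExponent c (List.drop 1 m)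
tailExponent (drop c) m = mAt m 2 ℕ.* mAt m 2 ℕ.+ tailExponent c (List.drop 1 m)

-- The induction along the continued fraction

module Induction {c ℓ} (R : CommutativeRing c ℓ) (Qp : QuantumParameter R) where
  open CommutativeRing R hiding (zero)
  open SemiringSolver commutativeSemiring using (solve; _:+_; _:*_; _:=_)
  open SetoidReasoning setoid
  open QBinomial R Qp
  open IntegerBinomial R Qp
  open IntegerSums R Qp
  open SeedIdentity R Qp
  open BurgeTransform R Qp

  pair : Params → ℕ → ℕ → ℤ → Carrier
  pair P L M j = 𝓑 L M (Params.line₁ P j) (Params.line₂ P j)

  lhs : Params → ℕ → ℕ → ℕ → Carrier
  lhs P N L M = ∑ℤ N (term (Params.E P) (pair P L M))

  transform₁ transform₂ : (ℕ → ℕ → Carrier) → ℕ → ℕ → Carrier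
  transform₁ K L M = ∑ (suc L) (λ i → q^ (i ℕ.* i) *
    (binomℤ (+ (2 ℕ.* L ℕ.+ M) ℤ.- + i) (+ (2 ℕ.* L)) * K i (L ∸ i)))
  transform₂ K L M = ∑ (suc L) (λ i → q^ ((L ∸ i) ℕ.* (L ∸ i)) *
    (binomℤ (+ (L ℕ.+ M ℕ.+ i)) (+ (2 ℕ.* L)) * K i (L ∸ i)))

  private
    line-neg : ∀ a ā m → ā ≤ a → + a ℤ.* -[1+ m ] ℤ.+ + ā ℤ.≤ + 0
    line-neg a ā m ā≤a with ℕₚ.m≤n⇒∃[o]m+o≡n ā≤a
    ... | k , ≡.refl = ≡.subst (ℤ._≤ + 0) (≡.trans (≡.cong (λ t → ℤ.- (+ k ℤ.+ t)) (ℤₚ.pos-* (ā ℕ.+ k) m)) (≡.sym (ar (+ ā) (+ k) (+ m))))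
                         (ℤₚ.neg-mono-≤ (ℤ.+≤+ z≤n))
      where
      ar : ∀ ā k m → (ā ℤ.+ k) ℤ.* (ℤ.- (+ 1 ℤ.+ m)) ℤ.+ ā ≡ ℤ.- (k ℤ.+ (ā ℤ.+ k) ℤ.* m)
      ar = solveℤ

    line-pos : ∀ a ā m → + 0 ℤ.≤ + a ℤ.* + m ℤ.+ + ā
    line-pos a ā m = ≡.subst (λ t → + 0 ℤ.≤ t ℤ.+ + ā) (ℤₚ.pos-* a m) (ℤ.+≤+ z≤n)

  same-sign : ∀ P → Bounded P → ∀ j → SameSign (Params.line₁ P j) (Params.line₂ P j)
  same-sign P (x , y) (+ m)    = inj₁ (line-pos a ā m , line-pos b b̄ m)
    where open Params P
  same-sign P (x , y) -[1+ m ] = inj₂ (line-neg a ā m x , line-neg b b̄ m y)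
    where open Params P

  private
    module Step (P : Params) (N L : ℕ) (K : ℕ → ℕ → Carrier) (IH : ∀ i → i ≤ L → lhs P N i (L ∸ i) ≈ K i (L ∸ i)) where
      open Params P

      sum-line : ∀ a ā b b̄ j → (a ℤ.* j ℤ.+ ā) ℤ.+ (b ℤ.* j ℤ.+ b̄) ≡ (a ℤ.+ b) ℤ.* j ℤ.+ (ā ℤ.+ b̄)
      sum-line = solveℤ

      -- Common to both transforms: e and g are the power and the binomial of the kernel, s is the
      -- square added to the exponent. The hypothesis sums over i for each j; exchanging the sums
      -- leaves the identity for P at (i, L - i).
      expand : (e : ℕ → ℕ) (g : ℕ → Carrier) (s : ℤ → ℕ) (h : ℤ → Carrier) →
        (∀ j → ∑ (suc L) (λ i → q^ (e i) * (g i * pair P i (L ∸ i) j)) ≈ q^ (s j) * h j) →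
        ∑ℤ N (term (λ j → E j ℕ.+ s j) h) ≈ ∑ (suc L) (λ i → q^ (e i) * (g i * K i (L ∸ i)))
      expand e g s h burge = begin
        ∑ℤ N (term (λ j → E j ℕ.+ s j) h)
          ≈⟨ ∑ℤ-cong N {term (λ j → E j ℕ.+ s j) h} {λ j → ∑ (suc L) (λ i → F i j)} inner ⟩
        ∑ℤ N (λ j → ∑ (suc L) (λ i → F i j))
          ≈⟨ ∑-∑ℤ-comm (suc L) N F ⟨
        ∑ (suc L) (λ i → ∑ℤ N (F i))
          ≈⟨ ∑-cong (suc L) (λ { i (s≤s i≤L) → outer i i≤L }) ⟩
        ∑ (suc L) (λ i → q^ (e i) * (g i * K i (L ∸ i))) ∎
        where
        F : ℕ → ℤ → Carrier
        F i j = q^ (e i) * g i * term E (pair P i (L ∸ i)) j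
        inner : ∀ j → term (λ j → E j ℕ.+ s j) h j ≈ ∑ (suc L) (λ i → F i j)
        inner j = begin
          sign j * (q^ (E j ℕ.+ s j) * h j)
            ≈⟨ *-congˡ (trans (*-congʳ (q^-+ (E j) (s j))) (*-assoc _ _ _)) ⟩
          sign j * (q^ E j * (q^ (s j) * h j))
            ≈⟨ *-assoc _ _ _ ⟨
          sign j * q^ E j * (q^ (s j) * h j)
            ≈⟨ *-congˡ (burge j) ⟨
          sign j * q^ E j * ∑ (suc L) (λ i → q^ (e i) * (g i * pair P i (L ∸ i) j))
            ≈⟨ *-distribˡ-∑ (suc L) (sign j * q^ E j) (λ i → q^ (e i) * (g i * pair P i (L ∸ i) j)) ⟩
          ∑ (suc L) (λ i → sign j * q^ E j * (q^ (e i) * (g i * pair P i (L ∸ i) j)))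
            ≈⟨ ∑-cong (suc L) (λ i _ → solve 5 (λ s x e g b → s :* x :* (e :* (g :* b)) := e :* g :* (s :* (x :* b))) refl
                 (sign j) (q^ E j) (q^ (e i)) (g i) (pair P i (L ∸ i) j)) ⟩
          ∑ (suc L) (λ i → F i j) ∎
        outer : ∀ i → i ≤ L → ∑ℤ N (F i) ≈ q^ (e i) * (g i * K i (L ∸ i))
        outer i i≤L = begin
          ∑ℤ N (F i) ≈⟨ *-distribˡ-∑ℤ N (q^ (e i) * g i) (term E (pair P i (L ∸ i))) ⟨
          q^ (e i) * g i * lhs P N i (L ∸ i) ≈⟨ *-congˡ (IH i i≤L) ⟩
          q^ (e i) * g i * K i (L ∸ i) ≈⟨ *-assoc _ _ _ ⟩
          q^ (e i) * (g i * K i (L ∸ i)) ∎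

  lhs-step₁ : ∀ P N L K M → Bounded P → (∀ i → i ≤ L → lhs P N i (L ∸ i) ≈ K i (L ∸ i)) →
    lhs (step₁ P) N L M ≈ transform₁ K L M
  lhs-step₁ P N L K M bd IH = expand (λ i → i ℕ.* i) (λ i → binomℤ (+ (2 ℕ.* L ℕ.+ M) ℤ.- + i) (+ (2 ℕ.* L)))
    (λ j → sq (line₁ j)) (pair (step₁ P) L M)
    λ j → trans (burge₁ L M (line₁ j) (line₂ j) (same-sign P bd j))
      (*-congˡ (reflexive (≡.cong (λ t → 𝓑 L M t (line₁ j)) (sum-line (+ a) (+ ā) (+ b) (+ b̄) j))))
    where
    open Params P
    open Step P N L K IH

  lhs-step₂ : ∀ P N L K M → Bounded P → (∀ i → i ≤ L → lhs P N i (L ∸ i) ≈ K i (L ∸ i)) →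
    lhs (step₂ P) N L M ≈ transform₂ K L M
  lhs-step₂ P N L K M bd IH = expand (λ i → (L ∸ i) ℕ.* (L ∸ i)) (λ i → binomℤ (+ (L ℕ.+ M ℕ.+ i)) (+ (2 ℕ.* L)))
    (λ j → sq (line₂ j)) (pair (step₂ P) L M)
    λ j → trans (burge₂ L M (line₁ j) (line₂ j) (same-sign P bd j))
      (*-congˡ (reflexive (≡.cong (λ t → 𝓑 L M t (line₂ j)) (sum-line (+ a) (+ ā) (+ b) (+ b̄) j))))
    where
    open Params P
    open Step P N L K IH

  rhs : ∀ {as} → CF as → ℕ → ℕ → Carrier
  rhs two      = H₂₁
  rhs (stay c) = transform₂ (rhs c)
  rhs (drop c) = transform₁ (rhs c)

  lhs≈rhs : ∀ {as} (c : CF as) N L M → L ≤ N → lhs (paramsOf c) N L M ≈ rhs c L M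
  lhs≈rhs two      N L M L≤N = seed-identity N L M L≤N
  lhs≈rhs (stay c) N L M L≤N = lhs-step₂ (paramsOf c) N L (rhs c) M (bounded c)
    λ i i≤L → lhs≈rhs c N i (L ∸ i) (ℕₚ.≤-trans i≤L L≤N)
  lhs≈rhs (drop c) N L M L≤N = lhs-step₁ (paramsOf c) N L (rhs c) M (bounded c)
    λ i i≤L → lhs≈rhs c N i (L ∸ i) (ℕₚ.≤-trans i≤L L≤N)

  -- The final transform, leading from the value of the list to the pair of the theorem when a < 2b;
  -- its companion serves a > 2b.
  lhs₁≈rhs₁ : ∀ {as} (c : CF as) N L M → L ≤ N → lhs (step₁ (paramsOf c)) N L M ≈ transform₁ (rhs c) L M
  lhs₁≈rhs₁ c N L M L≤N = lhs-step₁ (paramsOf c) N L (rhs c) M (bounded c)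
    λ i i≤L → lhs≈rhs c N i (L ∸ i) (ℕₚ.≤-trans i≤L L≤N)

  lhs₂≈rhs₂ : ∀ {as} (c : CF as) N L M → L ≤ N → lhs (step₂ (paramsOf c)) N L M ≈ transform₂ (rhs c) L M
  lhs₂≈rhs₂ c N L M L≤N = lhs-step₂ (paramsOf c) N L (rhs c) M (bounded c)
    λ i i≤L → lhs≈rhs c N i (L ∸ i) (ℕₚ.≤-trans i≤L L≤N)

  -- Sums over the vectors m as iterated transforms

  ∑box : ℕ → ℕ → (List ℕ → Carrier) → Carrier
  ∑box zero    N f = f []
  ∑box (suc d) N f = ∑ (suc N) (λ i → ∑box d N (λ m → f (i ∷ m)))

  ∑box-cong : ∀ d N {f g : List ℕ → Carrier} → (∀ m → f m ≈ g m) → ∑box d N f ≈ ∑box d N g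
  ∑box-cong zero    N f≈g = f≈g []
  ∑box-cong (suc d) N f≈g = ∑-cong (suc N) λ i _ → ∑box-cong d N λ m → f≈g (i ∷ m)

  ∑box-zero : ∀ d N {f : List ℕ → Carrier} → (∀ m → f m ≈ 0#) → ∑box d N f ≈ 0#
  ∑box-zero zero    N f≈0 = f≈0 []
  ∑box-zero (suc d) N f≈0 = ∑-zero (suc N) λ i _ → ∑box-zero d N λ m → f≈0 (i ∷ m)

  *-distribˡ-∑box : ∀ d N x (f : List ℕ → Carrier) → x * ∑box d N f ≈ ∑box d N (λ m → x * f m)
  *-distribˡ-∑box zero    N x f = refl
  *-distribˡ-∑box (suc d) N x f =
    trans (*-distribˡ-∑ (suc N) x _) (∑-cong (suc N) λ i _ → *-distribˡ-∑box d N x (λ m → f (i ∷ m)))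

  -- The product over j in H with the n_j written out. Only the first factor depends on L; in the
  -- remaining ones m_1 takes over its role.
  tailProduct : ∀ {as} → CF as → ℕ → List ℕ → Carrier
  tailProduct two      L m = binomℤ (+ (L ℕ.+ mAt m 2)) (+ (2 ℕ.* mAt m 1) ℤ.- + 1) * binomℤ (+ mAt m 1 ℤ.- + 1) (+ mAt m 2)
  tailProduct (stay c) L m = binomℤ (+ (L ℕ.+ mAt m 2)) (+ (2 ℕ.* mAt m 1)) * tailProduct c (mAt m 1) (List.drop 1 m)
  tailProduct (drop c) L m = binomℤ (+ (L ℕ.+ mAt m 1) ℤ.- + mAt m 2) (+ (2 ℕ.* mAt m 1)) * tailProduct c (mAt m 1) (List.drop 1 m)

  private
    x+y<2z : ∀ {x y z} → x < z → y ≤ z → x ℕ.+ y < 2 ℕ.* z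
    x+y<2z {x} {y} {z} x<z y≤z = ≡.subst (x ℕ.+ y <_) (≡.cong (z ℕ.+_) (≡.sym (ℕₚ.+-identityʳ z))) (ℕₚ.+-mono-<-≤ x<z y≤z)

    mAt-drop : ∀ m j → mAt (List.drop 1 m) (suc j) ≡ mAt m (suc (suc j))
    mAt-drop []      j = ≡.refl
    mAt-drop (x ∷ m) j = ≡.refl

  -- After `stay`: if m_2 ≤ m_1, the first upper entry L + m_2 is below 2 m_1; if m_2 > m_1, the
  -- remaining product vanishes by induction with m_1 in place of L. After `drop` the upper entry L
  -- + m_1 - m_2 is below 2 m_1 anyway. This confines m_1 to values up to L.
  tailProduct-zero : ∀ {as} (c : CF as) L m → L < mAt m 1 → tailProduct c L m ≈ 0#
  tailProduct-zero two L m L<m₁ with mAt m 1 | mAt m 2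
  ... | suc i | y with y ℕₚ.≤? i
  ...   | no y≰i  = zero-*ʳ (binomℤ-n<k (ℤ.+<+ (ℕₚ.≰⇒> y≰i)))
  ...   | yes y≤i = zero-*ˡ (binomℤ-n<k (ℤ.+<+ (≡.subst (L ℕ.+ y <_) eq (ℕₚ.+-mono-<-≤ L<m₁ y≤i))))
    where
    eq : suc i ℕ.+ i ≡ i ℕ.+ suc (i ℕ.+ 0)
    eq = ≡.trans (≡.sym (ℕₚ.+-suc i i)) (≡.cong (λ k → i ℕ.+ suc k) (≡.sym (ℕₚ.+-identityʳ i)))
  tailProduct-zero (stay c) L m L<m₁ with mAt m 2 ℕₚ.≤? mAt m 1
  ... | yes m₂≤m₁ = zero-*ˡ (binomℤ-n<k (ℤ.+<+ (x+y<2z L<m₁ m₂≤m₁)))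
  ... | no m₂≰m₁  = zero-*ʳ (tailProduct-zero c (mAt m 1) (List.drop 1 m)
                      (≡.subst (mAt m 1 <_) (≡.sym (mAt-drop m 0)) (ℕₚ.≰⇒> m₂≰m₁)))
  tailProduct-zero (drop c) L m L<m₁ = zero-*ˡ (binomℤ-n<k
    (ℤₚ.≤-<-trans (ℤₚ.i-j≤i (+ (L ℕ.+ mAt m 1)) (+ mAt m 2)) (ℤ.+<+ (x+y<2z L<m₁ ℕₚ.≤-refl))))

  module _ {as} (c : CF as) where

    -- With m_1 = i fixed, the sum over the other entries is the right-hand side at (i, L - i),
    -- exactly the arguments at which the Burge transform evaluates it.
    BoxSum : Set _
    BoxSum = ∀ N L i → L ≤ N → i ≤ L →
      ∑box (ℕ.pred (dOf as)) N (λ m → q^ tailExponent c (i ∷ m) * tailProduct c L (i ∷ m)) ≈ rhs c i (L ∸ i)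

    -- Attaches a kernel in i and sums over m_1 = i as well: the terms with i > L drop out by
    -- `tailProduct-zero`, the others are instances of `BoxSum`.
    ∑box-outer : BoxSum → ∀ N L (e : ℕ → ℕ) (g : ℕ → Carrier) → L ≤ N →
      ∑ (suc N) (λ i → ∑box (ℕ.pred (dOf as)) N (λ m →
          q^ (e i ℕ.+ tailExponent c (i ∷ m)) * (g i * tailProduct c L (i ∷ m))))
        ≈ ∑ (suc L) (λ i → q^ (e i) * (g i * rhs c i (L ∸ i)))
    ∑box-outer boxSum N L e g L≤N with ℕₚ.m≤n⇒∃[o]m+o≡n L≤N
    ... | k , ≡.refl = begin
      ∑ (suc L ℕ.+ k) F
        ≈⟨ ∑-pad (suc L) k F large ⟩
      ∑ (suc L) F
        ≈⟨ ∑-cong (suc L) (λ { i (s≤s i≤L) → small i i≤L }) ⟩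
      ∑ (suc L) (λ i → q^ (e i) * (g i * rhs c i (L ∸ i))) ∎
      where
      d = ℕ.pred (dOf as)
      G : ℕ → List ℕ → Carrier
      G i m = q^ tailExponent c (i ∷ m) * tailProduct c L (i ∷ m)
      F : ℕ → Carrier
      F i = ∑box d (L ℕ.+ k) (λ m → q^ (e i ℕ.+ tailExponent c (i ∷ m)) * (g i * tailProduct c L (i ∷ m)))
      large : ∀ i → L < i → F i ≈ 0#
      large i L<i = ∑box-zero d (L ℕ.+ k) λ m → zero-*ʳ (zero-*ʳ (tailProduct-zero c L (i ∷ m) L<i))
      small : ∀ i → i ≤ L → F i ≈ q^ (e i) * (g i * rhs c i (L ∸ i))
      small i i≤L = begin
        F i
          ≈⟨ ∑box-cong d (L ℕ.+ k) (λ m → trans (*-congʳ (q^-+ _ _))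
               (solve 4 (λ e t g p → e :* t :* (g :* p) := e :* g :* (t :* p)) refl _ _ _ _)) ⟩
        ∑box d (L ℕ.+ k) (λ m → q^ (e i) * g i * G i m)
          ≈⟨ *-distribˡ-∑box d (L ℕ.+ k) (q^ (e i) * g i) (G i) ⟨
        q^ (e i) * g i * ∑box d (L ℕ.+ k) (G i)
          ≈⟨ *-congˡ (boxSum (L ℕ.+ k) L i L≤N i≤L) ⟩
        q^ (e i) * g i * rhs c i (L ∸ i)
          ≈⟨ *-assoc _ _ _ ⟩
        q^ (e i) * (g i * rhs c i (L ∸ i)) ∎

  private
    sq-∸ : ∀ {i L} → i ≤ L → sq (+ L ℤ.- + i) ≡ (L ∸ i) ℕ.* (L ∸ i)
    sq-∸ i≤L = ≡.cong sq (≡.sym (+∸ i≤L))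

  -- For `stay` and `drop` the first factor is the kernel of the transform at (i, L - i), because L
  -- = i + (L - i) and L + i = 2i + (L - i); the rest is `∑box-outer` with i in place of L. The base
  -- case reverses the sum over m_2.
  boxSum : ∀ {as} (c : CF as) → BoxSum c
  -- For m_1 = 0 the lower entry 2 m_1 - 1 is negative, in agreement with the empty sum `H₂₁` at 0.
  boxSum two N L zero L≤N i≤L = trans
    (∑-zero (suc N) λ y _ → zero-*ʳ (zero-*ˡ (binomℤ-negʳ _ 0))) (sym (∑-0 _))
  boxSum two N L (suc i) L≤N i<L = begin
    ∑ (suc N) F
      ≈⟨ ∑-change-bound (suc N) (suc i) F (λ y N<y → large y (ℕₚ.≤-trans i<L (ℕₚ.≤-trans L≤N (ℕₚ.<⇒≤ N<y)))) large ⟩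
    ∑ (suc i) F
      ≈⟨ ∑-reverse i F ⟩
    ∑ (suc i) (λ k → F (i ∸ k))
      ≈⟨ ∑-cong (suc i) (λ { k (s≤s k≤i) → step k k≤i }) ⟩
    H₂₁ (suc i) (L ∸ suc i) ∎
    where
    F : ℕ → Carrier
    F y = q^ sq (+ suc i ℤ.- + y ℤ.- + 1) *
      (binomℤ (+ (L ℕ.+ y)) (+ (2 ℕ.* suc i) ℤ.- + 1) * binomℤ (+ suc i ℤ.- + 1) (+ y))
    large : ∀ y → suc i ≤ y → F y ≈ 0#
    large y i<y = zero-*ʳ (zero-*ʳ (binomℤ-n<k (ℤ.+<+ i<y)))
    ar₁ : ∀ i k → + 1 ℤ.+ i ℤ.- (i ℤ.- k) ℤ.- + 1 ≡ k
    ar₁ = solveℤ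
    ar₂ : ∀ L i k → L ℤ.+ (i ℤ.- k) ≡ (+ 1 ℤ.+ i) ℤ.+ (+ 1 ℤ.+ i) ℤ.+ (L ℤ.- (+ 1 ℤ.+ i)) ℤ.- k ℤ.- + 1
    ar₂ = solveℤ
    double : + 2 ℤ.* + suc i ≡ + suc i ℤ.+ + suc i
    double = ≡.cong (λ k → + (suc i ℕ.+ k)) (ℕₚ.+-identityʳ (suc i))
    step : ∀ k → k ≤ i → F (i ∸ k) ≈ q^ (k ℕ.* k) *
      (binomℤ (+ (2 ℕ.* suc i ℕ.+ (L ∸ suc i)) ℤ.- + k ℤ.- + 1) (+ (2 ℕ.* suc i) ℤ.- + 1) * binomℤ (+ i) (+ k))
    step k k≤i = *-cong
      (qpow-cong (≡.cong sq (≡.trans (≡.cong (λ t → + suc i ℤ.- t ℤ.- + 1) (+∸ k≤i)) (ar₁ (+ i) (+ k)))))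
      (*-cong
        (binomℤ-cong (≡.trans (≡.cong (λ t → + L ℤ.+ t) (+∸ k≤i)) (≡.trans (ar₂ (+ L) (+ i) (+ k))
          (≡.cong₂ (λ s t → s ℤ.+ t ℤ.- + k ℤ.- + 1) (≡.sym double) (≡.sym (+∸ i<L))))) ≡.refl)
        (trans (binomℤ-sym (+ i) (+ (i ∸ k))) (binomℤ-cong {+ i} ≡.refl
          (≡.trans (≡.cong (λ t → + i ℤ.- t) (+∸ k≤i)) (ar₃ (+ i) (+ k))))))
      where
      ar₃ : ∀ i k → i ℤ.- (i ℤ.- k) ≡ k
      ar₃ = solveℤ
  boxSum (stay c) N L i L≤N i≤L = trans
    (∑box-outer c (boxSum c) N i (λ y → sq (+ i ℤ.- + y)) (λ y → binomℤ (+ (L ℕ.+ y)) (+ (2 ℕ.* i))) (ℕₚ.≤-trans i≤L L≤N))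
    (∑-cong (suc i) λ { y (s≤s y≤i) → *-cong (qpow-cong (sq-∸ y≤i)) (*-congʳ
      (binomℤ-cong (≡.cong (λ t → + (t ℕ.+ y)) (≡.sym (ℕₚ.m+[n∸m]≡n i≤L))) ≡.refl)) })
  boxSum (drop c) N L i L≤N i≤L = trans
    (∑box-outer c (boxSum c) N i (λ y → y ℕ.* y) (λ y → binomℤ (+ (L ℕ.+ i) ℤ.- + y) (+ (2 ℕ.* i))) (ℕₚ.≤-trans i≤L L≤N))
    (∑-cong (suc i) λ { y (s≤s y≤i) → *-congˡ (*-congʳ
      (binomℤ-cong (≡.cong (λ t → + t ℤ.- + y) eq) ≡.refl)) })
    where
    ar : ∀ i k → i ℕ.+ k ℕ.+ i ≡ 2 ℕ.* i ℕ.+ k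
    ar = solveℕ
    eq : L ℕ.+ i ≡ 2 ℕ.* i ℕ.+ (L ∸ i)
    eq = ≡.trans (≡.cong (ℕ._+ i) (≡.sym (ℕₚ.m+[n∸m]≡n i≤L))) (ar i (L ∸ i))

  ∑box-transform₁ : ∀ {as} (c : CF as) N L M → L ≤ N →
    ∑ (suc N) (λ i → ∑box (ℕ.pred (dOf as)) N (λ m → q^ (i ℕ.* i ℕ.+ tailExponent c (i ∷ m)) *
        (binomℤ (+ (2 ℕ.* L ℕ.+ M) ℤ.- + i) (+ (2 ℕ.* L)) * tailProduct c L (i ∷ m))))
      ≈ transform₁ (rhs c) L M
  ∑box-transform₁ c N L M L≤N =
    ∑box-outer c (boxSum c) N L (λ i → i ℕ.* i) (λ i → binomℤ (+ (2 ℕ.* L ℕ.+ M) ℤ.- + i) (+ (2 ℕ.* L))) L≤N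

  ∑box-transform₂ : ∀ {as} (c : CF as) N L M → L ≤ N →
    ∑ (suc N) (λ i → ∑box (ℕ.pred (dOf as)) N (λ m → q^ (sq (+ L ℤ.- + i) ℕ.+ tailExponent c (i ∷ m)) *
        (binomℤ (+ (L ℕ.+ M ℕ.+ i)) (+ (2 ℕ.* L)) * tailProduct c L (i ∷ m))))
      ≈ transform₂ (rhs c) L M
  ∑box-transform₂ c N L M L≤N = trans
    (∑box-outer c (boxSum c) N L (λ i → sq (+ L ℤ.- + i)) (λ i → binomℤ (+ (L ℕ.+ M ℕ.+ i)) (+ (2 ℕ.* L))) L≤N)
    (∑-cong (suc L) λ { i (s≤s i≤L) → *-congʳ (qpow-cong (sq-∸ i≤L)) })

-- The ring of formal power series

tailPS : PS → PS
tailPS f k = f (suc k)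

_+PS_ : PS → PS → PS
(f +PS g) k = f k ℤ.+ g k

-PS_ : PS → PS
(-PS f) k = ℤ.- f k

sumUpTo-applyUpTo : ∀ k f → sumUpTo k f ≡ sumℤ (applyUpTo f (suc k))
sumUpTo-applyUpTo k f = ≡.cong sumℤ (Listₚ.map-upTo f (suc k))

*PS-0 : ∀ f g → (f *PS g) 0 ≡ f 0 ℤ.* g 0
*PS-0 f g = ℤₚ.+-identityʳ _

-- From f = f(0) + q · `tailPS f`. The ring laws below are inductions on the degree along this
-- recursion.
*PS-suc : ∀ f g k → (f *PS g) (suc k) ≡ f 0 ℤ.* g (suc k) ℤ.+ (tailPS f *PS g) k
*PS-suc f g k = ≡.trans (sumUpTo-applyUpTo (suc k) (λ i → f i ℤ.* g (suc k ∸ i))) (≡.cong (λ t → f 0 ℤ.* g (suc k) ℤ.+ t) (≡.sym (sumUpTo-applyUpTo k (λ i → f (suc i) ℤ.* g (k ∸ i)))))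

-- Splits off the last term of the convolution instead of the first; the two recursions together
-- make commutativity an induction on the degree.
*PS-suc′ : ∀ f g k → (f *PS g) (suc k) ≡ (f *PS tailPS g) k ℤ.+ f (suc k) ℤ.* g 0
*PS-suc′ f g zero = ≡.trans (*PS-suc f g 0)
  (≡.cong₂ ℤ._+_ (≡.sym (*PS-0 f (tailPS g))) (*PS-0 (tailPS f) g))
*PS-suc′ f g (suc k) = ≡.trans (*PS-suc f g (suc k))
  (≡.trans (≡.cong (λ t → f 0 ℤ.* g (suc (suc k)) ℤ.+ t) (*PS-suc′ (tailPS f) g k))
  (≡.trans (≡.sym (ℤₚ.+-assoc (f 0 ℤ.* g (suc (suc k))) _ _))
           (≡.cong (ℤ._+ f (suc (suc k)) ℤ.* g 0) (≡.sym (*PS-suc f (tailPS g) k)))))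

*PS-cong : ∀ {f f′ g g′} → f ≗ f′ → g ≗ g′ → (f *PS g) ≗ (f′ *PS g′)
*PS-cong {f} {f′} {g} {g′} f≗ g≗ zero = ≡.trans (*PS-0 f g)
  (≡.trans (≡.cong₂ ℤ._*_ (f≗ 0) (g≗ 0)) (≡.sym (*PS-0 f′ g′)))
*PS-cong {f} {f′} {g} {g′} f≗ g≗ (suc k) = ≡.trans (*PS-suc f g k)
  (≡.trans (≡.cong₂ ℤ._+_ (≡.cong₂ ℤ._*_ (f≗ 0) (g≗ (suc k))) (*PS-cong (f≗ ∘ suc) g≗ k)) (≡.sym (*PS-suc f′ g′ k)))

*PS-comm : ∀ f g → (f *PS g) ≗ (g *PS f)
*PS-comm f g zero    = ≡.trans (*PS-0 f g) (≡.trans (ℤₚ.*-comm (f 0) (g 0)) (≡.sym (*PS-0 g f)))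
*PS-comm f g (suc k) = ≡.trans (*PS-suc f g k)
  (≡.trans (≡.cong₂ ℤ._+_ (ℤₚ.*-comm (f 0) (g (suc k))) (*PS-comm (tailPS f) g k))
  (≡.trans (ℤₚ.+-comm (g (suc k) ℤ.* f 0) _) (≡.sym (*PS-suc′ g f k))))

*PS-distribʳ : ∀ h f g → ((f +PS g) *PS h) ≗ ((f *PS h) +PS (g *PS h))
*PS-distribʳ h f g zero = ≡.trans (*PS-0 (f +PS g) h)
  (≡.trans (ℤₚ.*-distribʳ-+ (h 0) (f 0) (g 0)) (≡.cong₂ ℤ._+_ (≡.sym (*PS-0 f h)) (≡.sym (*PS-0 g h))))
*PS-distribʳ h f g (suc k) = ≡.trans (*PS-suc (f +PS g) h k)
  (≡.trans (≡.cong (λ t → (f 0 ℤ.+ g 0) ℤ.* h (suc k) ℤ.+ t) (*PS-distribʳ h (tailPS f) (tailPS g) k))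
  (≡.trans (ar (f 0) (g 0) (h (suc k)) _ _) (≡.cong₂ ℤ._+_ (≡.sym (*PS-suc f h k)) (≡.sym (*PS-suc g h k)))))
  where
  ar : ∀ x y z u v → (x ℤ.+ y) ℤ.* z ℤ.+ (u ℤ.+ v) ≡ x ℤ.* z ℤ.+ u ℤ.+ (y ℤ.* z ℤ.+ v)
  ar = solveℤ

scalePS : ∀ x f g → ((λ k → x ℤ.* f k) *PS g) ≗ (λ k → x ℤ.* (f *PS g) k)
scalePS x f g zero    = ≡.trans (*PS-0 (λ k → x ℤ.* f k) g) (≡.trans (ℤₚ.*-assoc x (f 0) (g 0)) (≡.cong (x ℤ.*_) (≡.sym (*PS-0 f g))))
scalePS x f g (suc k) = ≡.trans (*PS-suc (λ k → x ℤ.* f k) g k)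
  (≡.trans (≡.cong (λ t → x ℤ.* f 0 ℤ.* g (suc k) ℤ.+ t) (scalePS x (tailPS f) g k))
  (≡.trans (ar x (f 0) (g (suc k)) _) (≡.cong (x ℤ.*_) (≡.sym (*PS-suc f g k)))))
  where
  ar : ∀ x y z u → x ℤ.* y ℤ.* z ℤ.+ x ℤ.* u ≡ x ℤ.* (y ℤ.* z ℤ.+ u)
  ar = solveℤ

*PS-assoc : ∀ f g h → ((f *PS g) *PS h) ≗ (f *PS (g *PS h))
*PS-assoc f g h zero = ≡.trans (*PS-0 (f *PS g) h)
  (≡.trans (≡.cong (ℤ._* h 0) (*PS-0 f g)) (≡.trans (ℤₚ.*-assoc (f 0) (g 0) (h 0))
  (≡.trans (≡.cong (f 0 ℤ.*_) (≡.sym (*PS-0 g h))) (≡.sym (*PS-0 f (g *PS h))))))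
*PS-assoc f g h (suc k) = begin
  ((f *PS g) *PS h) (suc k)
    ≡⟨ *PS-suc (f *PS g) h k ⟩
  (f *PS g) 0 ℤ.* h (suc k) ℤ.+ (tailPS (f *PS g) *PS h) k
    ≡⟨ ≡.cong₂ (λ x y → x ℤ.* h (suc k) ℤ.+ y) (*PS-0 f g) (*PS-cong {g = h} (*PS-suc f g) (λ _ → ≡.refl) k) ⟩
  f 0 ℤ.* g 0 ℤ.* h (suc k) ℤ.+ (((λ i → f 0 ℤ.* tailPS g i) +PS (tailPS f *PS g)) *PS h) k
    ≡⟨ ≡.cong (λ y → f 0 ℤ.* g 0 ℤ.* h (suc k) ℤ.+ y) (*PS-distribʳ h (λ i → f 0 ℤ.* tailPS g i) (tailPS f *PS g) k) ⟩
  f 0 ℤ.* g 0 ℤ.* h (suc k) ℤ.+ (((λ i → f 0 ℤ.* tailPS g i) *PS h) k ℤ.+ ((tailPS f *PS g) *PS h) k)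
    ≡⟨ ≡.cong₂ (λ x y → f 0 ℤ.* g 0 ℤ.* h (suc k) ℤ.+ (x ℤ.+ y)) (scalePS (f 0) (tailPS g) h k) (*PS-assoc (tailPS f) g h k) ⟩
  f 0 ℤ.* g 0 ℤ.* h (suc k) ℤ.+ (f 0 ℤ.* (tailPS g *PS h) k ℤ.+ (tailPS f *PS (g *PS h)) k)
    ≡⟨ ar (f 0) (g 0) (h (suc k)) _ _ ⟩
  f 0 ℤ.* (g 0 ℤ.* h (suc k) ℤ.+ (tailPS g *PS h) k) ℤ.+ (tailPS f *PS (g *PS h)) k
    ≡⟨ ≡.cong (λ x → f 0 ℤ.* x ℤ.+ (tailPS f *PS (g *PS h)) k) (≡.sym (*PS-suc g h k)) ⟩
  f 0 ℤ.* (g *PS h) (suc k) ℤ.+ (tailPS f *PS (g *PS h)) k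
    ≡⟨ *PS-suc f (g *PS h) k ⟨
  (f *PS (g *PS h)) (suc k) ∎
  where
  open ≡.≡-Reasoning
  ar : ∀ x y z u v → x ℤ.* y ℤ.* z ℤ.+ (x ℤ.* u ℤ.+ v) ≡ x ℤ.* (y ℤ.* z ℤ.+ u) ℤ.+ v
  ar = solveℤ

*PS-zeroˡ : ∀ f → (zeroPS *PS f) ≗ zeroPS
*PS-zeroˡ f zero    = ≡.trans (*PS-0 zeroPS f) (ℤₚ.*-zeroˡ (f 0))
*PS-zeroˡ f (suc k) = ≡.trans (*PS-suc zeroPS f k) (≡.cong₂ ℤ._+_ (ℤₚ.*-zeroˡ (f (suc k))) (*PS-zeroˡ f k))

*PS-identityˡ : ∀ f → (onePS *PS f) ≗ f
*PS-identityˡ f zero    = ≡.trans (*PS-0 onePS f) (ℤₚ.*-identityˡ (f 0))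
*PS-identityˡ f (suc k) = ≡.trans (*PS-suc onePS f k)
  (≡.trans (≡.cong₂ ℤ._+_ (ℤₚ.*-identityˡ (f (suc k))) (*PS-zeroˡ f k)) (ℤₚ.+-identityʳ _))

psRing : CommutativeRing 0ℓ 0ℓ
psRing = record
  { Carrier = PS ; _≈_ = _≗_ ; _+_ = _+PS_ ; _*_ = _*PS_ ; -_ = -PS_ ; 0# = zeroPS ; 1# = onePS
  ; isCommutativeRing = record
    { isRing = record
      { +-isAbelianGroup = record
        { isGroup = record
          { isMonoid = record
            { isSemigroup = record
              { isMagma = record
                { isEquivalence = record
                  { refl = λ _ → ≡.refl ; sym = λ e k → ≡.sym (e k) ; trans = λ e e′ k → ≡.trans (e k) (e′ k) }
                ; ∙-cong = λ e e′ k → ≡.cong₂ ℤ._+_ (e k) (e′ k) }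
              ; assoc = λ f g h k → ℤₚ.+-assoc (f k) (g k) (h k) }
            ; identity = (λ f k → ℤₚ.+-identityˡ (f k)) , (λ f k → ℤₚ.+-identityʳ (f k)) }
          ; inverse = (λ f k → ℤₚ.+-inverseˡ (f k)) , (λ f k → ℤₚ.+-inverseʳ (f k))
          ; ⁻¹-cong = λ e k → ≡.cong ℤ.-_ (e k) }
        ; comm = λ f g k → ℤₚ.+-comm (f k) (g k) }
      ; *-cong = λ {f} {f′} {g} {g′} → *PS-cong {f} {f′} {g} {g′}
      ; *-assoc = *PS-assoc
      ; *-identity = *PS-identityˡ , λ f k → ≡.trans (*PS-comm f onePS k) (*PS-identityˡ f k)
      ; distrib = (λ h f g k → ≡.trans (*PS-comm h (f +PS g) k) (≡.trans (*PS-distribʳ h f g k)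
                    (≡.cong₂ ℤ._+_ (*PS-comm f h k) (*PS-comm g h k)))) , *PS-distribʳ }
    ; *-comm = *PS-comm } }

qPS : PS
qPS zero    = + 0
qPS (suc k) = onePS k

private
  module P = CommutativeRing psRing
open Algebra.Properties.Semiring.Exp P.semiring using (_^_)

qPS-*-0 : ∀ f → (qPS *PS f) 0 ≡ + 0
qPS-*-0 f = ≡.trans (*PS-0 qPS f) (ℤₚ.*-zeroˡ (f 0))

qPS-*-suc : ∀ f k → (qPS *PS f) (suc k) ≡ f k
qPS-*-suc f k = ≡.trans (*PS-suc qPS f k)
  (≡.trans (≡.cong₂ ℤ._+_ (ℤₚ.*-zeroˡ (f (suc k))) (*PS-identityˡ f k)) (ℤₚ.+-identityˡ (f k)))

qPS^-≥ : ∀ n f k → ((qPS ^ n) *PS f) (n ℕ.+ k) ≡ f k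
qPS^-≥ zero    f k = *PS-identityˡ f k
qPS^-≥ (suc n) f k = ≡.trans (*PS-assoc qPS (qPS ^ n) f (suc n ℕ.+ k))
  (≡.trans (qPS-*-suc ((qPS ^ n) *PS f) (n ℕ.+ k)) (qPS^-≥ n f k))

qPS^-< : ∀ n f k → k < n → ((qPS ^ n) *PS f) k ≡ + 0
qPS^-< (suc n) f zero    _         = ≡.trans (*PS-assoc qPS (qPS ^ n) f 0) (qPS-*-0 ((qPS ^ n) *PS f))
qPS^-< (suc n) f (suc k) (s≤s k<n) = ≡.trans (*PS-assoc qPS (qPS ^ n) f (suc k))
  (≡.trans (qPS-*-suc ((qPS ^ n) *PS f) k) (qPS^-< n f k k<n))

one-qPS^ : ∀ i f → ((onePS +PS (-PS (qPS ^ suc i))) *PS f) ≗ (f +PS (-PS ((qPS ^ suc i) *PS f)))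
one-qPS^ i f = P.trans {i = (onePS +PS (-PS (qPS ^ suc i))) *PS f} (P.distribʳ f onePS (-PS (qPS ^ suc i)))
  (P.+-cong (P.*-identityˡ f) (P.sym (Algebra.Properties.Ring.-‿distribˡ-* P.ring (qPS ^ suc i) f)))

≡ᵇ-refl : ∀ n → (n ≡ᵇ n) ≡ true
≡ᵇ-refl zero    = ≡.refl
≡ᵇ-refl (suc n) = ≡ᵇ-refl n

≢⇒≡ᵇ-false : ∀ m n → ¬ (m ≡ n) → (m ≡ᵇ n) ≡ false
≢⇒≡ᵇ-false m n m≢n with m ≡ᵇ n in eq
... | false = ≡.refl
... | true  = contradiction (ℕₚ.≡ᵇ⇒≡ m n (≡.subst Bool.T (≡.sym eq) _)) m≢n

oneMinusQPow-≗ : ∀ i → oneMinusQPow i ≗ (onePS +PS (-PS (qPS ^ suc i)))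
oneMinusQPow-≗ i k = ≡.trans (split k)
  (≡.cong (λ t → onePS k ℤ.- t) (P.*-identityʳ (qPS ^ suc i) k))
  where
  split : ∀ k → oneMinusQPow i k ≡ onePS k ℤ.- ((qPS ^ suc i) *PS onePS) k
  split zero = ≡.sym (≡.cong (λ t → + 1 ℤ.- t) (qPS^-< (suc i) onePS 0 (s≤s z≤n)))
  split (suc k) with i ℕₚ.≤? k
  ... | no i≰k rewrite ≢⇒≡ᵇ-false k i (λ { ≡.refl → i≰k ℕₚ.≤-refl }) =
        ≡.sym (≡.cong (λ t → + 0 ℤ.- t) (qPS^-< (suc i) onePS (suc k) (s≤s (ℕₚ.≰⇒> i≰k))))
  ... | yes i≤k with ℕₚ.m≤n⇒∃[o]m+o≡n i≤k
  ...   | zero , ≡.refl rewrite ℕₚ.+-identityʳ i | ≡ᵇ-refl i =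
        ≡.sym (≡.cong (λ t → + 0 ℤ.- t) (≡.subst (λ m → ((qPS ^ suc i) *PS onePS) m ≡ + 1) (ℕₚ.+-identityʳ (suc i)) (qPS^-≥ (suc i) onePS 0)))
  ...   | suc o , ≡.refl rewrite ≢⇒≡ᵇ-false (i ℕ.+ suc o) i (λ e → ℕₚ.m+1+n≢m i e) =
        ≡.sym (≡.cong (λ t → + 0 ℤ.- t) (qPS^-≥ (suc i) onePS (suc o)))

-- Multiplying by 1 - q^{i+1} subtracts the series shifted by i + 1. The coefficients have that
-- period, so only those below degree i + 1 survive.
geomInv-inverse : ∀ i → ((onePS +PS (-PS (qPS ^ suc i))) *PS geomInv i) ≗ onePS
geomInv-inverse i k = ≡.trans (one-qPS^ i (geomInv i) k) (split k)
  where
  small : ∀ k → k < suc i → geomInv i k ≡ onePS k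
  small k k<i rewrite ℕ-DivMod.m<n⇒m%n≡m k<i with k
  ... | zero  = ≡.refl
  ... | suc _ = ≡.refl
  periodic : ∀ k → geomInv i (suc i ℕ.+ k) ≡ geomInv i k
  periodic k = ≡.cong (λ r → if r ≡ᵇ 0 then + 1 else + 0)
    (≡.trans (≡.cong (ℕ._% suc i) (ℕₚ.+-comm (suc i) k)) (ℕ-DivMod.[m+n]%n≡m%n k (suc i)))
  split : ∀ k → geomInv i k ℤ.- ((qPS ^ suc i) *PS geomInv i) k ≡ onePS k
  split k with k ℕₚ.<? suc i
  ... | yes k<i = ≡.trans (≡.cong₂ ℤ._-_ (small k k<i) (qPS^-< (suc i) (geomInv i) k k<i)) (ℤₚ.+-identityʳ _)
  ... | no k≮i with ℕₚ.m≤n⇒∃[o]m+o≡n (ℕₚ.≮⇒≥ k≮i)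
  ...   | o , ≡.refl = ≡.trans (≡.cong₂ ℤ._-_ (periodic o) (qPS^-≥ (suc i) (geomInv i) o)) (ℤₚ.+-inverseʳ (geomInv i o))

psParameter : QuantumParameter psRing
psParameter = record { q = qPS ; inv = geomInv ; inverse = geomInv-inverse }

open QBinomial psRing psParameter
open IntegerBinomial psRing psParameter
open IntegerSums psRing psParameter

-- `prodPS` peels off the first factor, whereas `poch` and `pochInv` peel off the last.
prodPS-snoc : ∀ (f : ℕ → PS) n → prodPS (applyUpTo f (suc n)) ≗ (prodPS (applyUpTo f n) *PS f n)
prodPS-snoc f zero    = P.*-comm (f 0) onePS
prodPS-snoc f (suc n) = P.trans (P.*-congˡ {f 0} (prodPS-snoc (f ∘ suc) n)) (P.sym (P.*-assoc (f 0) (prodPS (applyUpTo (f ∘ suc) n)) (f (suc n))))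

qPoch-poch : ∀ n → qPoch n ≗ poch n
qPoch-poch n = P.trans (P.reflexive (≡.cong prodPS (Listₚ.map-upTo oneMinusQPow n))) (go n)
  where
  go : ∀ n → prodPS (applyUpTo oneMinusQPow n) ≗ poch n
  go zero    = P.refl {onePS}
  go (suc n) = P.trans (prodPS-snoc oneMinusQPow n) (P.*-cong {u = oneMinusQPow n} (go n)
    (P.trans {i = oneMinusQPow n} (oneMinusQPow-≗ n) (P.+-congˡ {onePS} (P.-‿cong {qPS ^ suc n} (P.sym {q^ suc n} (q^-def (suc n)))))))

qPochInv-pochInv : ∀ n → qPochInv n ≗ pochInv n
qPochInv-pochInv n = P.trans (P.reflexive (≡.cong prodPS (Listₚ.map-upTo geomInv n))) (go n)
  where
  go : ∀ n → prodPS (applyUpTo geomInv n) ≗ pochInv n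
  go zero    = P.refl {onePS}
  go (suc n) = P.trans (prodPS-snoc geomInv n) (P.*-congʳ {geomInv n} (go n))

gaussNat-binom : ∀ m r → gaussNat m r ≗ binom (m ℕ.+ r) m
gaussNat-binom m r = P.trans
  (P.*-cong (qPoch-poch (m ℕ.+ r)) (P.*-cong (qPochInv-pochInv m) (qPochInv-pochInv r)))
  (P.sym {binom (m ℕ.+ r) m} (binom-multinom m r))

-- `gauss` asks for m ≥ 0 and n - m ≥ 0, `binomℤ` for two nonnegative entries; where these differ,
-- at 0 ≤ n < m, `binom` is zero.
gauss-binomℤ : ∀ n m → gauss n m ≗ binomℤ n m
gauss-binomℤ n m with m | n ℤ.- m in eq
... | + m′      | + r′      = P.trans (gaussNat-binom m′ r′) (P.sym {binomℤ n (+ m′)}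
      (P.trans {binomℤ n (+ m′)} (P.reflexive (≡.cong (λ t → binomℤ t (+ m′)) n≡)) (binomℤ-+ (m′ ℕ.+ r′) m′)))
  where
  ar : ∀ n m → n ≡ m ℤ.+ (n ℤ.- m)
  ar = solveℤ
  n≡ : n ≡ + (m′ ℕ.+ r′)
  n≡ = ≡.trans (ar n (+ m′)) (≡.cong (λ t → + m′ ℤ.+ t) eq)
... | + m′      | -[1+ r′ ] = P.sym {binomℤ n (+ m′)} (binomℤ-n<k (ℤₚ.≰⇒> λ m≤n → neg (≡.subst (+ 0 ℤ.≤_) eq (ℤₚ.i≤j⇒0≤j-i m≤n))))
  where
  neg : ∀ {r} → ¬ (+ 0 ℤ.≤ -[1+ r ])
  neg ()
... | -[1+ m′ ] | + r′      = P.sym {binomℤ n -[1+ m′ ]} (binomℤ-negʳ n m′)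
... | -[1+ m′ ] | -[1+ r′ ] = P.sym {binomℤ n -[1+ m′ ]} (binomℤ-negʳ n m′)

open Induction psRing psParameter

-- Coefficients of the finite sums

coeff : PS → ℤ → ℤ
coeff f (+ t)    = f t
coeff f -[1+ _ ] = + 0

coeff-cong : ∀ {f g} → f ≗ g → ∀ k → coeff f k ≡ coeff g k
coeff-cong f≗g (+ t)    = f≗g t
coeff-cong f≗g -[1+ _ ] = ≡.refl

coeff-+ : ∀ f g k → coeff (f +PS g) k ≡ coeff f k ℤ.+ coeff g k
coeff-+ f g (+ t)    = ≡.refl
coeff-+ f g -[1+ _ ] = ≡.refl

coeff-0 : ∀ k → coeff zeroPS k ≡ + 0
coeff-0 (+ t)    = ≡.refl
coeff-0 -[1+ _ ] = ≡.refl

private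
  q^-≥ : ∀ n f k → ((q^ n) *PS f) (n ℕ.+ k) ≡ f k
  q^-≥ n f k = ≡.trans (P.*-congʳ {f} (q^-def n) (n ℕ.+ k)) (qPS^-≥ n f k)

  q^-< : ∀ n f k → k < n → ((q^ n) *PS f) k ≡ + 0
  q^-< n f k k<n = ≡.trans (P.*-congʳ {f} (q^-def n) k) (qPS^-< n f k k<n)

  shiftCoeff-≥ : ∀ e f k t → k ℤ.- e ≡ + t → shiftCoeff e f k ≡ f t
  shiftCoeff-≥ e f k t eq with k ℤ.- e
  shiftCoeff-≥ e f k t ≡.refl | + .t = ≡.refl

  shiftCoeff-< : ∀ e f k t → k ℤ.- e ≡ -[1+ t ] → shiftCoeff e f k ≡ + 0
  shiftCoeff-< e f k t eq with k ℤ.- e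
  shiftCoeff-< e f k t ≡.refl | -[1+ .t ] = ≡.refl

-- Only nonnegative shifts are products with powers of q, so every integer exponent of the statement
-- is first brought into the form `+ n`.
shiftCoeff-coeff : ∀ n f k → shiftCoeff (+ n) f k ≡ coeff ((q^ n) *PS f) k
shiftCoeff-coeff zero    f -[1+ k ] = shiftCoeff-< (+ 0) f -[1+ k ] k ≡.refl
shiftCoeff-coeff (suc n) f -[1+ k ] = shiftCoeff-< (+ suc n) f -[1+ k ] (suc (k ℕ.+ n)) ≡.refl
shiftCoeff-coeff n f (+ k) with n ℕₚ.≤? k
... | yes n≤k with ℕₚ.m≤n⇒∃[o]m+o≡n n≤k
...   | o , ≡.refl = ≡.trans (shiftCoeff-≥ (+ n) f (+ (n ℕ.+ o)) o (ar (+ n) (+ o))) (≡.sym (q^-≥ n f o))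
  where
  ar : ∀ n o → n ℤ.+ o ℤ.- n ≡ o
  ar = solveℤ
shiftCoeff-coeff n f (+ k) | no n≰k with ℕₚ.m≤n⇒∃[o]m+o≡n (ℕₚ.≰⇒> n≰k)
... | o , ≡.refl = ≡.trans (shiftCoeff-< (+ n) f (+ k) o (ar (+ k) (+ o))) (≡.sym (q^-< n f k (ℕₚ.≰⇒> n≰k)))
  where
  ar : ∀ k o → k ℤ.- (+ 1 ℤ.+ k ℤ.+ o) ≡ ℤ.- (+ 1 ℤ.+ o)
  ar = solveℤ

signPow-coeff : ∀ j f k → signPow j ℤ.* coeff f k ≡ coeff (sign j *PS f) k
signPow-coeff j f k = ≡.trans (go ∣ j ∣) (coeff-cong (P.*-congʳ {f} (P.sym {sign j} (sign-def j))) k)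
  where
  coeff-neg : ∀ g k → coeff (-PS g) k ≡ ℤ.- coeff g k
  coeff-neg g (+ t)    = ≡.refl
  coeff-neg g -[1+ _ ] = ≡.refl
  ar : ∀ x y → (ℤ.- (+ 1)) ℤ.* x ℤ.* y ≡ ℤ.- (x ℤ.* y)
  ar = solveℤ
  go : ∀ n → (ℤ.- (+ 1)) ℤ.^ n ℤ.* coeff f k ≡ coeff (signℕ n *PS f) k
  go zero    = ≡.trans (ℤₚ.*-identityˡ _) (≡.sym (coeff-cong (P.*-identityˡ f) k))
  go (suc n) = ≡.trans (ar ((ℤ.- (+ 1)) ℤ.^ n) (coeff f k)) (≡.trans (≡.cong ℤ.-_ (go n))
    (≡.trans (≡.sym (coeff-neg (signℕ n *PS f) k))
             (coeff-cong (Algebra.Properties.Ring.-‿distribˡ-* P.ring (signℕ n) f) k)))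

sumℤ-++ : ∀ xs ys → sumℤ (xs ++ ys) ≡ sumℤ xs ℤ.+ sumℤ ys
sumℤ-++ []       ys = ≡.sym (ℤₚ.+-identityˡ _)
sumℤ-++ (x ∷ xs) ys = ≡.trans (≡.cong (λ t → x ℤ.+ t) (sumℤ-++ xs ys)) (≡.sym (ℤₚ.+-assoc x _ _))

sumℤ-concatMap : ∀ {A B : Set} (g : B → ℤ) (h : A → List B) xs →
  sumℤ (List.map g (concatMap h xs)) ≡ sumℤ (List.map (λ x → sumℤ (List.map g (h x))) xs)
sumℤ-concatMap g h []       = ≡.refl
sumℤ-concatMap g h (x ∷ xs) = ≡.trans (≡.cong sumℤ (Listₚ.map-++ g (h x) (concatMap h xs)))
  (≡.trans (sumℤ-++ (List.map g (h x)) _) (≡.cong (λ t → sumℤ (List.map g (h x)) ℤ.+ t) (sumℤ-concatMap g h xs)))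

coeff-∑ : ∀ n (F : ℕ → PS) k → sumℤ (List.map (λ i → coeff (F i) k) (upTo n)) ≡ coeff (∑ n F) k
coeff-∑ n F k = ≡.trans (≡.cong sumℤ (Listₚ.map-upTo (λ i → coeff (F i) k) n)) (go n F)
  where
  go : ∀ n (F : ℕ → PS) → sumℤ (applyUpTo (λ i → coeff (F i) k) n) ≡ coeff (∑ n F) k
  go zero    F = ≡.sym (≡.trans (coeff-cong (∑-0 F) k) (coeff-0 k))
  go (suc n) F = ≡.trans (≡.cong (λ t → coeff (F 0) k ℤ.+ t) (go n (λ i → F (suc i))))
    (≡.trans (≡.sym (coeff-+ (F 0) (∑ n (λ i → F (suc i))) k)) (≡.sym (coeff-cong (∑-suc n F) k)))

-- `symRange` lists all nonnegative integers before the negative ones, whereas `∑ℤ` pairs opposite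
-- ones.
coeff-∑ℤ : ∀ N (F : ℤ → PS) k → sumℤ (List.map (λ j → coeff (F j) k) (symRange N)) ≡ coeff (∑ℤ N F) k
coeff-∑ℤ N F k = begin
  sumℤ (List.map g (List.map +_ (upTo (suc N)) ++ List.map -[1+_] (upTo N)))
    ≡⟨ ≡.cong sumℤ (Listₚ.map-++ g (List.map +_ (upTo (suc N))) _) ⟩
  sumℤ (List.map g (List.map +_ (upTo (suc N))) ++ List.map g (List.map -[1+_] (upTo N)))
    ≡⟨ sumℤ-++ (List.map g (List.map +_ (upTo (suc N)))) _ ⟩
  sumℤ (List.map g (List.map +_ (upTo (suc N)))) ℤ.+ sumℤ (List.map g (List.map -[1+_] (upTo N)))
    ≡⟨ ≡.cong₂ (λ x y → sumℤ x ℤ.+ sumℤ y) (≡.sym (Listₚ.map-∘ {g = g} {f = +_} (upTo (suc N)))) (≡.sym (Listₚ.map-∘ {g = g} {f = -[1+_]} (upTo N))) ⟩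
  sumℤ (List.map (λ i → coeff (F (+ i)) k) (upTo (suc N))) ℤ.+ sumℤ (List.map (λ i → coeff (F -[1+ i ]) k) (upTo N))
    ≡⟨ ≡.cong₂ ℤ._+_ (coeff-∑ (suc N) (λ i → F (+ i)) k) (coeff-∑ N (λ i → F -[1+ i ]) k) ⟩
  coeff (∑ (suc N) (λ i → F (+ i))) k ℤ.+ coeff (∑ N (λ i → F -[1+ i ])) k
    ≡⟨ ≡.sym (coeff-+ (∑ (suc N) (λ i → F (+ i))) (∑ N (λ i → F -[1+ i ])) k) ⟩
  coeff (∑ (suc N) (λ i → F (+ i)) +PS ∑ N (λ i → F -[1+ i ])) k
    ≡⟨ coeff-cong merge k ⟩
  coeff (∑ℤ N F) k ∎
  where
  open ≡.≡-Reasoning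
  g : ℤ → ℤ
  g j = coeff (F j) k
  merge : (∑ (suc N) (λ i → F (+ i)) +PS ∑ N (λ i → F -[1+ i ])) ≗ ∑ℤ N F
  merge = P.trans {∑ (suc N) (λ i → F (+ i)) +PS ∑ N (λ i → F -[1+ i ])}
    (P.+-congʳ {∑ N (λ i → F -[1+ i ])} (∑-suc N (λ i → F (+ i))))
    (P.trans (P.+-assoc (F (+ 0)) (∑ N (λ i → F (+ suc i))) (∑ N (λ i → F -[1+ i ])))
      (P.+-congˡ {F (+ 0)} (P.sym {∑ N (λ i → F (+ suc i) +PS F -[1+ i ])} (∑-distrib-+ N (λ i → F (+ suc i)) (λ i → F -[1+ i ])))))

coeff-∑box : ∀ d N (F : List ℕ → PS) k → sumℤ (List.map (λ m → coeff (F m) k) (box d N)) ≡ coeff (∑box d N F) k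
coeff-∑box zero    N F k = ℤₚ.+-identityʳ _
coeff-∑box (suc d) N F k = begin
  sumℤ (List.map (λ m → coeff (F m) k) (box (suc d) N))
    ≡⟨ sumℤ-concatMap (λ m → coeff (F m) k) (λ i → List.map (i ∷_) (box d N)) (upTo (suc N)) ⟩
  sumℤ (List.map (λ i → sumℤ (List.map (λ m → coeff (F m) k) (List.map (i ∷_) (box d N)))) (upTo (suc N)))
    ≡⟨ ≡.cong sumℤ (Listₚ.map-cong (λ i → ≡.trans (≡.cong sumℤ (≡.sym (Listₚ.map-∘ (box d N)))) (coeff-∑box d N (λ m → F (i ∷ m)) k)) (upTo (suc N))) ⟩
  sumℤ (List.map (λ i → coeff (∑box d N (λ m → F (i ∷ m))) k) (upTo (suc N)))
    ≡⟨ coeff-∑ (suc N) (λ i → ∑box d N (λ m → F (i ∷ m))) k ⟩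
  coeff (∑box (suc d) N F) k ∎
  where open ≡.≡-Reasoning

-- Membership in {t₁, …, t_{n+1}}, as tested by calI.
marked : List ℕ → ℕ → Bool
marked as j = List.foldr (λ t r → (t ≡ᵇ j) ∨ r) false (tList as)

-- Splitting off the first row and column of C

private
  row : Bool → ℕ → ℕ → ℤ
  row false j k = δ j (suc k) ℤ.+ δ (suc j) k
  row true  j k = δ j (suc k) ℤ.+ δ j k ℤ.- δ (suc j) k

  calI-row : ∀ as j k → calI as j k ≡ row (marked as j) j k
  calI-row as j k with List.foldr (λ t r → (t ≡ᵇ j) ∨ r) false (tList as)
  ... | false = ≡.refl
  ... | true  = ≡.refl

  Cmat-row : ∀ as j k → Cmat as j k ≡ (+ 2) ℤ.* δ j k ℤ.- row (marked as j) j k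
  Cmat-row as j k = ≡.cong (λ t → (+ 2) ℤ.* δ j k ℤ.- t) (calI-row as j k)

  any : ℕ → List ℕ → Bool
  any j = List.foldr (λ t r → (t ≡ᵇ j) ∨ r) false

  any-suc : ∀ x j l → any (suc j) (List.map (suc x ℕ.+_) l) ≡ any j (List.map (x ℕ.+_) l)
  any-suc x j []      = ≡.refl
  any-suc x j (t ∷ l) = ≡.cong ((x ℕ.+ t ≡ᵇ j) ∨_) (any-suc x j l)

  any-map-suc : ∀ j l → any (suc j) (List.map (1 ℕ.+_) l) ≡ any j l
  any-map-suc j []      = ≡.refl
  any-map-suc j (t ∷ l) = ≡.cong ((t ≡ᵇ j) ∨_) (any-map-suc j l)

  any-1 : ∀ x l → any 1 (List.map (suc (suc x) ℕ.+_) l) ≡ false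
  any-1 x []      = ≡.refl
  any-1 x (t ∷ l) = any-1 x l

  -- Lowering the first entry by one shifts every t_j down by one, just as removing the first index
  -- does.
  marked-stay : ∀ a as j → marked (suc (suc a) ∷ as) (suc j) ≡ marked (suc a ∷ as) j
  marked-stay a as j = ≡.cong ((suc a ≡ᵇ j) ∨_) (any-suc (suc a) j (tList as))

  marked-stay-1 : ∀ a as → marked (suc (suc a) ∷ as) 1 ≡ false
  marked-stay-1 a as = any-1 a (tList as)

  -- Removing a leading 1 deletes t_1 = 1 and shifts the other t_j down by one.
  marked-drop : ∀ as j → marked (1 ∷ as) (suc (suc j)) ≡ marked as (suc j)
  marked-drop as j = any-map-suc (suc j) (tList as)

sumOneTo-suc : ∀ n f → sumOneTo (suc n) f ≡ f 1 ℤ.+ sumOneTo n (λ i → f (suc i))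
sumOneTo-suc n f = ≡.cong (λ t → f 1 ℤ.+ sumℤ t)
  (≡.trans (Listₚ.map-applyUpTo suc (λ i → f (suc i)) n) (≡.sym (Listₚ.map-upTo (λ i → f (suc (suc i))) n)))

sumOneTo-cong : ∀ n {f g} → (∀ i → f (suc i) ≡ g (suc i)) → sumOneTo n f ≡ sumOneTo n g
sumOneTo-cong n f≡g = ≡.cong sumℤ (Listₚ.map-cong f≡g (upTo n))

sumOneTo-zero : ∀ n f → (∀ i → f (suc i) ≡ + 0) → sumOneTo n f ≡ + 0
sumOneTo-zero zero    f f≡0 = ≡.refl
sumOneTo-zero (suc n) f f≡0 = ≡.trans (sumOneTo-suc n f)
  (≡.cong₂ ℤ._+_ (f≡0 0) (sumOneTo-zero n (λ i → f (suc i)) (λ i → f≡0 (suc i))))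

sumOneTo-first : ∀ n f → (∀ i → f (suc (suc i)) ≡ + 0) → sumOneTo (suc n) f ≡ f 1
sumOneTo-first n f f≡0 = ≡.trans (sumOneTo-suc n f)
  (≡.trans (≡.cong (λ t → f 1 ℤ.+ t) (sumOneTo-zero n (λ i → f (suc i)) f≡0)) (ℤₚ.+-identityʳ _))

sumOneTo-+ : ∀ n f g → sumOneTo n (λ i → f i ℤ.+ g i) ≡ sumOneTo n f ℤ.+ sumOneTo n g
sumOneTo-+ zero    f g = ≡.refl
sumOneTo-+ (suc n) f g = ≡.trans (sumOneTo-suc n (λ i → f i ℤ.+ g i))
  (≡.trans (≡.cong (λ t → f 1 ℤ.+ g 1 ℤ.+ t) (sumOneTo-+ n (λ i → f (suc i)) (λ i → g (suc i))))
  (≡.trans (ar (f 1) (g 1) _ _) (≡.sym (≡.cong₂ ℤ._+_ (sumOneTo-suc n f) (sumOneTo-suc n g)))))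
  where
  ar : ∀ a b c d → a ℤ.+ b ℤ.+ (c ℤ.+ d) ≡ (a ℤ.+ c) ℤ.+ (b ℤ.+ d)
  ar = solveℤ

-- mCm, Am, nj and prodFactor with the size d, the matrix C and the vector m decoupled: removing
-- the first row and column of Cmat changes all three at once.
quadratic : ℕ → (ℕ → ℕ → ℤ) → (ℕ → ℤ) → ℤ
quadratic d C μ = sumOneTo d (λ j → sumOneTo d (λ k → μ j ℤ.* C j k ℤ.* μ k))

linear : ℕ → (ℕ → ℤ) → ℤ
linear d μ = (+ 2) ℤ.* μ d ℤ.- (+ 2) ℤ.* μ (d ∸ 1) ℤ.+ + 1

occupation : ℕ → (ℕ → ℕ → ℤ) → ℕ → (ℕ → ℤ) → ℕ → ℤ
occupation d C L μ j = + L ℤ.* δ j 1 ℤ.- sumOneTo d (λ k → C j k ℤ.* μ k)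

factor : ℕ → (ℕ → ℕ → ℤ) → ℕ → (ℕ → ℤ) → ℕ → PS
factor d C L μ i =
  gauss ((if suc i ≡ᵇ d then + 1 else + 2) ℤ.* μ (suc i) ℤ.+ occupation d C L μ (suc i) ℤ.- δ (suc i) d)
        ((if suc i ≡ᵇ d then + 1 else + 2) ℤ.* μ (suc i) ℤ.- δ (suc (suc i)) d)

factors : ℕ → (ℕ → ℕ → ℤ) → ℕ → (ℕ → ℤ) → PS
factors d C L μ = prodPS (List.map (factor d C L μ) (upTo d))

-- C is C′ bordered by a row and a column, μ is μ′ with an entry in front. Below the corner the
-- column is (-1, 0, 0, ...) whether or not the index is marked; the entries (1,1) and (1,2) depend
-- on the mark of 1 and stay open.
record Extends (C C′ : ℕ → ℕ → ℤ) (μ μ′ : ℕ → ℤ) : Set where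
  field
    shifted-C : ∀ i k → C (suc (suc i)) (suc (suc k)) ≡ C′ (suc i) (suc k)
    column    : ∀ i → C (suc (suc i)) 1 ≡ ℤ.- δ (suc i) 1
    zeros     : ∀ k → C 1 (suc (suc (suc k))) ≡ + 0
    shifted-μ : ∀ i → μ (suc (suc i)) ≡ μ′ (suc i)

module _ {C C′ μ μ′} (ext : Extends C C′ μ μ′) where
  open Extends ext

  quadratic-extends : ∀ d → quadratic (suc (suc d)) C μ ≡
    μ 1 ℤ.* C 1 1 ℤ.* μ 1 ℤ.+ μ 1 ℤ.* C 1 2 ℤ.* μ 2 ℤ.- μ 2 ℤ.* μ 1 ℤ.+ quadratic (suc d) C′ μ′
  quadratic-extends d = begin
    sumOneTo (suc (suc d)) (λ j → sumOneTo (suc (suc d)) (e j))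
      ≡⟨ sumOneTo-suc (suc d) (λ j → sumOneTo (suc (suc d)) (e j)) ⟩
    sumOneTo (suc (suc d)) (e 1) ℤ.+ sumOneTo (suc d) (λ j → sumOneTo (suc (suc d)) (e (suc j)))
      ≡⟨ ≡.cong₂ ℤ._+_ first-row (sumOneTo-cong (suc d) {λ j → sumOneTo (suc (suc d)) (e (suc j))} {λ j → e (suc j) 1 ℤ.+ sumOneTo (suc d) (λ k → e (suc j) (suc k))} (λ i → sumOneTo-suc (suc d) (e (suc (suc i))))) ⟩
    (e 1 1 ℤ.+ e 1 2) ℤ.+ sumOneTo (suc d) (λ j → e (suc j) 1 ℤ.+ sumOneTo (suc d) (λ k → e (suc j) (suc k)))
      ≡⟨ ≡.cong (λ t → (e 1 1 ℤ.+ e 1 2) ℤ.+ t) (sumOneTo-+ (suc d) (λ j → e (suc j) 1) (λ j → sumOneTo (suc d) (λ k → e (suc j) (suc k)))) ⟩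
    (e 1 1 ℤ.+ e 1 2) ℤ.+ (sumOneTo (suc d) (λ j → e (suc j) 1) ℤ.+ sumOneTo (suc d) (λ j → sumOneTo (suc d) (λ k → e (suc j) (suc k))))
      ≡⟨ ≡.cong₂ (λ s t → (e 1 1 ℤ.+ e 1 2) ℤ.+ (s ℤ.+ t)) first-column inner ⟩
    (e 1 1 ℤ.+ e 1 2) ℤ.+ (ℤ.- (μ 2 ℤ.* μ 1) ℤ.+ quadratic (suc d) C′ μ′)
      ≡⟨ ≡.sym (ℤₚ.+-assoc (e 1 1 ℤ.+ e 1 2) (ℤ.- (μ 2 ℤ.* μ 1)) _) ⟩
    e 1 1 ℤ.+ e 1 2 ℤ.- μ 2 ℤ.* μ 1 ℤ.+ quadratic (suc d) C′ μ′ ∎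
    where
    open ≡.≡-Reasoning
    e : ℕ → ℕ → ℤ
    e j k = μ j ℤ.* C j k ℤ.* μ k
    first-row : sumOneTo (suc (suc d)) (e 1) ≡ e 1 1 ℤ.+ e 1 2
    first-row = ≡.trans (sumOneTo-suc (suc d) (e 1)) (≡.cong (λ t → e 1 1 ℤ.+ t)
      (sumOneTo-first d (λ k → e 1 (suc k)) λ k → ≡.trans (≡.cong (λ t → μ 1 ℤ.* t ℤ.* μ (suc (suc (suc k)))) (zeros k))
        (≡.cong (ℤ._* μ (suc (suc (suc k)))) (ℤₚ.*-zeroʳ (μ 1)))))
    ar : ∀ x y → x ℤ.* (ℤ.- (+ 1)) ℤ.* y ≡ ℤ.- (x ℤ.* y)
    ar = solveℤ
    first-column : sumOneTo (suc d) (λ j → e (suc j) 1) ≡ ℤ.- (μ 2 ℤ.* μ 1)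
    first-column = ≡.trans (sumOneTo-first d (λ j → e (suc j) 1) λ i →
        ≡.trans (≡.cong (λ t → μ (suc (suc (suc i))) ℤ.* t ℤ.* μ 1) (column (suc i)))
          (≡.cong (ℤ._* μ 1) (ℤₚ.*-zeroʳ (μ (suc (suc (suc i)))))))
      (≡.trans (≡.cong (λ t → μ 2 ℤ.* t ℤ.* μ 1) (column 0)) (ar (μ 2) (μ 1)))
    inner : sumOneTo (suc d) (λ j → sumOneTo (suc d) (λ k → e (suc j) (suc k))) ≡ quadratic (suc d) C′ μ′
    inner = sumOneTo-cong (suc d) {λ j → sumOneTo (suc d) (λ k → e (suc j) (suc k))} {λ j → sumOneTo (suc d) (λ k → μ′ j ℤ.* C′ j k ℤ.* μ′ k)}
      λ i → sumOneTo-cong (suc d) {λ k → e (suc (suc i)) (suc k)} {λ k → μ′ (suc i) ℤ.* C′ (suc i) k ℤ.* μ′ k} λ k →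
      ≡.cong₂ ℤ._*_ (≡.cong₂ ℤ._*_ (shifted-μ i) (shifted-C i k)) (shifted-μ k)

  -- L enters n_1 only, and the entry C_{2,1} = -1 contributes + m_1 to n_2; hence m_1 is the L of
  -- the smaller matrix.
  occupation-extends : ∀ d L m₁ → μ 1 ≡ + m₁ → ∀ i →
    occupation (suc d) C L μ (suc (suc i)) ≡ occupation d C′ m₁ μ′ (suc i)
  occupation-extends d L m₁ μ1≡ i = begin
    + L ℤ.* + 0 ℤ.- sumOneTo (suc d) (λ k → C (suc (suc i)) k ℤ.* μ k)
      ≡⟨ ≡.cong (λ t → + L ℤ.* + 0 ℤ.- t) (sumOneTo-suc d (λ k → C (suc (suc i)) k ℤ.* μ k)) ⟩
    + L ℤ.* + 0 ℤ.- (C (suc (suc i)) 1 ℤ.* μ 1 ℤ.+ sumOneTo d (λ k → C (suc (suc i)) (suc k) ℤ.* μ (suc k)))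
      ≡⟨ ≡.cong₂ (λ s t → + L ℤ.* + 0 ℤ.- (s ℤ.+ t)) (≡.cong₂ ℤ._*_ (column i) μ1≡)
           (sumOneTo-cong d {λ k → C (suc (suc i)) (suc k) ℤ.* μ (suc k)} {λ k → C′ (suc i) k ℤ.* μ′ k} λ k → ≡.cong₂ ℤ._*_ (shifted-C i k) (shifted-μ k)) ⟩
    + L ℤ.* + 0 ℤ.- (ℤ.- δ (suc i) 1 ℤ.* + m₁ ℤ.+ sumOneTo d (λ k → C′ (suc i) k ℤ.* μ′ k))
      ≡⟨ ar (+ L) (δ (suc i) 1) (+ m₁) _ ⟩
    occupation d C′ m₁ μ′ (suc i) ∎
    where
    open ≡.≡-Reasoning
    ar : ∀ L e m s → L ℤ.* + 0 ℤ.- (ℤ.- e ℤ.* m ℤ.+ s) ≡ m ℤ.* e ℤ.- s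
    ar = solveℤ

  occupation-1 : ∀ d L → occupation (suc (suc d)) C L μ 1 ≡ + L ℤ.- (C 1 1 ℤ.* μ 1 ℤ.+ C 1 2 ℤ.* μ 2)
  occupation-1 d L = ≡.cong₂ ℤ._-_ (ℤₚ.*-identityʳ (+ L))
    (≡.trans (sumOneTo-suc (suc d) (λ k → C 1 k ℤ.* μ k)) (≡.cong (λ t → C 1 1 ℤ.* μ 1 ℤ.+ t)
      (sumOneTo-first d (λ k → C 1 (suc k) ℤ.* μ (suc k)) λ k → ≡.cong (ℤ._* μ (suc (suc (suc k)))) (zeros k))))

  -- The size is at least 3, so the corrections at the indices d and d - 1 do not touch j = 1 and
  -- the lower entry is just 2 m_1.
  factors-extends : ∀ d L m₁ n → μ 1 ≡ + m₁ → + 2 ℤ.* μ 1 ℤ.+ (+ L ℤ.- (C 1 1 ℤ.* μ 1 ℤ.+ C 1 2 ℤ.* μ 2)) ≡ n →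
    factors (suc (suc (suc d))) C L μ ≗ (gauss n (+ (2 ℕ.* m₁)) *PS factors (suc (suc d)) C′ m₁ μ′)
  factors-extends d L m₁ n μ1≡ n≡ = P.reflexive
    (≡.cong prodPS (≡.trans (Listₚ.map-upTo f (suc (suc (suc d))))
      (≡.cong₂ _∷_ head (≡.trans (≡.sym (Listₚ.map-upTo (f ∘ suc) (suc (suc d)))) (Listₚ.map-cong rest (upTo (suc (suc d))))))))
    where
    f = factor (suc (suc (suc d))) C L μ
    ar : ∀ x y → x ℤ.+ y ℤ.- + 0 ≡ x ℤ.+ y
    ar = solveℤ
    head : f 0 ≡ gauss n (+ (2 ℕ.* m₁))
    head = ≡.cong₂ gauss
      (≡.trans (≡.cong (λ t → + 2 ℤ.* μ 1 ℤ.+ t ℤ.- + 0) (occupation-1 (suc d) L)) (≡.trans (ar (+ 2 ℤ.* μ 1) _) n≡))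
      (≡.trans (ℤₚ.+-identityʳ _) (≡.trans (≡.cong (+ 2 ℤ.*_) μ1≡) (≡.sym (ℤₚ.pos-* 2 m₁))))
    rest : ∀ i → f (suc i) ≡ factor (suc (suc d)) C′ m₁ μ′ i
    rest i = ≡.cong₂ (λ x y → gauss ((if suc i ≡ᵇ suc (suc d) then + 1 else + 2) ℤ.* x ℤ.+ y ℤ.- δ (suc i) (suc (suc d)))
                                    ((if suc i ≡ᵇ suc (suc d) then + 1 else + 2) ℤ.* x ℤ.- δ (suc (suc i)) (suc (suc d))))
      (shifted-μ i) (occupation-extends (suc (suc d)) L m₁ μ1≡ i)

entry : List ℕ → ℕ → ℤ
entry m j = + mAt m j

private
  entry-drop : ∀ m i → entry m (suc (suc i)) ≡ entry (List.drop 1 m) (suc i)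
  entry-drop []      i = ≡.refl
  entry-drop (x ∷ m) i = ≡.refl

  row-zeros : ∀ r k → (+ 2) ℤ.* δ 1 (suc (suc (suc k))) ℤ.- row r 1 (suc (suc (suc k))) ≡ + 0
  row-zeros false k = ≡.refl
  row-zeros true  k = ≡.refl

  row-column : ∀ r i → (+ 2) ℤ.* δ (suc (suc i)) 1 ℤ.- row r (suc (suc i)) 1 ≡ ℤ.- δ (suc i) 1
  row-column false zero    = ≡.refl
  row-column false (suc i) = ≡.refl
  row-column true  zero    = ≡.refl
  row-column true  (suc i) = ≡.refl

  extends : ∀ as as′ m → (∀ i → marked as (suc (suc i)) ≡ marked as′ (suc i)) →
    Extends (Cmat as) (Cmat as′) (entry m) (entry (List.drop 1 m))
  extends as as′ m marked≡ = record
    { shifted-C = λ i k → ≡.trans (Cmat-row as (suc (suc i)) (suc (suc k)))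
        (≡.trans (≡.cong (λ r → (+ 2) ℤ.* δ (suc i) (suc k) ℤ.- row r (suc (suc i)) (suc (suc k))) (marked≡ i))
        (≡.trans (row-suc (marked as′ (suc i)) i k) (≡.sym (Cmat-row as′ (suc i) (suc k)))))
    ; column = λ i → ≡.trans (Cmat-row as (suc (suc i)) 1) (row-column (marked as (suc (suc i))) i)
    ; zeros = λ k → ≡.trans (Cmat-row as 1 (suc (suc (suc k)))) (row-zeros (marked as 1) k)
    ; shifted-μ = entry-drop m }
    where
    row-suc : ∀ r i k → (+ 2) ℤ.* δ (suc i) (suc k) ℤ.- row r (suc (suc i)) (suc (suc k))
                      ≡ (+ 2) ℤ.* δ (suc i) (suc k) ℤ.- row r (suc i) (suc k)
    row-suc false i k = ≡.refl
    row-suc true  i k = ≡.refl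

dOf-CF : ∀ {as} → CF as → ∃ λ d → dOf as ≡ suc (suc d)
dOf-CF two      = 0 , ≡.refl
dOf-CF (stay c) = let d , eq = dOf-CF c in suc d , ≡.cong suc eq
dOf-CF (drop c) = let d , eq = dOf-CF c in suc d , ≡.cong suc eq

private
  -- Yields C_{11} = 2 and C_{12} = -1: as t_1 ≥ 2, the index 1 is unmarked.
  corner-stay : ∀ a as k → Cmat (suc (suc a) ∷ as) 1 k ≡ (+ 2) ℤ.* δ 1 k ℤ.- (δ 1 (suc k) ℤ.+ δ 2 k)
  corner-stay a as k = ≡.trans (Cmat-row (suc (suc a) ∷ as) 1 k)
    (≡.cong (λ r → (+ 2) ℤ.* δ 1 k ℤ.- row r 1 k) (marked-stay-1 a as))

  -- Yields C_{11} = C_{12} = 1: here t_1 = 1 is marked.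
  corner-drop : ∀ as k → Cmat (1 ∷ as) 1 k ≡ (+ 2) ℤ.* δ 1 k ℤ.- (δ 1 (suc k) ℤ.+ δ 1 k ℤ.- δ 2 k)
  corner-drop as k = Cmat-row (1 ∷ as) 1 k

  exponent-step : ∀ as as′ L m d → dOf as ≡ suc (suc (suc d)) → dOf as′ ≡ suc (suc d) →
    (∀ i → marked as (suc (suc i)) ≡ marked as′ (suc i)) →
    let x = entry m 1 ; y = entry m 2 ; m′ = List.drop 1 m in
    mCm as L m ℤ.+ Am as L m ≡
      (x ℤ.* Cmat as 1 1 ℤ.* x ℤ.+ x ℤ.* Cmat as 1 2 ℤ.* y ℤ.- y ℤ.* x) ℤ.+ (mCm as′ (mAt m 1) m′ ℤ.+ Am as′ (mAt m 1) m′)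
  exponent-step as as′ L m d dOf≡ dOf′≡ marked≡ = begin
    quadratic (dOf as) (Cmat as) (entry m) ℤ.+ linear (dOf as) (entry m)
      ≡⟨ ≡.cong (λ d → quadratic d (Cmat as) (entry m) ℤ.+ linear d (entry m)) dOf≡ ⟩
    quadratic (suc (suc (suc d))) (Cmat as) (entry m) ℤ.+ linear (suc (suc (suc d))) (entry m)
      ≡⟨ ≡.cong₂ ℤ._+_ (quadratic-extends (extends as as′ m marked≡) (suc d))
           (≡.cong₂ (λ s t → (+ 2) ℤ.* s ℤ.- (+ 2) ℤ.* t ℤ.+ + 1) (entry-drop m (suc d)) (entry-drop m d)) ⟩
    head ℤ.+ quadratic (suc (suc d)) (Cmat as′) (entry m′) ℤ.+ linear (suc (suc d)) (entry m′)
      ≡⟨ ℤₚ.+-assoc head _ _ ⟩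
    head ℤ.+ (quadratic (suc (suc d)) (Cmat as′) (entry m′) ℤ.+ linear (suc (suc d)) (entry m′))
      ≡⟨ ≡.cong (λ d → head ℤ.+ (quadratic d (Cmat as′) (entry m′) ℤ.+ linear d (entry m′))) (≡.sym dOf′≡) ⟩
    head ℤ.+ (quadratic (dOf as′) (Cmat as′) (entry m′) ℤ.+ linear (dOf as′) (entry m′)) ∎
    where
    open ≡.≡-Reasoning
    m′ = List.drop 1 m
    head = entry m 1 ℤ.* Cmat as 1 1 ℤ.* entry m 1 ℤ.+ entry m 1 ℤ.* Cmat as 1 2 ℤ.* entry m 2 ℤ.- entry m 2 ℤ.* entry m 1

  factors-step : ∀ as as′ L m n d → dOf as ≡ suc (suc (suc d)) → dOf as′ ≡ suc (suc d) →
    (∀ i → marked as (suc (suc i)) ≡ marked as′ (suc i)) →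
    + 2 ℤ.* entry m 1 ℤ.+ (+ L ℤ.- (Cmat as 1 1 ℤ.* entry m 1 ℤ.+ Cmat as 1 2 ℤ.* entry m 2)) ≡ n →
    prodFactor as L m ≗ (gauss n (+ (2 ℕ.* mAt m 1)) *PS prodFactor as′ (mAt m 1) (List.drop 1 m))
  factors-step as as′ L m n d dOf≡ dOf′≡ marked≡ n≡ =
    P.trans {prodFactor as L m} (P.reflexive (≡.cong (λ d → factors d (Cmat as) L (entry m)) dOf≡))
      (P.trans {factors (suc (suc (suc d))) (Cmat as) L (entry m)}
        (factors-extends (extends as as′ m marked≡) d L (mAt m 1) n ≡.refl n≡)
        (P.reflexive (≡.cong (λ d → gauss n (+ (2 ℕ.* mAt m 1)) *PS factors d (Cmat as′) (mAt m 1) (entry (List.drop 1 m))) (≡.sym dOf′≡))))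

tail-value : ∀ {as} (c : CF as) L m → let m′ = List.drop 1 m in
  mCm as L m′ ℤ.+ Am as L m′ ≡ entry m 2 ℤ.* entry m 2 ℤ.+ + tailExponent c m′
-- Squares are completed row by row. With x = m_1 and y = m_2, 2x² - 2xy + y² = x² + (x - y)² after
-- `stay`, while after `drop` the mixed terms cancel because C_{12} = 1 and C_{21} = -1. In the base
-- case the linear terms and the constant 1 of A_m complete (x - y - 1)².
exponent-tailExponent : ∀ {as} (c : CF as) L m →
  mCm as L m ℤ.+ Am as L m ≡ + (mAt m 1 ℕ.* mAt m 1 ℕ.+ tailExponent c m)
exponent-tailExponent two L m = ≡.trans (ar x y)
  (≡.cong₂ ℤ._+_ (≡.sym (ℤₚ.pos-* (mAt m 1) (mAt m 1))) (≡.sym (+sq (x ℤ.- y ℤ.- + 1))))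
  where
  x = entry m 1
  y = entry m 2
  ar : ∀ x y → (x ℤ.* + 2 ℤ.* x ℤ.+ (x ℤ.* (ℤ.- (+ 1)) ℤ.* y ℤ.+ + 0)) ℤ.+ ((y ℤ.* (ℤ.- (+ 1)) ℤ.* x ℤ.+ (y ℤ.* + 1 ℤ.* y ℤ.+ + 0)) ℤ.+ + 0)
                  ℤ.+ ((+ 2) ℤ.* y ℤ.- (+ 2) ℤ.* x ℤ.+ + 1) ≡ x ℤ.* x ℤ.+ (x ℤ.- y ℤ.- + 1) ℤ.* (x ℤ.- y ℤ.- + 1)
  ar = solveℤ
exponent-tailExponent {as} (stay {a} {as′} c) L m = begin
  mCm as L m ℤ.+ Am as L m
    ≡⟨ exponent-step as (suc a ∷ as′) L m (proj₁ d) (≡.cong suc (proj₂ d)) (proj₂ d) (λ i → marked-stay a as′ (suc i)) ⟩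
  (x ℤ.* Cmat as 1 1 ℤ.* x ℤ.+ x ℤ.* Cmat as 1 2 ℤ.* y ℤ.- y ℤ.* x) ℤ.+ rest
    ≡⟨ ≡.cong₂ (λ s t → (x ℤ.* s ℤ.* x ℤ.+ x ℤ.* t ℤ.* y ℤ.- y ℤ.* x) ℤ.+ rest)
         (corner-stay a as′ 1) (corner-stay a as′ 2) ⟩
  (x ℤ.* + 2 ℤ.* x ℤ.+ x ℤ.* (ℤ.- (+ 1)) ℤ.* y ℤ.- y ℤ.* x) ℤ.+ rest
    ≡⟨ ≡.cong (λ t → (x ℤ.* + 2 ℤ.* x ℤ.+ x ℤ.* (ℤ.- (+ 1)) ℤ.* y ℤ.- y ℤ.* x) ℤ.+ t) (tail-value c (mAt m 1) m) ⟩
  (x ℤ.* + 2 ℤ.* x ℤ.+ x ℤ.* (ℤ.- (+ 1)) ℤ.* y ℤ.- y ℤ.* x) ℤ.+ (y ℤ.* y ℤ.+ e)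
    ≡⟨ ar x y e ⟩
  x ℤ.* x ℤ.+ ((x ℤ.- y) ℤ.* (x ℤ.- y) ℤ.+ e)
    ≡⟨ ≡.cong₂ (λ s t → s ℤ.+ (t ℤ.+ e)) (≡.sym (ℤₚ.pos-* (mAt m 1) (mAt m 1))) (≡.sym (+sq (x ℤ.- y))) ⟩
  + (mAt m 1 ℕ.* mAt m 1 ℕ.+ (sq (x ℤ.- y) ℕ.+ tailExponent c m′)) ∎
  where
  open ≡.≡-Reasoning
  d = dOf-CF c
  m′ = List.drop 1 m
  rest = mCm (suc a ∷ as′) (mAt m 1) m′ ℤ.+ Am (suc a ∷ as′) (mAt m 1) m′
  x = entry m 1
  y = entry m 2
  e = + tailExponent c m′
  ar : ∀ x y e → (x ℤ.* + 2 ℤ.* x ℤ.+ x ℤ.* (ℤ.- (+ 1)) ℤ.* y ℤ.- y ℤ.* x) ℤ.+ (y ℤ.* y ℤ.+ e) ≡ x ℤ.* x ℤ.+ ((x ℤ.- y) ℤ.* (x ℤ.- y) ℤ.+ e)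
  ar = solveℤ
exponent-tailExponent {as} (drop {a} {as′} c) L m = begin
  mCm as L m ℤ.+ Am as L m
    ≡⟨ exponent-step as (suc a ∷ as′) L m (proj₁ d) (≡.cong suc (proj₂ d)) (proj₂ d) (λ i → marked-drop (suc a ∷ as′) i) ⟩
  (x ℤ.* Cmat as 1 1 ℤ.* x ℤ.+ x ℤ.* Cmat as 1 2 ℤ.* y ℤ.- y ℤ.* x) ℤ.+ rest
    ≡⟨ ≡.cong₂ (λ s t → (x ℤ.* s ℤ.* x ℤ.+ x ℤ.* t ℤ.* y ℤ.- y ℤ.* x) ℤ.+ rest)
         (corner-drop (suc a ∷ as′) 1) (corner-drop (suc a ∷ as′) 2) ⟩
  (x ℤ.* + 1 ℤ.* x ℤ.+ x ℤ.* + 1 ℤ.* y ℤ.- y ℤ.* x) ℤ.+ rest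
    ≡⟨ ≡.cong (λ t → (x ℤ.* + 1 ℤ.* x ℤ.+ x ℤ.* + 1 ℤ.* y ℤ.- y ℤ.* x) ℤ.+ t) (tail-value c (mAt m 1) m) ⟩
  (x ℤ.* + 1 ℤ.* x ℤ.+ x ℤ.* + 1 ℤ.* y ℤ.- y ℤ.* x) ℤ.+ (y ℤ.* y ℤ.+ e)
    ≡⟨ ar x y e ⟩
  x ℤ.* x ℤ.+ (y ℤ.* y ℤ.+ e)
    ≡⟨ ≡.cong₂ (λ s t → s ℤ.+ (t ℤ.+ e)) (≡.sym (ℤₚ.pos-* (mAt m 1) (mAt m 1))) (≡.sym (ℤₚ.pos-* (mAt m 2) (mAt m 2))) ⟩
  + (mAt m 1 ℕ.* mAt m 1 ℕ.+ (mAt m 2 ℕ.* mAt m 2 ℕ.+ tailExponent c m′)) ∎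
  where
  open ≡.≡-Reasoning
  d = dOf-CF c
  m′ = List.drop 1 m
  rest = mCm (suc a ∷ as′) (mAt m 1) m′ ℤ.+ Am (suc a ∷ as′) (mAt m 1) m′
  x = entry m 1
  y = entry m 2
  e = + tailExponent c m′
  ar : ∀ x y e → (x ℤ.* + 1 ℤ.* x ℤ.+ x ℤ.* + 1 ℤ.* y ℤ.- y ℤ.* x) ℤ.+ (y ℤ.* y ℤ.+ e) ≡ x ℤ.* x ℤ.+ (y ℤ.* y ℤ.+ e)
  ar = solveℤ

tail-value c L m = ≡.trans (exponent-tailExponent c L m′)
  (≡.cong (λ t → t ℤ.+ + tailExponent c m′) (≡.trans (ℤₚ.pos-* (mAt m′ 1) (mAt m′ 1))
    (≡.cong (λ t → t ℤ.* t) (≡.sym (entry-drop m 0)))))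
  where m′ = List.drop 1 m

gauss-* : ∀ n k {f g} → f ≗ g → (gauss n k *PS f) ≗ (binomℤ n k *PS g)
gauss-* n k {f} {g} f≗g = P.*-cong {gauss n k} {binomℤ n k} {f} {g} (gauss-binomℤ n k) f≗g

-- The first upper entry 2 m_1 + n_1 equals L + (2 - C_{11}) m_1 - C_{12} m_2, which is L + m_2 for
-- an unmarked and L + m_1 - m_2 for a marked first index.
prodFactor-tailProduct : ∀ {as} (c : CF as) L m → prodFactor as L m ≗ tailProduct c L m
prodFactor-tailProduct two L m = P.*-cong {gauss n₁ k₁} {binomℤ (+ (L ℕ.+ mAt m 2)) (+ (2 ℕ.* mAt m 1) ℤ.- + 1)}
    {gauss n₂ k₂ *PS onePS} {binomℤ (x ℤ.- + 1) y}
  (P.trans {gauss n₁ k₁} (gauss-binomℤ n₁ k₁) (binomℤ-cong (ar₁ (+ L) x y) (≡.cong (ℤ._- + 1) (≡.sym (ℤₚ.pos-* 2 (mAt m 1))))))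
  (P.trans {gauss n₂ k₂ *PS onePS} (P.*-identityʳ (gauss n₂ k₂))
    (P.trans {gauss n₂ k₂} (gauss-binomℤ n₂ k₂) (binomℤ-cong (ar₂ (+ L) x y) (ar₃ y))))
  where
  x = entry m 1
  y = entry m 2
  n₁ = + 2 ℤ.* x ℤ.+ (+ L ℤ.* + 1 ℤ.- (+ 2 ℤ.* x ℤ.+ ((ℤ.- (+ 1)) ℤ.* y ℤ.+ + 0))) ℤ.- + 0
  k₁ = + 2 ℤ.* x ℤ.- + 1
  n₂ = + 1 ℤ.* y ℤ.+ (+ L ℤ.* + 0 ℤ.- ((ℤ.- (+ 1)) ℤ.* x ℤ.+ (+ 1 ℤ.* y ℤ.+ + 0))) ℤ.- + 1
  k₂ = + 1 ℤ.* y ℤ.- + 0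
  ar₁ : ∀ L x y → + 2 ℤ.* x ℤ.+ (L ℤ.* + 1 ℤ.- (+ 2 ℤ.* x ℤ.+ ((ℤ.- (+ 1)) ℤ.* y ℤ.+ + 0))) ℤ.- + 0 ≡ L ℤ.+ y
  ar₁ = solveℤ
  ar₂ : ∀ L x y → + 1 ℤ.* y ℤ.+ (L ℤ.* + 0 ℤ.- ((ℤ.- (+ 1)) ℤ.* x ℤ.+ (+ 1 ℤ.* y ℤ.+ + 0))) ℤ.- + 1 ≡ x ℤ.- + 1
  ar₂ = solveℤ
  ar₃ : ∀ y → + 1 ℤ.* y ℤ.- + 0 ≡ y
  ar₃ = solveℤ
prodFactor-tailProduct {as} (stay {a} {as′} c) L m = P.trans {prodFactor as L m}
  (factors-step as (suc a ∷ as′) L m (+ (L ℕ.+ mAt m 2)) (proj₁ d) (≡.cong suc (proj₂ d)) (proj₂ d) (λ i → marked-stay a as′ (suc i))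
    (≡.trans (≡.cong₂ (λ s t → + 2 ℤ.* x ℤ.+ (+ L ℤ.- (s ℤ.* x ℤ.+ t ℤ.* y))) (corner-stay a as′ 1) (corner-stay a as′ 2)) (ar (+ L) x y)))
  (gauss-* (+ (L ℕ.+ mAt m 2)) (+ (2 ℕ.* mAt m 1)) {prodFactor (suc a ∷ as′) (mAt m 1) (List.drop 1 m)}
    {tailProduct c (mAt m 1) (List.drop 1 m)} (prodFactor-tailProduct c (mAt m 1) (List.drop 1 m)))
  where
  d = dOf-CF c
  x = entry m 1
  y = entry m 2
  ar : ∀ L x y → + 2 ℤ.* x ℤ.+ (L ℤ.- (+ 2 ℤ.* x ℤ.+ (ℤ.- (+ 1)) ℤ.* y)) ≡ L ℤ.+ y
  ar = solveℤ
prodFactor-tailProduct {as} (drop {a} {as′} c) L m = P.trans {prodFactor as L m}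
  (factors-step as (suc a ∷ as′) L m (+ (L ℕ.+ mAt m 1) ℤ.- y) (proj₁ d) (≡.cong suc (proj₂ d)) (proj₂ d) (λ i → marked-drop (suc a ∷ as′) i)
    (≡.trans (≡.cong₂ (λ s t → + 2 ℤ.* x ℤ.+ (+ L ℤ.- (s ℤ.* x ℤ.+ t ℤ.* y))) (corner-drop (suc a ∷ as′) 1) (corner-drop (suc a ∷ as′) 2)) (ar (+ L) x y)))
  (gauss-* (+ (L ℕ.+ mAt m 1) ℤ.- y) (+ (2 ℕ.* mAt m 1)) {prodFactor (suc a ∷ as′) (mAt m 1) (List.drop 1 m)}
    {tailProduct c (mAt m 1) (List.drop 1 m)} (prodFactor-tailProduct c (mAt m 1) (List.drop 1 m)))
  where
  d = dOf-CF c
  x = entry m 1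
  y = entry m 2
  ar : ∀ L x y → + 2 ℤ.* x ℤ.+ (L ℤ.- (+ 1 ℤ.* x ℤ.+ + 1 ℤ.* y)) ≡ L ℤ.+ x ℤ.- y
  ar = solveℤ

-- Continued fractions and their convergents

build : ∀ k {as} → CF (suc (suc zero) ∷ as) ⊎ CF (1 ∷ as) → CF (suc (suc k) ∷ as)
build zero    (inj₁ c) = c
build zero    (inj₂ c) = stay c
build (suc k) c        = stay (build k c)

toCF : ∀ {n} (as : Vec ℕ (suc n)) → (∀ x → x ∈ toList as → 1 ≤ x) → 2 ≤ last as → CF (toList as)
toCF (zero ∷ as)             pos _ = ⊥-elim (ℕₚ.1+n≰n (pos 0 (here ≡.refl)))
toCF (suc zero ∷ [])         _   (s≤s ())
toCF (suc (suc k) ∷ [])      _   _ = build k (inj₁ two)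
toCF (suc x ∷ zero ∷ as)     pos _ = ⊥-elim (ℕₚ.1+n≰n (pos 0 (there (here ≡.refl))))
toCF (suc zero ∷ suc y ∷ as) pos l = drop (toCF (suc y ∷ as) (λ x x∈ → pos x (there x∈)) l)
toCF (suc (suc k) ∷ suc y ∷ as) pos l = build k (inj₂ (drop (toCF (suc y ∷ as) (λ x x∈ → pos x (there x∈)) l)))

open Params

private
  rearrange : ∀ P y Q → P ℕ.+ y ℕ.+ Q ℕ.+ P ≡ P ℕ.+ (P ℕ.+ y) ℕ.+ Q
  rearrange = solveℕ

params-cfEval : ∀ {as} (c : CF as) → (a (paramsOf c) , b (paramsOf c)) ≡ cfEval as
params-cfEval two = ≡.refl
params-cfEval (stay {x} {as} c) with cfEval as | params-cfEval c
... | P , Q | eq = ≡.trans (≡.cong (λ t → proj₁ t ℕ.+ proj₂ t , proj₂ t) eq)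
                     (≡.cong (_, P) (rearrange P (x ℕ.* P) Q))
params-cfEval (drop {x} {as} c) with cfEval as | params-cfEval c
... | P , Q | eq = ≡.trans (≡.cong (λ t → proj₁ t ℕ.+ proj₂ t , proj₁ t) eq)
                     (≡.cong (λ t → t ℕ.+ P , suc x ℕ.* P ℕ.+ Q) (≡.sym (ℕₚ.+-identityʳ (suc x ℕ.* P ℕ.+ Q))))

-- The steps act on (ā, b̄) as they act on the value of the list without its last entry, and the
-- start (1, 0) is the value 1/0 of the empty list.
bars-cfEval : ∀ {n} (as : Vec ℕ (suc n)) (c : CF (toList as)) →
  (ā (paramsOf c) , b̄ (paramsOf c)) ≡ cfEval (toList (init as))
bars-cfEval (x ∷ []) two = ≡.refl
bars-cfEval (suc (suc x) ∷ []) (stay c) with bars-cfEval (suc x ∷ []) c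
... | eq = ≡.cong (λ t → proj₁ t ℕ.+ proj₂ t , proj₂ t) eq
bars-cfEval (suc (suc x) ∷ y ∷ as) (stay c) with cfEval (toList (init (y ∷ as))) | bars-cfEval (suc x ∷ y ∷ as) c
... | P , Q | eq = ≡.trans (≡.cong (λ t → proj₁ t ℕ.+ proj₂ t , proj₂ t) eq)
                     (≡.cong (_, P) (rearrange P (x ℕ.* P) Q))
bars-cfEval (1 ∷ suc y ∷ as) (drop c) with cfEval (toList (init (suc y ∷ as))) | bars-cfEval (suc y ∷ as) c
... | P , Q | eq = ≡.trans (≡.cong (λ t → proj₁ t ℕ.+ proj₂ t , proj₁ t) eq)
                     (≡.cong (λ t → t ℕ.+ Q , P) (≡.sym (ℕₚ.+-identityʳ P)))

coprime-sum : ∀ {m n} → Coprime m n → Coprime (m ℕ.+ n) m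
coprime-sum c = coprime-+ (Coprimality.sym c)

coprime-sum′ : ∀ {m n} → Coprime m n → Coprime (m ℕ.+ n) n
coprime-sum′ {m} {n} c = ≡.subst (λ k → Coprime k n) (ℕₚ.+-comm n m) (coprime-+ c)

coprime-params : ∀ {as} (c : CF as) → Coprime (a (paramsOf c)) (b (paramsOf c))
coprime-params two      (_ , d∣1) = ∣1⇒≡1 d∣1
coprime-params (stay c) = coprime-sum′ (coprime-params c)
coprime-params (drop c) = coprime-sum (coprime-params c)

coprime-bars : ∀ {as} (c : CF as) → Coprime (ā (paramsOf c)) (b̄ (paramsOf c))
coprime-bars two      (d∣1 , _) = ∣1⇒≡1 d∣1
coprime-bars (stay c) = coprime-sum′ (coprime-bars c)
coprime-bars (drop c) = coprime-sum (coprime-bars c)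

2≤a : ∀ {as} (c : CF as) → 2 ≤ a (paramsOf c)
2≤a two      = ℕₚ.≤-refl
2≤a (stay c) = ℕₚ.≤-trans (2≤a c) (ℕₚ.m≤m+n _ _)
2≤a (drop c) = ℕₚ.≤-trans (2≤a c) (ℕₚ.m≤m+n _ _)

1≤b : ∀ {as} (c : CF as) → 1 ≤ b (paramsOf c)
1≤b two      = ℕₚ.≤-refl
1≤b (stay c) = 1≤b c
1≤b (drop c) = ℕₚ.≤-trans (ℕₚ.n≤1+n 1) (2≤a c)

b≤a : ∀ {as} (c : CF as) → b (paramsOf c) ≤ a (paramsOf c)
b≤a two      = s≤s z≤n
b≤a (stay c) = ℕₚ.m≤n+m _ _
b≤a (drop c) = ℕₚ.m≤m+n _ _

-- A `drop` makes b at least 2 for good, so b = 1 means that only `stay` has occurred, and `stay`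
-- fixes (1, 0).
bars-b≡1 : ∀ {as} (c : CF as) → b (paramsOf c) ≡ 1 → ā (paramsOf c) ≡ 1 × b̄ (paramsOf c) ≡ 0
bars-b≡1 two      _   = ≡.refl , ≡.refl
bars-b≡1 (stay c) b≡1 with bars-b≡1 c b≡1
... | ā≡1 , b̄≡0 = ≡.cong₂ ℕ._+_ ā≡1 b̄≡0 , b̄≡0
bars-b≡1 (drop c) a≡1 = contradiction (≡.subst (2 ≤_) a≡1 (2≤a c)) ℕₚ.1+n≰n

b≡1 : ∀ {x} (c : CF (x ∷ [])) → b (paramsOf c) ≡ 1
b≡1 two      = ≡.refl
b≡1 (stay c) = b≡1 c

fraction-unique : ∀ {m n k l} → Coprime m n → Coprime k l → m ℕ.* l ≡ k ℕ.* n → m ≡ k × n ≡ l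
fraction-unique {m} {n} {k} {l} m⊥n k⊥l eq =
  ∣-antisym (coprime-divisor m⊥n (divides l (≡.trans (ℕₚ.*-comm n k) (≡.trans (≡.sym eq) (ℕₚ.*-comm m l)))))
            (coprime-divisor k⊥l (divides n (≡.trans (ℕₚ.*-comm l m) (≡.trans eq (ℕₚ.*-comm k n))))) ,
  ∣-antisym (coprime-divisor (Coprimality.sym m⊥n) (divides k eq))
            (coprime-divisor (Coprimality.sym k⊥l) (divides m (≡.sym eq)))

-- The exponent of q on the left-hand side

isEven : ℕ → Bool
isEven zero    = true
isEven (suc n) = not (isEven n)

private
  isEven-+2 : ∀ n → isEven (2 ℕ.+ n) ≡ isEven n
  isEven-+2 n with isEven n
  ... | true  = ≡.refl
  ... | false = ≡.refl

2∣⇒isEven : ∀ {n} → 2 ∣ n → isEven n ≡ true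
2∣⇒isEven (divides zero    ≡.refl) = ≡.refl
2∣⇒isEven (divides (suc k) ≡.refl) = ≡.trans (isEven-+2 (k ℕ.* 2)) (2∣⇒isEven (divides k ≡.refl))

isEven⇒2∣ : ∀ n → isEven n ≡ true → 2 ∣ n
isEven⇒2∣ zero          _ = divides 0 ≡.refl
isEven⇒2∣ (suc (suc n)) e = ∣m∣n⇒∣m+n ∣-refl (isEven⇒2∣ n (≡.trans (≡.sym (isEven-+2 n)) e))

¬2∣⇒isOdd : ∀ {n} → ¬ (2 ∣ n) → isEven n ≡ false
¬2∣⇒isOdd {n} ¬2∣n with isEven n in eq
... | true  = contradiction (isEven⇒2∣ n eq) ¬2∣n
... | false = ≡.refl

-- Half the linear coefficient of the exponent, beyond the triangular number:
-- E j = a b j² + slope j + j (j + 1) / 2 + ā b̄.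
slope : ∀ {as} → CF as → ℕ
slope two      = 0
slope (stay c) = slope c ℕ.+ 2 ℕ.* (b (paramsOf c) ℕ.* b̄ (paramsOf c))
slope (drop c) = slope c ℕ.+ 2 ℕ.* (a (paramsOf c) ℕ.* ā (paramsOf c))

slopeBy : Bool → Params → ℕ
slopeBy true  P = 2 ℕ.* (a P ℕ.* b̄ P)
slopeBy false P = 2 ℕ.* (ā P ℕ.* b P)

-- The new product ā b is (ā + b̄) a = a b̄ + a ā, and the new a b̄ is (a + b) ā = ā b + a ā: the
-- two products exchange roles, so the parity flips. Under `step₂` each product keeps its role.
slopeBy-step₁ : ∀ e P → slopeBy e P ℕ.+ 2 ℕ.* (a P ℕ.* ā P) ≡ slopeBy (not e) (step₁ P)
slopeBy-step₁ true  P = ar (a P) (ā P) (b̄ P)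
  where
  ar : ∀ a ā b̄ → 2 ℕ.* (a ℕ.* b̄) ℕ.+ 2 ℕ.* (a ℕ.* ā) ≡ 2 ℕ.* ((ā ℕ.+ b̄) ℕ.* a)
  ar = solveℕ
slopeBy-step₁ false P = ar (a P) (b P) (ā P)
  where
  ar : ∀ a b ā → 2 ℕ.* (ā ℕ.* b) ℕ.+ 2 ℕ.* (a ℕ.* ā) ≡ 2 ℕ.* ((a ℕ.+ b) ℕ.* ā)
  ar = solveℕ

slopeBy-step₂ : ∀ e P → slopeBy e P ℕ.+ 2 ℕ.* (b P ℕ.* b̄ P) ≡ slopeBy e (step₂ P)
slopeBy-step₂ true  P = ar (a P) (b P) (b̄ P)
  where
  ar : ∀ a b b̄ → 2 ℕ.* (a ℕ.* b̄) ℕ.+ 2 ℕ.* (b ℕ.* b̄) ≡ 2 ℕ.* ((a ℕ.+ b) ℕ.* b̄)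
  ar = solveℕ
slopeBy-step₂ false P = ar (b P) (ā P) (b̄ P)
  where
  ar : ∀ b ā b̄ → 2 ℕ.* (ā ℕ.* b) ℕ.+ 2 ℕ.* (b ℕ.* b̄) ≡ 2 ℕ.* ((ā ℕ.+ b̄) ℕ.* b)
  ar = solveℕ

-- Each `drop` lengthens the list by one entry, so n counts the exchanges of roles.
slope-parity : ∀ {n} (as : Vec ℕ (suc n)) (c : CF (toList as)) → slope c ≡ slopeBy (isEven n) (paramsOf c)
slope-parity (x ∷ []) two = ≡.refl
slope-parity {n} (suc (suc x) ∷ as) (stay c) =
  ≡.trans (≡.cong (ℕ._+ 2 ℕ.* (b (paramsOf c) ℕ.* b̄ (paramsOf c))) (slope-parity (suc x ∷ as) c)) (slopeBy-step₂ (isEven n) (paramsOf c))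
slope-parity {suc n} (1 ∷ suc y ∷ as) (drop c) =
  ≡.trans (≡.cong (ℕ._+ 2 ℕ.* (a (paramsOf c) ℕ.* ā (paramsOf c))) (slope-parity (suc y ∷ as) c)) (slopeBy-step₁ (isEven n) (paramsOf c))

exponentFormula : Params → ℕ → ℤ → ℤ
exponentFormula P h j = + (a P ℕ.* b P) ℤ.* (j ℤ.* j) ℤ.+ + h ℤ.* j ℤ.+ + triℤ j ℤ.+ + (ā P ℕ.* b̄ P)

private
  formula-cong : ∀ t j {x x′ y y′ z z′} → x ≡ x′ → y ≡ y′ → z ≡ z′ →
    x ℤ.* (j ℤ.* j) ℤ.+ y ℤ.* j ℤ.+ t ℤ.+ z ≡ x′ ℤ.* (j ℤ.* j) ℤ.+ y′ ℤ.* j ℤ.+ t ℤ.+ z′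
  formula-cong t j ≡.refl ≡.refl ≡.refl = ≡.refl

  slope-cast : ∀ h x y → + (h ℕ.+ 2 ℕ.* (x ℕ.* y)) ≡ + h ℤ.+ + 2 ℤ.* (+ x ℤ.* + y)
  slope-cast h x y = ≡.cong (λ t → + h ℤ.+ t) (≡.trans (ℤₚ.pos-* 2 (x ℕ.* y)) (≡.cong (+ 2 ℤ.*_) (ℤₚ.pos-* x y)))

exponent-step₁ : ∀ P h → (∀ j → + E P j ≡ exponentFormula P h j) →
  ∀ j → + E (step₁ P) j ≡ exponentFormula (step₁ P) (h ℕ.+ 2 ℕ.* (a P ℕ.* ā P)) j
exponent-step₁ (params a b ā b̄ E) h eq j =
  ≡.trans (≡.cong₂ ℤ._+_ (≡.trans (eq j) (formula-cong (+ triℤ j) j {y = + h} (ℤₚ.pos-* a b) ≡.refl (ℤₚ.pos-* ā b̄)))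
                         (+sq (+ a ℤ.* j ℤ.+ + ā)))
    (≡.trans (ar (+ a) (+ b) (+ ā) (+ b̄) (+ h) (+ triℤ j) j)
      (≡.sym (formula-cong (+ triℤ j) j (ℤₚ.pos-* (a ℕ.+ b) a) (slope-cast h a ā) (ℤₚ.pos-* (ā ℕ.+ b̄) ā))))
  where
  ar : ∀ a b ā b̄ h t j → a ℤ.* b ℤ.* (j ℤ.* j) ℤ.+ h ℤ.* j ℤ.+ t ℤ.+ ā ℤ.* b̄ ℤ.+ (a ℤ.* j ℤ.+ ā) ℤ.* (a ℤ.* j ℤ.+ ā)
         ≡ (a ℤ.+ b) ℤ.* a ℤ.* (j ℤ.* j) ℤ.+ (h ℤ.+ + 2 ℤ.* (a ℤ.* ā)) ℤ.* j ℤ.+ t ℤ.+ (ā ℤ.+ b̄) ℤ.* ā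
  ar = solveℤ

exponent-step₂ : ∀ P h → (∀ j → + E P j ≡ exponentFormula P h j) →
  ∀ j → + E (step₂ P) j ≡ exponentFormula (step₂ P) (h ℕ.+ 2 ℕ.* (b P ℕ.* b̄ P)) j
exponent-step₂ (params a b ā b̄ E) h eq j =
  ≡.trans (≡.cong₂ ℤ._+_ (≡.trans (eq j) (formula-cong (+ triℤ j) j {y = + h} (ℤₚ.pos-* a b) ≡.refl (ℤₚ.pos-* ā b̄)))
                         (+sq (+ b ℤ.* j ℤ.+ + b̄)))
    (≡.trans (ar (+ a) (+ b) (+ ā) (+ b̄) (+ h) (+ triℤ j) j)
      (≡.sym (formula-cong (+ triℤ j) j (ℤₚ.pos-* (a ℕ.+ b) b) (slope-cast h b b̄) (ℤₚ.pos-* (ā ℕ.+ b̄) b̄))))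
  where
  ar : ∀ a b ā b̄ h t j → a ℤ.* b ℤ.* (j ℤ.* j) ℤ.+ h ℤ.* j ℤ.+ t ℤ.+ ā ℤ.* b̄ ℤ.+ (b ℤ.* j ℤ.+ b̄) ℤ.* (b ℤ.* j ℤ.+ b̄)
         ≡ (a ℤ.+ b) ℤ.* b ℤ.* (j ℤ.* j) ℤ.+ (h ℤ.+ + 2 ℤ.* (b ℤ.* b̄)) ℤ.* j ℤ.+ t ℤ.+ (ā ℤ.+ b̄) ℤ.* b̄
  ar = solveℤ

exponent-seed : ∀ j → + seedExponent j ≡ exponentFormula seed 0 j
exponent-seed j = ≡.trans (≡.cong (λ s → s ℤ.+ + triℤ j ℤ.+ s) (+sq j)) (ar j (+ triℤ j))
  where
  ar : ∀ j t → j ℤ.* j ℤ.+ t ℤ.+ j ℤ.* j ≡ + 2 ℤ.* (j ℤ.* j) ℤ.+ + 0 ℤ.* j ℤ.+ t ℤ.+ + 0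
  ar = solveℤ

exponent-CF : ∀ {as} (c : CF as) j → + E (paramsOf c) j ≡ exponentFormula (paramsOf c) (slope c) j
exponent-CF two      = exponent-seed
exponent-CF (stay c) = exponent-step₂ (paramsOf c) (slope c) (exponent-CF c)
exponent-CF (drop c) = exponent-step₁ (paramsOf c) (slope c) (exponent-CF c)

-- If k + k = r + 2Q with 0 ≤ r < 2, then 2(k - Q) = r forces k = Q.
[k+k]/2 : ∀ k → (k ℤ.+ k) ℤ./ + 2 ≡ k
[k+k]/2 k = ≡.sym (ℤₚ.i-j≡0⇒i≡j k Q (zero-if-small (k ℤ.- Q) (r , ℤ-DivMod.n%d<d (k ℤ.+ k) (+ 2) ,
    ≡.trans (ar₁ k Q) (≡.trans (≡.cong (ℤ._- Q ℤ.* + 2) (ℤ-DivMod.a≡a%n+[a/n]*n (k ℤ.+ k) (+ 2))) (ar₂ (+ r) Q)))))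
  where
  Q = (k ℤ.+ k) ℤ./ + 2
  r = (k ℤ.+ k) ℤ.% + 2
  ar₁ : ∀ k Q → (k ℤ.- Q) ℤ.+ (k ℤ.- Q) ≡ k ℤ.+ k ℤ.- Q ℤ.* + 2
  ar₁ = solveℤ
  ar₂ : ∀ r Q → r ℤ.+ Q ℤ.* + 2 ℤ.- Q ℤ.* + 2 ≡ r
  ar₂ = solveℤ
  zero-if-small : ∀ z → (∃ λ r → r < 2 × z ℤ.+ z ≡ + r) → z ≡ + 0
  zero-if-small (+ zero)  _ = ≡.refl
  zero-if-small (+ suc m) (_ , r<2 , ≡.refl) = contradiction r<2 (ℕₚ.≤⇒≯ (s≤s (ℕₚ.≤-trans (s≤s z≤n) (ℕₚ.m≤n+m (suc m) m))))
  zero-if-small -[1+ m ] (_ , _ , ())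

exponent-halved : ∀ P h j →
  (j ℤ.* ((+ (2 ℕ.* a P ℕ.* b P ℕ.+ 1)) ℤ.* j ℤ.+ + (2 ℕ.* h) ℤ.+ + 1)) ℤ./ (+ 2) ℤ.+ + (ā P ℕ.* b̄ P) ≡ exponentFormula P h j
exponent-halved (params a b ā b̄ _) h j = ≡.cong (ℤ._+ + (ā ℕ.* b̄)) (≡.trans (≡.cong (ℤ._/ + 2) numerator) ([k+k]/2 k))
  where
  k = + (a ℕ.* b) ℤ.* (j ℤ.* j) ℤ.+ + h ℤ.* j ℤ.+ + triℤ j
  ar₁ : ∀ ab h j → j ℤ.* ((ab ℤ.+ ab ℤ.+ + 1) ℤ.* j ℤ.+ (h ℤ.+ h) ℤ.+ + 1)
          ≡ ab ℤ.* (j ℤ.* j) ℤ.+ h ℤ.* j ℤ.+ (ab ℤ.* (j ℤ.* j) ℤ.+ h ℤ.* j) ℤ.+ (j ℤ.* j ℤ.+ j)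
  ar₁ = solveℤ
  ar₂ : ∀ x t → x ℤ.+ x ℤ.+ (t ℤ.+ t) ≡ x ℤ.+ t ℤ.+ (x ℤ.+ t)
  ar₂ = solveℤ
  ar₃ : ∀ a b → 2 ℕ.* a ℕ.* b ≡ a ℕ.* b ℕ.+ a ℕ.* b
  ar₃ = solveℕ
  ar₄ : ∀ h → 2 ℕ.* h ≡ h ℕ.+ h
  ar₄ = solveℕ
  numerator : j ℤ.* ((+ (2 ℕ.* a ℕ.* b ℕ.+ 1)) ℤ.* j ℤ.+ + (2 ℕ.* h) ℤ.+ + 1) ≡ k ℤ.+ k
  numerator = ≡.trans (≡.cong₂ (λ x y → j ℤ.* (+ (x ℕ.+ 1) ℤ.* j ℤ.+ + y ℤ.+ + 1)) (ar₃ a b) (ar₄ h))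
    (≡.trans (ar₁ (+ (a ℕ.* b)) (+ h) j)
    (≡.trans (≡.cong (λ t → x ℤ.+ x ℤ.+ t) (≡.sym (triℤ-double j))) (ar₂ x (+ triℤ j))))
    where x = + (a ℕ.* b) ℤ.* (j ℤ.* j) ℤ.+ + h ℤ.* j

-- The partial sums of the theorem

open SeedIdentity psRing psParameter using (term)
open BurgeTransform psRing psParameter using (𝓑; H₂₁; seed-identity)

calB-𝓑 : ∀ L M x y → calB L M x y ≗ 𝓑 L M x y
calB-𝓑 L M x y = gauss-* n₁ k₁ {gauss n₂ k₂} {binomℤ n₂ k₂} (gauss-binomℤ n₂ k₂)
  where
  n₁ = + L ℤ.+ + M ℤ.+ x ℤ.- y
  k₁ = + L ℤ.+ x
  n₂ = + L ℤ.+ + M ℤ.- x ℤ.+ y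
  k₂ = + L ℤ.- x

lhsPartial-lhs : ∀ P h c L M N k → (∀ j → + E P j ≡ exponentFormula P h j) → c ≡ 2 ℕ.* h →
  lhsPartial (a P) (b P) (ā P) (b̄ P) c L M N k ≡ coeff (lhs P N L M) k
lhsPartial-lhs P h c L M N k E≡ ≡.refl = ≡.trans
  (≡.cong sumℤ (Listₚ.map-cong summand (symRange N)))
  (coeff-∑ℤ N (term (E P) (pair P L M)) k)
  where
  summand : ∀ j → signPow j ℤ.* shiftCoeff ((j ℤ.* ((+ (2 ℕ.* a P ℕ.* b P ℕ.+ 1)) ℤ.* j ℤ.+ + c ℤ.+ + 1)) ℤ./ (+ 2) ℤ.+ + (ā P ℕ.* b̄ P))
                    (calB L M (line₁ P j) (line₂ P j)) k
                  ≡ coeff (term (E P) (pair P L M) j) k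
  summand j = ≡.trans
    (≡.cong (signPow j ℤ.*_) (≡.trans
      (≡.cong (λ e → shiftCoeff e (calB L M (line₁ P j) (line₂ P j)) k) (≡.trans (exponent-halved P h j) (≡.sym (E≡ j))))
      (≡.trans (shiftCoeff-coeff (E P j) (calB L M (line₁ P j) (line₂ P j)) k)
        (coeff-cong (P.*-congˡ {q^ E P j} (calB-𝓑 L M (line₁ P j) (line₂ P j))) k))))
    (signPow-coeff j ((q^ E P j) *PS pair P L M j) k)

-- Both sequences of partial sums are constant from N = L on, with the coefficient of R as common
-- value.
same-sum : ∀ P h c L M R (T : ℕ → ℤ → ℤ) → (∀ j → + E P j ≡ exponentFormula P h j) → c ≡ 2 ℕ.* h →
  (∀ N → L ≤ N → lhs P N L M ≗ R) → (∀ N k → L ≤ N → T N k ≡ coeff R k) →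
  SameSum (lhsPartial (a P) (b P) (ā P) (b̄ P) c L M) T
same-sum P h c L M R T E≡ c≡ lhs≗ T≡ k = coeff R k ,
  (L , λ N L≤N → ≡.trans (lhsPartial-lhs P h c L M N k E≡ c≡) (coeff-cong (lhs≗ N L≤N) k)) ,
  (L , λ N L≤N → T≡ N k L≤N)

<ᵇ-true : ∀ {m n} → m < n → (m ℕ.<ᵇ n) ≡ true
<ᵇ-true {m} {n} m<n with m ℕ.<ᵇ n | ℕₚ.<⇒<ᵇ m<n
... | true | _ = ≡.refl

<ᵇ-false : ∀ {m n} → n ≤ m → (m ℕ.<ᵇ n) ≡ false
<ᵇ-false {m} {n} n≤m with m ℕ.<ᵇ n in eq
... | false = ≡.refl
... | true  = contradiction (ℕₚ.<ᵇ⇒< m n (≡.subst Bool.T (≡.sym eq) _)) (ℕₚ.≤⇒≯ n≤m)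

∑box-dOf : ∀ {as} (c : CF as) N (F : List ℕ → PS) →
  ∑box (dOf as) N F ≗ ∑ (suc N) (λ i → ∑box (ℕ.pred (dOf as)) N (λ m → F (i ∷ m)))
∑box-dOf {as} c N F with dOf as | dOf-CF c
... | _ | d , ≡.refl = P.refl {∑box (suc (suc d)) N F}

coeff-box : ∀ {as} (c : CF as) L N k (n : ℕ → ℤ) (d : ℤ) (e : List ℕ → ℤ) (e′ : ℕ → ℕ) →
  (∀ m → e m ≡ + (e′ (mAt m 1) ℕ.+ tailExponent c m)) →
  sumℤ (List.map (λ m → shiftCoeff (e m) (gauss (n (mAt m 1)) d *PS prodFactor as L m) k) (box (dOf as) N))
    ≡ coeff (∑ (suc N) (λ i → ∑box (ℕ.pred (dOf as)) N (λ m →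
        (q^ (e′ i ℕ.+ tailExponent c (i ∷ m))) *PS (binomℤ (n i) d *PS tailProduct c L (i ∷ m))))) k
coeff-box {as} c L N k n d e e′ e≡ = ≡.trans (≡.cong sumℤ (Listₚ.map-cong summand (box (dOf as) N)))
  (≡.trans (coeff-∑box (dOf as) N F k) (coeff-cong (∑box-dOf c N F) k))
  where
  F : List ℕ → PS
  F m = (q^ (e′ (mAt m 1) ℕ.+ tailExponent c m)) *PS (binomℤ (n (mAt m 1)) d *PS tailProduct c L m)
  summand : ∀ m → shiftCoeff (e m) (gauss (n (mAt m 1)) d *PS prodFactor as L m) k ≡ coeff (F m) k
  summand m = ≡.trans (≡.cong (λ x → shiftCoeff x f k) (e≡ m)) (≡.trans (shiftCoeff-coeff x f k)
    (coeff-cong (P.*-congˡ {q^ x} (gauss-* (n (mAt m 1)) d {prodFactor as L m} {tailProduct c L m} (prodFactor-tailProduct c L m))) k))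
    where
    x = e′ (mAt m 1) ℕ.+ tailExponent c m
    f = gauss (n (mAt m 1)) d *PS prodFactor as L m

Hpartial-< : ∀ {as} (c : CF as) a b L M N k → a < 2 ℕ.* b → b ≢ 1 → L ≤ N →
  Hpartial a b as L M N k ≡ coeff (transform₁ (rhs c) L M) k
Hpartial-< {as} c a b L M N k a<2b b≢1 L≤N = ≡.trans unfold (≡.trans
  (coeff-box c L N k n (+ (2 ℕ.* L)) (λ m → mCm as L m ℤ.+ Am as L m) (λ i → i ℕ.* i) (exponent-tailExponent c L))
  (coeff-cong (∑box-transform₁ c N L M L≤N) k))
  where
  n : ℕ → ℤ
  n i = + (2 ℕ.* L ℕ.+ M) ℤ.- + i
  unfold : Hpartial a b as L M N k ≡ sumℤ (List.map (λ m →
    shiftCoeff (mCm as L m ℤ.+ Am as L m) (gauss (n (mAt m 1)) (+ (2 ℕ.* L)) *PS prodFactor as L m) k) (box (dOf as) N))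
  -- b ≢ 1 excludes the clause for (2, 1); the test of a against 2 is split only to let the
  -- definition reduce.
  unfold rewrite ≢⇒≡ᵇ-false b 1 b≢1 | <ᵇ-true a<2b with a ≡ᵇ 2
  ... | true  = ≡.refl
  ... | false = ≡.refl

-- L(L - 2 m_1) + m_1² = (L - m_1)² turns the exponent into the square of the second transform.
Hpartial-> : ∀ {as} (c : CF as) a b L M N k → 2 ℕ.* b ≤ a → a ≢ 2 → L ≤ N →
  Hpartial a b as L M N k ≡ coeff (transform₂ (rhs c) L M) k
Hpartial-> {as} c a b L M N k 2b≤a a≢2 L≤N = ≡.trans unfold (≡.trans
  (coeff-box c L N k n (+ (2 ℕ.* L)) e (λ i → sq (+ L ℤ.- + i)) exponent)
  (coeff-cong (∑box-transform₂ c N L M L≤N) k))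
  where
  n : ℕ → ℤ
  n i = + (L ℕ.+ M ℕ.+ i)
  e : List ℕ → ℤ
  e m = + L ℤ.* (+ L ℤ.- (+ 2) ℤ.* + mAt m 1) ℤ.+ mCm as L m ℤ.+ Am as L m
  unfold : Hpartial a b as L M N k ≡ sumℤ (List.map (λ m →
    shiftCoeff (e m) (gauss (n (mAt m 1)) (+ (2 ℕ.* L)) *PS prodFactor as L m) k) (box (dOf as) N))
  unfold rewrite ≢⇒≡ᵇ-false a 2 a≢2 | <ᵇ-false 2b≤a = ≡.refl
  ar : ∀ L x t → L ℤ.* (L ℤ.- (+ 2) ℤ.* x) ℤ.+ (x ℤ.* x ℤ.+ t) ≡ (L ℤ.- x) ℤ.* (L ℤ.- x) ℤ.+ t
  ar = solveℤ
  exponent : ∀ m → e m ≡ + (sq (+ L ℤ.- + mAt m 1) ℕ.+ tailExponent c m)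
  exponent m = ≡.trans (ℤₚ.+-assoc (+ L ℤ.* (+ L ℤ.- (+ 2) ℤ.* x)) (mCm as L m) (Am as L m))
    (≡.trans (≡.cong (λ t → + L ℤ.* (+ L ℤ.- (+ 2) ℤ.* x) ℤ.+ t) (≡.trans (exponent-tailExponent c L m)
      (≡.cong (ℤ._+ + tailExponent c m) (ℤₚ.pos-* (mAt m 1) (mAt m 1)))))
    (≡.trans (ar (+ L) x (+ tailExponent c m)) (≡.cong (ℤ._+ + tailExponent c m) (≡.sym (+sq (+ L ℤ.- x))))))
    where x = + mAt m 1

Hpartial-21 : ∀ as L M N k → L ≤ N → Hpartial 2 1 as L M N k ≡ coeff (H₂₁ L M) k
Hpartial-21 as L M N k L≤N = begin
  Hpartial 2 1 as L M N k
    ≡⟨ ≡.cong sumℤ (Listₚ.map-cong summand (upTo (suc N))) ⟩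
  sumℤ (List.map (λ i → coeff (F i) k) (upTo (suc N)))
    ≡⟨ coeff-∑ (suc N) F k ⟩
  coeff (∑ (suc N) F) k
    ≡⟨ coeff-cong (∑-change-bound (suc N) L F (λ i N<i → large i (ℕₚ.≤-trans L≤N (ℕₚ.<⇒≤ N<i))) large) k ⟩
  coeff (H₂₁ L M) k ∎
  where
  open ≡.≡-Reasoning
  n₁ n₂ : ℕ → ℤ
  n₁ i = + (2 ℕ.* L ℕ.+ M) ℤ.- + i ℤ.- + 1
  n₂ i = + L ℤ.- + 1
  F : ℕ → PS
  F i = (q^ (i ℕ.* i)) *PS (binomℤ (n₁ i) (+ (2 ℕ.* L) ℤ.- + 1) *PS binomℤ (n₂ i) (+ i))
  L-1<i : ∀ {L i} → L ≤ i → + L ℤ.- + 1 ℤ.< + i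
  L-1<i {zero}  _   = ℤ.-<+
  L-1<i {suc L} L<i = ℤ.+<+ L<i
  large : ∀ i → L ≤ i → F i ≗ zeroPS
  large i L≤i = zero-*ʳ {q^ (i ℕ.* i)} {binomℤ (n₁ i) (+ (2 ℕ.* L) ℤ.- + 1) *PS binomℤ (n₂ i) (+ i)}
    (zero-*ʳ {binomℤ (n₁ i) (+ (2 ℕ.* L) ℤ.- + 1)} {binomℤ (n₂ i) (+ i)} (binomℤ-n<k (L-1<i L≤i)))
  summand : ∀ i → shiftCoeff (+ (i ℕ.* i)) (gauss (n₁ i) (+ (2 ℕ.* L) ℤ.- + 1) *PS gauss (n₂ i) (+ i)) k ≡ coeff (F i) k
  summand i = ≡.trans (shiftCoeff-coeff (i ℕ.* i) (gauss (n₁ i) (+ (2 ℕ.* L) ℤ.- + 1) *PS gauss (n₂ i) (+ i)) k)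
    (coeff-cong (P.*-congˡ {q^ (i ℕ.* i)} (gauss-* (n₁ i) (+ (2 ℕ.* L) ℤ.- + 1) {gauss (n₂ i) (+ i)} {binomℤ (n₂ i) (+ i)}
      (gauss-binomℤ (n₂ i) (+ i)))) k)

-- Identifying the given data with the recursive parameters

cfTarget-< : ∀ {a b} → a < 2 ℕ.* b → cfTarget a b ≡ (b , a ∸ b)
cfTarget-< a<2b rewrite <ᵇ-true a<2b = ≡.refl

cfTarget-> : ∀ {a b} → 2 ℕ.* b < a → cfTarget a b ≡ (a ∸ b , b)
cfTarget-> {a} {b} 2b<a rewrite <ᵇ-false {a} {2 ℕ.* b} (ℕₚ.<⇒≤ 2b<a) | <ᵇ-true 2b<a = ≡.refl

coprime-∸ : ∀ {a b} → b ≤ a → Coprime a b → Coprime (a ∸ b) b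
coprime-∸ {a} {b} b≤a a⊥b (d∣a∸b , d∣b) = a⊥b (≡.subst (_ ∣_) (ℕₚ.m∸n+n≡m b≤a) (∣m∣n⇒∣m+n d∣a∸b d∣b) , d∣b)

record Identified (P : Params) (a b ā b̄ : ℕ) : Set where
  constructor identified
  field
    a≡ : a ≡ Params.a P
    b≡ : b ≡ Params.b P
    ā≡ : ā ≡ Params.ā P
    b̄≡ : b̄ ≡ Params.b̄ P

-- The pairs (b₀, a₀ - b₀) and (a, b) of `paramsOf c` have the same ratio and are both coprime,
-- hence equal; `step₁` then restores (a₀, b₀). The bars are compared in the same way.
identify-< : ∀ {a₀ b₀ ā₀ b̄₀ n} (as : Vec ℕ (suc n)) (c : CF (toList as)) → Coprime a₀ b₀ → b₀ < a₀ → a₀ < 2 ℕ.* b₀ →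
  IsCF a₀ b₀ n as → IsBar a₀ b₀ n as ā₀ b̄₀ → Identified (step₁ (paramsOf c)) a₀ b₀ ā₀ b̄₀
identify-< {a₀} {b₀} {ā₀} {b̄₀} {n} as c a⊥b b<a a<2b (_ , value , _) (_ , bar₂ , bar₃) = identified
  (≡.trans (≡.sym (ℕₚ.m+[n∸m]≡n (ℕₚ.<⇒≤ b<a))) (≡.sym (≡.cong₂ ℕ._+_ p≡ q≡))) (≡.sym p≡) (proj₁ bars) (proj₂ bars)
  where
  P = paramsOf c
  ratio : a P ℕ.* (a₀ ∸ b₀) ≡ b₀ ℕ.* b P
  ratio = ≡.subst₂ (λ v t → proj₁ v ℕ.* proj₂ t ≡ proj₁ t ℕ.* proj₂ v) (≡.sym (params-cfEval c)) (cfTarget-< {a₀} {b₀} a<2b) value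
  unique = fraction-unique (coprime-params c) (Coprimality.sym (coprime-∸ (ℕₚ.<⇒≤ b<a) a⊥b)) ratio
  p≡ : a P ≡ b₀
  p≡ = proj₁ unique
  q≡ : b P ≡ a₀ ∸ b₀
  q≡ = proj₂ unique
  2≤b₀ : 2 ≤ b₀
  2≤b₀ = ≡.subst (2 ≤_) p≡ (2≤a c)
  b≢1 : ¬ (b₀ ≡ 1)
  b≢1 b≡1 = ℕₚ.1+n≰n (≡.subst (2 ≤_) b≡1 2≤b₀)
  barCF-< : barCF a₀ b₀ n as ≡ 1 ∷ toList (init as)
  barCF-< rewrite <ᵇ-true a<2b = ≡.refl
  bars : ā₀ ≡ ā P ℕ.+ b̄ P × b̄₀ ≡ ā P
  bars with b₀ ℕₚ.≟ a₀ ∸ 1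
  -- b₀ = a₀ - 1 means b = 1 one step earlier. There the bars are (1, 0), which `step₁` turns into
  -- the prescribed (1, 1).
  ... | yes b≡a∸1 = ≡.trans (proj₁ one-one) (≡.sym (≡.cong₂ ℕ._+_ (proj₁ one-zero) (proj₂ one-zero))) ,
                    ≡.trans (proj₂ one-one) (≡.sym (proj₁ one-zero))
    where
    one-one = bar₂ b≢1 b≡a∸1 (ℕₚ.<-≤-trans (s≤s 2≤b₀) b<a)
    a≡1+b : a₀ ≡ 1 ℕ.+ b₀
    a≡1+b = ≡.trans (≡.sym (ℕₚ.m+[n∸m]≡n {1} (ℕₚ.≤-trans (s≤s z≤n) b<a))) (≡.cong suc (≡.sym b≡a∸1))
    one-zero = bars-b≡1 c (≡.trans q≡ (≡.trans (≡.cong (_∸ b₀) a≡1+b) (ℕₚ.m+n∸n≡m 1 b₀)))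
  ... | no b≢a∸1 = let _ , _ , ā⊥b̄ , eq = bar₃ b≢1 (λ x → b≢a∸1 (proj₁ x)) in
    fraction-unique ā⊥b̄ (coprime-sum (coprime-bars c))
      (≡.subst (λ v → ā₀ ℕ.* proj₂ v ≡ proj₁ v ℕ.* b̄₀) cfEval≡ eq)
    where
    -- Prefixing 1 to a fraction ā/b̄ gives (ā + b̄)/ā, as `step₁` does.
    cfEval≡ : cfEval (barCF a₀ b₀ n as) ≡ (ā P ℕ.+ b̄ P , ā P)
    cfEval≡ = ≡.trans (≡.cong cfEval barCF-<) (≡.trans (≡.cong (λ v → 1 ℕ.* proj₁ v ℕ.+ proj₂ v , proj₁ v) (≡.sym (bars-cfEval as c)))
      (≡.cong (λ t → t ℕ.+ b̄ P , ā P) (ℕₚ.+-identityʳ (ā P))))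

identify-> : ∀ {a₀ b₀ ā₀ b̄₀ n} (as : Vec ℕ (suc n)) (c : CF (toList as)) → Coprime a₀ b₀ → b₀ < a₀ → 2 ℕ.* b₀ < a₀ →
  IsCF a₀ b₀ n as → IsBar a₀ b₀ n as ā₀ b̄₀ → Identified (step₂ (paramsOf c)) a₀ b₀ ā₀ b̄₀
identify-> {a₀} {b₀} {ā₀} {b̄₀} {n} as c a⊥b b<a 2b<a (_ , value , _) (bar₁ , _ , bar₃) = identified
  (≡.trans (≡.sym (ℕₚ.m∸n+n≡m (ℕₚ.<⇒≤ b<a))) (≡.sym (≡.cong₂ ℕ._+_ p≡ q≡))) (≡.sym q≡) (proj₁ bars) (proj₂ bars)
  where
  P = paramsOf c
  ratio : a P ℕ.* b₀ ≡ (a₀ ∸ b₀) ℕ.* b P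
  ratio = ≡.subst₂ (λ v t → proj₁ v ℕ.* proj₂ t ≡ proj₁ t ℕ.* proj₂ v) (≡.sym (params-cfEval c)) (cfTarget-> {a₀} {b₀} 2b<a) value
  unique = fraction-unique (coprime-params c) (coprime-∸ (ℕₚ.<⇒≤ b<a) a⊥b) ratio
  p≡ : a P ≡ a₀ ∸ b₀
  p≡ = proj₁ unique
  q≡ : b P ≡ b₀
  q≡ = proj₂ unique
  cfEval-barCF : ∀ {n} (as : Vec ℕ (suc n)) (c : CF (toList as)) → b (paramsOf c) ≢ 1 → (a₀ ℕ.<ᵇ 2 ℕ.* b₀) ≡ false →
    cfEval (barCF a₀ b₀ n as) ≡ (ā (paramsOf c) ℕ.+ b̄ (paramsOf c) , b̄ (paramsOf c))
  -- For n = 0 `barCF` would produce [a_0 + 1], which is not the convergent wanted; but then b = 1,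
  -- where (1, 0) is prescribed directly.
  cfEval-barCF (x ∷ [])     c b≢1 _ = contradiction (b≡1 c) b≢1
  cfEval-barCF (x ∷ y ∷ as) c b≢1 a≮2b rewrite a≮2b with cfEval (toList (init (y ∷ as))) | bars-cfEval (x ∷ y ∷ as) c
  ... | P′ , Q′ | eq = ≡.trans (≡.cong (_, P′) (ar x P′ Q′)) (≡.cong (λ v → proj₁ v ℕ.+ proj₂ v , proj₂ v) (≡.sym eq))
    where
    ar : ∀ x P Q → (x ℕ.+ 1) ℕ.* P ℕ.+ Q ≡ x ℕ.* P ℕ.+ Q ℕ.+ P
    ar = solveℕ
  bars : ā₀ ≡ ā P ℕ.+ b̄ P × b̄₀ ≡ b̄ P
  bars with b₀ ℕₚ.≟ 1
  ... | yes b≡1′ = ≡.trans (proj₁ (bar₁ b≡1′)) (≡.sym (≡.cong₂ ℕ._+_ (proj₁ one-zero) (proj₂ one-zero))) ,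
                   ≡.trans (proj₂ (bar₁ b≡1′)) (≡.sym (proj₂ one-zero))
    where one-zero = bars-b≡1 c (≡.trans q≡ b≡1′)
  ... | no b≢1 = let _ , _ , ā⊥b̄ , eq = bar₃ b≢1 (λ x → b≢a∸1 (proj₁ x)) in
    fraction-unique ā⊥b̄ (coprime-sum′ (coprime-bars c))
      (≡.subst (λ v → ā₀ ℕ.* proj₂ v ≡ proj₁ v ℕ.* b̄₀)
        (cfEval-barCF as c (λ q≡1 → b≢1 (≡.trans (≡.sym q≡) q≡1)) (<ᵇ-false (ℕₚ.<⇒≤ 2b<a))) eq)
    where
    -- b₀ = a₀ - 1 would make a₀ - b₀ = 1 the larger entry one step earlier, which is at least 2.
    b≢a∸1 : ¬ (b₀ ≡ a₀ ∸ 1)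
    b≢a∸1 b≡a∸1 = ℕₚ.1+n≰n (≡.subst (2 ≤_) (≡.trans p≡ (≡.trans (≡.cong (_∸ b₀) a≡1+b) (ℕₚ.m+n∸n≡m 1 b₀))) (2≤a c))
      where
      a≡1+b : a₀ ≡ 1 ℕ.+ b₀
      a≡1+b = ≡.trans (≡.sym (ℕₚ.m+[n∸m]≡n {1} (ℕₚ.≤-trans (s≤s z≤n) b<a))) (≡.cong suc (≡.sym b≡a∸1))

module _ (L M : ℕ) {n} (as : Vec ℕ (suc n)) (c : CF (toList as)) {a₀ b₀ ā₀ b̄₀ : ℕ} where
  private
    ar₁ : ∀ x y → 4 ℕ.* x ℕ.* y ≡ 2 ℕ.* (2 ℕ.* (x ℕ.* y))
    ar₁ = solveℕ

  same-sum-< : ∀ x → Identified (step₁ (paramsOf c)) a₀ b₀ ā₀ b̄₀ → a₀ < 2 ℕ.* b₀ → b₀ ≢ 1 →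
    x ≡ 2 ℕ.* slopeBy (not (isEven n)) (step₁ (paramsOf c)) →
    SameSum (lhsPartial a₀ b₀ ā₀ b̄₀ x L M) (Hpartial a₀ b₀ (toList as) L M)
  same-sum-< x (identified ≡.refl ≡.refl ≡.refl ≡.refl) a<2b b≢1 x≡ =
    same-sum (step₁ (paramsOf c)) (slope c ℕ.+ 2 ℕ.* (a (paramsOf c) ℕ.* ā (paramsOf c))) x L M (transform₁ (rhs c) L M) (Hpartial a₀ b₀ (toList as) L M)
      (exponent-step₁ (paramsOf c) (slope c) (exponent-CF c))
      (≡.trans x≡ (≡.cong (2 ℕ.*_) (≡.sym (≡.trans (≡.cong (ℕ._+ 2 ℕ.* (a (paramsOf c) ℕ.* ā (paramsOf c))) (slope-parity as c))
        (slopeBy-step₁ (isEven n) (paramsOf c))))))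
      (λ N L≤N → lhs₁≈rhs₁ c N L M L≤N)
      (λ N k L≤N → Hpartial-< c a₀ b₀ L M N k a<2b b≢1 L≤N)

  same-sum-> : ∀ x → Identified (step₂ (paramsOf c)) a₀ b₀ ā₀ b̄₀ → 2 ℕ.* b₀ ≤ a₀ → a₀ ≢ 2 →
    x ≡ 2 ℕ.* slopeBy (isEven n) (step₂ (paramsOf c)) →
    SameSum (lhsPartial a₀ b₀ ā₀ b̄₀ x L M) (Hpartial a₀ b₀ (toList as) L M)
  same-sum-> x (identified ≡.refl ≡.refl ≡.refl ≡.refl) 2b≤a a≢2 x≡ =
    same-sum (step₂ (paramsOf c)) (slope c ℕ.+ 2 ℕ.* (b (paramsOf c) ℕ.* b̄ (paramsOf c))) x L M (transform₂ (rhs c) L M) (Hpartial a₀ b₀ (toList as) L M)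
      (exponent-step₂ (paramsOf c) (slope c) (exponent-CF c))
      (≡.trans x≡ (≡.cong (2 ℕ.*_) (≡.sym (≡.trans (≡.cong (ℕ._+ 2 ℕ.* (b (paramsOf c) ℕ.* b̄ (paramsOf c))) (slope-parity as c))
        (slopeBy-step₂ (isEven n) (paramsOf c))))))
      (λ N L≤N → lhs₂≈rhs₂ c N L M L≤N)
      (λ N k L≤N → Hpartial-> c a₀ b₀ L M N k 2b≤a a≢2 L≤N)

  slope-i : ∀ P → Identified P a₀ b₀ ā₀ b̄₀ → ∀ {e} → e ≡ false → 4 ℕ.* ā₀ ℕ.* b₀ ≡ 2 ℕ.* slopeBy e P
  slope-i P (identified _ ≡.refl ≡.refl _) ≡.refl = ar₁ ā₀ b₀

  slope-ii : ∀ P → Identified P a₀ b₀ ā₀ b̄₀ → ∀ {e} → e ≡ true → 4 ℕ.* a₀ ℕ.* b̄₀ ≡ 2 ℕ.* slopeBy e P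
  slope-ii P (identified ≡.refl _ _ ≡.refl) ≡.refl = ar₁ a₀ b̄₀

same-sum-21 : ∀ L M as → SameSum (lhsPartial 2 1 1 0 0 L M) (Hpartial 2 1 as L M)
same-sum-21 L M as = same-sum seed 0 0 L M (H₂₁ L M) (Hpartial 2 1 as L M) exponent-seed ≡.refl
  (λ N L≤N → seed-identity N L M L≤N) (λ N k L≤N → Hpartial-21 as L M N k L≤N)

-- b divides both entries, so the boundary a = 2b contains only (2, 1).
coprime-2b : ∀ {a b} → Coprime a b → 2 ℕ.* b ≡ a → a ≡ 2 × b ≡ 1
coprime-2b {a} {b} a⊥b ≡.refl = ≡.cong (2 ℕ.*_) b≡1′ , b≡1′
  where
  b≡1′ : b ≡ 1
  b≡1′ = a⊥b (divides 2 ≡.refl , ∣-refl)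

open import Data.Nat using (_*_)

theorem5p2 : (L M a b : ℕ) → Coprime a b → 1 ≤ b → b < a →
    (n : ℕ) (as : Vec ℕ (suc n)) → IsCF a b n as →
    (ā b̄ : ℕ) → IsBar a b n as ā b̄ →
    (((a < 2 * b × 2 ∣ n) ⊎ (2 * b < a × ¬ (2 ∣ n))) →
    SameSum (lhsPartial a b ā b̄ (4 * ā * b) L M)
    (Hpartial a b (toList as) L M))
    ×
    (((a < 2 * b × ¬ (2 ∣ n)) ⊎ (2 * b ≤ a × 2 ∣ n)) →
    SameSum (lhsPartial a b ā b̄ (4 * a * b̄) L M)
    (Hpartial a b (toList as) L M))
theorem5p2 L M a b a⊥b 1≤b b<a n as isCF ā b̄ isBar = part-i , part-ii
  where
  cf : ¬ (a ≡ 2 × b ≡ 1) → CF (toList as)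
  cf ≢21 = toCF as (proj₁ isCF) (proj₂ (proj₂ isCF) ≢21)
  <-≢21 : a < 2 ℕ.* b → ¬ (a ≡ 2 × b ≡ 1)
  <-≢21 a<2b (≡.refl , ≡.refl) = ℕₚ.1+n≰n a<2b
  <-≢1 : a < 2 ℕ.* b → b ≢ 1
  <-≢1 a<2b ≡.refl = ℕₚ.1+n≰n (ℕₚ.≤-trans a<2b b<a)
  >-≢2 : 2 ℕ.* b < a → a ≢ 2
  >-≢2 2b<a ≡.refl = ℕₚ.1+n≰n (ℕₚ.≤-trans 2b<a (ℕₚ.*-monoʳ-≤ 2 1≤b))
  >-≢21 : 2 ℕ.* b < a → ¬ (a ≡ 2 × b ≡ 1)
  >-≢21 2b<a (a≡2 , _) = >-≢2 2b<a a≡2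
  part-i : ((a < 2 ℕ.* b × 2 ∣ n) ⊎ (2 ℕ.* b < a × ¬ (2 ∣ n))) →
    SameSum (lhsPartial a b ā b̄ (4 ℕ.* ā ℕ.* b) L M) (Hpartial a b (toList as) L M)
  part-i (inj₁ (a<2b , 2∣n)) = same-sum-< L M as c (4 ℕ.* ā ℕ.* b) id a<2b (<-≢1 a<2b)
    (slope-i L M as c _ id (≡.cong not (2∣⇒isEven 2∣n)))
    where
    c  = cf (<-≢21 a<2b)
    id = identify-< as c a⊥b b<a a<2b isCF isBar
  part-i (inj₂ (2b<a , 2∤n)) = same-sum-> L M as c (4 ℕ.* ā ℕ.* b) id (ℕₚ.<⇒≤ 2b<a) (>-≢2 2b<a)
    (slope-i L M as c _ id (¬2∣⇒isOdd 2∤n))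
    where
    c  = cf (>-≢21 2b<a)
    id = identify-> as c a⊥b b<a 2b<a isCF isBar
  part-ii : ((a < 2 ℕ.* b × ¬ (2 ∣ n)) ⊎ (2 ℕ.* b ≤ a × 2 ∣ n)) →
    SameSum (lhsPartial a b ā b̄ (4 ℕ.* a ℕ.* b̄) L M) (Hpartial a b (toList as) L M)
  part-ii (inj₁ (a<2b , 2∤n)) = same-sum-< L M as c (4 ℕ.* a ℕ.* b̄) id a<2b (<-≢1 a<2b)
    (slope-ii L M as c _ id (≡.cong not (¬2∣⇒isOdd 2∤n)))
    where
    c  = cf (<-≢21 a<2b)
    id = identify-< as c a⊥b b<a a<2b isCF isBar
  -- Equality leads to (2, 1), where H has its own formula and the prescribed bars are (1, 0).
  part-ii (inj₂ (2b≤a , 2∣n)) with ℕₚ.m≤n⇒m<n∨m≡n 2b≤a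
  ... | inj₁ 2b<a = same-sum-> L M as c (4 ℕ.* a ℕ.* b̄) id 2b≤a (>-≢2 2b<a)
    (slope-ii L M as c _ id (2∣⇒isEven 2∣n))
    where
    c  = cf (>-≢21 2b<a)
    id = identify-> as c a⊥b b<a 2b<a isCF isBar
  ... | inj₂ 2b≡a with coprime-2b a⊥b 2b≡a
  ...   | ≡.refl , ≡.refl with proj₁ isBar ≡.refl
  ...     | ≡.refl , ≡.refl = same-sum-21 L M (toList as)
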